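{- Let $G$ be a simple graph on $n$ vertices and $m$ edges with designated source $s$ and sink $t$. There exists a data structure occupying $\mathcal{O}(\min\{m,n^{1.5}\})$ space that can report an $(s,t)$-mincut $C$ (including the contributing edges of $C$) in $\mathcal{O}(\min\{m,n^{1.5}\})$ time after the failure or insertion of any given pair of query edges in $G$.
   Context: A simple graph is an undirected unweighted graph having no parallel edges. An $(s,t)$-cut of $G=(V,E)$ is a set $C\subset V$ with $s\in C$, $t\in V\setminus C$; an edge contributes to $C$ if it has exactly one endpoint in $C$; the capacity of $C$ is the number of contributing edges, and an $(s,t)$-mincut is an $(s,t)$-cut of minimum capacity. A query consists of a pair of edges $e_1,e_2$ that are both removed from $G$ (failure), or a pair of edges that are both added to $G$ (insertion); the answer is an $(s,t)$-mincut of the resulting graph. -}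

module Defs where

open import Data.Bool using (if_then_else_)
open import Data.Fin using (Fin; toℕ)
open import Data.Fin.Properties using () renaming (_≟_ to _≟ᶠ_)
open import Data.Fin.Subset using (Subset; _∈_; _∉_)
open import Data.Fin.Subset.Properties using (_∈?_)
open import Data.List using (List; []; _∷_; _++_; [_]; length; map; concatMap; filter)
open import Data.List.Membership.Propositional using () renaming (_∈_ to _∈ˡ_)
open import Data.List.Relation.Binary.Permutation.Homogeneous using (Permutation)
open import Data.List.Relation.Unary.All using (All)
open import Data.List.Relation.Unary.AllPairs using (AllPairs)
open import Data.List.Relation.Unary.Any using (Any)
open import Data.List.Relation.Unary.Unique.Propositional using (Unique)
open import Data.Nat using (ℕ; zero; suc; _+_; _*_; _∸_; _^_; _⊔_; _≤_; _<_; _/_; _%_; _<ᵇ_; _≡ᵇ_)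
open import Data.Nat.Logarithm using (⌈log₂_⌉)
open import Data.Nat.Properties using (m^n≢0)
open import Data.Product using (_×_; ∃-syntax)
open import Data.Sum using (_⊎_)
open import Function.Bundles using (_⇔_)
open import Relation.Binary.PropositionalEquality using (_≡_; _≢_)
open import Relation.Nullary using (Dec; ¬_)
open import Relation.Nullary.Decidable using (¬?; _×-dec_; _⊎-dec_)

------------------------------------------------------------------------
-- Graphs and cuts

record Edge (n : ℕ) : Set where
  constructor edge
  field
    end₁ end₂ : Fin n
    loopless  : end₁ ≢ end₂

open Edge public

infix 4 _∥_ _∥?_

-- Edges are undirected: an edge may be presented with its endpoints in
-- either order, so _∥_ (rather than _≡_) is the equality of endpoint pairs.

_∥_ : ∀ {n} → Edge n → Edge n → Set
e ∥ f = (end₁ e ≡ end₁ f × end₂ e ≡ end₂ f)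
      ⊎ (end₁ e ≡ end₂ f × end₂ e ≡ end₁ f)

_∥?_ : ∀ {n} (e f : Edge n) → Dec (e ∥ f)
e ∥? f = ((end₁ e ≟ᶠ end₁ f) ×-dec (end₂ e ≟ᶠ end₂ f))
   ⊎-dec ((end₁ e ≟ᶠ end₂ f) ×-dec (end₂ e ≟ᶠ end₁ f))

-- The edges of a graph on the vertex set Fin n, with multiplicity.

Edges : ℕ → Set
Edges n = List (Edge n)

record SimpleGraph (n : ℕ) : Set where
  field
    edges       : Edges n
    no-parallel : AllPairs (λ e f → ¬ (e ∥ f)) edges

open SimpleGraph public

∣E_∣ : ∀ {n} → SimpleGraph n → ℕ
∣E G ∣ = length (edges G)

IsCut : ∀ {n} → Fin n → Fin n → Subset n → Set
IsCut s t C = s ∈ C × t ∉ C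

Contributes : ∀ {n} → Subset n → Edge n → Set
Contributes C e = (end₁ e ∈ C × end₂ e ∉ C) ⊎ (end₁ e ∉ C × end₂ e ∈ C)

contributes? : ∀ {n} (C : Subset n) (e : Edge n) → Dec (Contributes C e)
contributes? C e = ((end₁ e ∈? C) ×-dec ¬? (end₂ e ∈? C))
             ⊎-dec (¬? (end₁ e ∈? C) ×-dec (end₂ e ∈? C))

contributing : ∀ {n} → Subset n → Edges n → Edges n
contributing C = filter (contributes? C)

capacity : ∀ {n} → Edges n → Subset n → ℕ
capacity E C = length (contributing C E)

IsMincut : ∀ {n} → Edges n → Fin n → Fin n → Subset n → Set
IsMincut E s t C =
  IsCut s t C × (∀ C′ → IsCut s t C′ → capacity E C ≤ capacity E C′)

------------------------------------------------------------------------
-- Queries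

-- Inserted edges are arbitrary, so the resulting graph may be a multigraph.

data Query {n : ℕ} (G : SimpleGraph n) : Set where
  failure   : (e₁ e₂ : Edge n) → Any (e₁ ∥_) (edges G) → Any (e₂ ∥_) (edges G) →
              ¬ (e₁ ∥ e₂) → Query G
  insertion : (e₁ e₂ : Edge n) → Query G

updated : ∀ {n} (G : SimpleGraph n) → Query G → Edges n
updated G (failure e₁ e₂ _ _ _) =
  filter (λ e → ¬? (e ∥? e₁) ×-dec ¬? (e ∥? e₂)) (edges G)
updated G (insertion e₁ e₂)     = e₁ ∷ e₂ ∷ edges G

------------------------------------------------------------------------
-- A word RAM with w-bit words, programmed in a structured language

data Op : Set where
  add sub mul div mod less equal : Op

data Expr : Set where
  lit  : ℕ → Expr
  reg  : ℕ → Expr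
  load : Expr → Expr
  op   : Op → Expr → Expr → Expr

infixr 4 _⨟_
infix  5 _:=_

data Program : Set where
  skip    : Program
  _:=_    : ℕ → Expr → Program
  store   : Expr → Expr → Program
  output  : Expr → Program
  _⨟_     : Program → Program → Program
  ifnz    : Expr → Program → Program → Program
  whilenz : Expr → Program → Program

record State : Set where
  constructor state
  field
    regs mem : ℕ → ℕ
    out      : List ℕ

open State public

_[_↦_] : (ℕ → ℕ) → ℕ → ℕ → (ℕ → ℕ)
(f [ a ↦ v ]) b = if a ≡ᵇ b then v else f b

⟦_⟧ : Op → ℕ → ℕ → ℕ
⟦ add   ⟧ x y       = x + y
⟦ sub   ⟧ x y       = x ∸ y
⟦ mul   ⟧ x y       = x * y
⟦ div   ⟧ x zero    = 0
⟦ div   ⟧ x (suc y) = x / suc y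
⟦ mod   ⟧ x zero    = 0
⟦ mod   ⟧ x (suc y) = x % suc y
⟦ less  ⟧ x y       = if x <ᵇ y then 1 else 0
⟦ equal ⟧ x y       = if x ≡ᵇ y then 1 else 0

wrap : ℕ → ℕ → ℕ
wrap w x = _%_ x (2 ^ w) {{m^n≢0 2 w}}

eval : ℕ → State → Expr → ℕ
eval w σ (lit x)    = wrap w x
eval w σ (reg r)    = regs σ r
eval w σ (load a)   = mem σ (eval w σ a)
eval w σ (op o a b) = wrap w (⟦ o ⟧ (eval w σ a) (eval w σ b))

cost : Expr → ℕ
cost (lit _)    = 1
cost (reg _)    = 1
cost (load a)   = 1 + cost a
cost (op _ a b) = 1 + cost a + cost b

-- Exec w P σ σ′ τ : started in σ, P halts in σ′ after τ unit-cost steps.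

data Exec (w : ℕ) : Program → State → State → ℕ → Set where
  skip   : ∀ {σ} → Exec w skip σ σ 1
  assign : ∀ {σ r e} →
           Exec w (r := e) σ (record σ { regs = regs σ [ r ↦ eval w σ e ] }) (1 + cost e)
  store  : ∀ {σ a e} →
           Exec w (store a e) σ (record σ { mem = mem σ [ eval w σ a ↦ eval w σ e ] })
             (1 + cost a + cost e)
  output : ∀ {σ e} →
           Exec w (output e) σ (record σ { out = out σ ++ [ eval w σ e ] }) (1 + cost e)
  seq    : ∀ {P Q σ σ′ σ″ τ τ′} →
           Exec w P σ σ′ τ → Exec w Q σ′ σ″ τ′ → Exec w (P ⨟ Q) σ σ″ (τ + τ′)
  if-nz  : ∀ {e P Q σ σ′ τ} → eval w σ e ≢ 0 →
           Exec w P σ σ′ τ → Exec w (ifnz e P Q) σ σ′ (1 + cost e + τ)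
  if-z   : ∀ {e P Q σ σ′ τ} → eval w σ e ≡ 0 →
           Exec w Q σ σ′ τ → Exec w (ifnz e P Q) σ σ′ (1 + cost e + τ)
  while-nz : ∀ {e P σ σ′ σ″ τ τ′} → eval w σ e ≢ 0 →
           Exec w P σ σ′ τ → Exec w (whilenz e P) σ′ σ″ τ′ →
           Exec w (whilenz e P) σ σ″ (1 + cost e + τ + τ′)
  while-z  : ∀ {e P σ} → eval w σ e ≡ 0 →
           Exec w (whilenz e P) σ σ (1 + cost e)

------------------------------------------------------------------------
-- Data structures and their queries

-- Words of Θ(log n) bits; the constant factor suc k does not depend on n.

wordBits : ℕ → ℕ → ℕ
wordBits k n = suc k * ⌈log₂ n ⌉

Fits : ℕ → List ℕ → Set
Fits w D = All (_< 2 ^ w) D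

contents : List ℕ → ℕ → ℕ
contents []      _       = 0
contents (x ∷ D) zero    = x
contents (x ∷ D) (suc a) = contents D a

endpoints : ∀ {n} → Edge n → List ℕ
endpoints e = toℕ (end₁ e) ∷ toℕ (end₂ e) ∷ []

queryWords : ∀ {n} {G : SimpleGraph n} → Query G → List ℕ
queryWords (failure e₁ e₂ _ _ _) = 0 ∷ endpoints e₁ ++ endpoints e₂
queryWords (insertion e₁ e₂)     = 1 ∷ endpoints e₁ ++ endpoints e₂

-- The data structure D fills the memory from address 0, the query is passed
-- in registers 0 to 4, and everything else is zero.

initial : ∀ {n} {G : SimpleGraph n} → List ℕ → Query G → State
initial D q = state (contents (queryWords q)) (contents D) []

encode : ∀ {n} → List (Fin n) → Edges n → List ℕ
encode vs es = length vs ∷ map toℕ vs ++ length es ∷ concatMap endpoints es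

-- C is reported as a list of its vertices, followed by a list of its
-- contributing edges, each in any order and without repetition.

Reports : ∀ {n} → List ℕ → Edges n → Subset n → Set
Reports {n} ws E C = ∃[ vs ] ∃[ es ]
    ws ≡ encode vs es
  × Unique vs × (∀ (v : Fin n) → v ∈ˡ vs ⇔ v ∈ C)
  × Permutation _∥_ es (contributing C E)

-- x ≤ c · min {m , n^1.5}, where x ≤ c · n^1.5 is squared to avoid the
-- irrational power, and m is replaced by 1 if m = 0: even then a constant
-- amount of space and time is needed to answer an insertion.

_≤_·min⟨_,_^1·5⟩ : ℕ → ℕ → ℕ → ℕ → Set
x ≤ c ·min⟨ m , n ^1·5⟩ = x ≤ c * (1 ⊔ m) × x ^ 2 ≤ c ^ 2 * n ^ 3

{-# OPTIONS --safe #-}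

-- Take a maximum flow of value λ without directed cycles and order the vertices along it.  Every prefix of the
-- order is crossed by at most λ ≤ n flow edges; cutting the order into √n blocks of √n vertices shows that
-- only O(n^1.5) edges carry flow, because G is simple.  The other edges may be thinned out to two successive
-- spanning forests: a cut of capacity at most λ + 1 crosses at most one flow-free edge, and then all flow-free
-- edges that it crosses are in the forests.  What is left, with its residual capacities, is the data structure.
--
-- A query changes the capacity of a cut by an amount that depends only on the sides of the four endpoints of
-- the query edges and lies in a range of width 2, so a cut of capacity at least λ + 2 never beats a minimum
-- cut.  For each of the 16 patterns of sides and each slack k ∈ {0 , 1}, in the order of the resulting capacity,
-- one searches for a cut with that pattern that at most k residual units leave: explore the residual network
-- from the sources; if a sink is reached and k = 1, send one unit along the search path and explore once more.
-- The first cut found is a minimum cut after the query.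

module Submission where

open import Defs
open import Data.Bool using (Bool; true; false; if_then_else_; T; not; _∧_; _∨_; _xor_)
open import Data.Bool.Properties using (not-involutive; ∨-zeroʳ; not-¬; ∧-identityʳ; ∧-comm; xor-comm; xor-same)
  renaming (_≟_ to _≟ᵇ_)
open import Data.Empty using (⊥-elim)
open import Data.Fin using (Fin; toℕ; fromℕ<; zero; suc; #_)
open import Data.Fin.Properties using (toℕ<n; toℕ-injective; toℕ-fromℕ<; any?)
  renaming (_≟_ to _≟ᶠ_; suc-injective to suc-injectiveᶠ)
open import Data.Fin.Subset using (Subset) renaming (_∈_ to _∈ˢ_; _∉_ to _∉ˢ_)
open import Data.Fin.Subset.Properties using () renaming (_∈?_ to _∈ˢ?_)
open import Data.List
  using (List; []; _∷_; _++_; [_]; _∷ʳ_; length; filter; filterᵇ; map; concat; concatMap; tabulate; lookup; take; upTo;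
    allFin; initLast; InitLast; _∷ʳ′_)
open import Data.List.Properties hiding (≡-dec; sum-++)
open import Data.List.Membership.Propositional using (_∈_; _∉_; lose)
open import Data.List.Membership.Propositional.Properties
  using (∈-filter⁺; ∈-filter⁻; ∈-++⁺ʳ; ∈-++⁺ˡ; ∈-++⁻; ∈-length; ∈-map⁺; ∈-map⁻; ∈-allFin; ∈-concatMap⁺; ∈-upTo⁺; ∈-lookup)
import Data.List.Membership.DecPropositional as DecMembership
import Data.List.Relation.Binary.Permutation.Homogeneous as Homogeneous
open import Data.List.Relation.Binary.Permutation.Propositional
  using (_↭_; ↭-refl; ↭-prep; ↭-trans; ↭-sym; ↭-reflexive; ↭⇒↭ₛ)
open import Data.List.Relation.Binary.Permutation.Propositional.Properties
  using (map⁺; ++⁺ˡ; ↭-length; filter-↭) renaming (shift to ↭-shift)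
open import Data.List.Relation.Binary.Pointwise using (Pointwise; []; _∷_; Pointwise-length)
open import Data.List.Relation.Unary.All as All using (All; []; _∷_)
import Data.List.Relation.Unary.All.Properties as All
open import Data.List.Relation.Unary.AllPairs as AllPairs using (AllPairs; []; _∷_; allPairs?)
import Data.List.Relation.Unary.AllPairs.Properties as AllPairs
open import Data.List.Relation.Unary.Any as Any using (Any; here; there)
open import Data.List.Relation.Unary.Unique.Propositional using (Unique)
open import Data.Nat
open import Data.Nat.DivMod
open import Data.Nat.Induction using (<-rec)
import Data.Nat.ListAction as List
open import Data.Nat.ListAction.Properties using (sum-++; sum-↭)
open import Data.Nat.Logarithm using (⌈log₂_⌉; ⌈log₂⌉-mono-≤; ⌈log₂⌈n/2⌉⌉≡⌈log₂n⌉∸1)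
open import Data.Nat.Properties
open import Data.Nat.Tactic.RingSolver using (solve-∀)
open import Data.Product using (Σ-syntax; ∃-syntax; _×_; _,_; proj₁; proj₂)
open import Data.Product.Properties using (≡-dec)
open import Data.Sum using (_⊎_; inj₁; inj₂)
open import Data.Unit using (⊤; tt)
open import Data.Vec as Vec using (Vec; []; _∷_)
open import Data.Vec.Properties using (lookup∘tabulate; lookup⇒[]=; []=⇒lookup)
open import Function using (_∘_; id)
open import Function.Bundles using (mk⇔)
open import Relation.Binary.Definitions using (tri<; tri≈; tri>)
open import Relation.Binary.PropositionalEquality hiding ([_]; J)
open import Relation.Nullary using (yes; no; ¬_; Dec; ¬?; does)
open import Relation.Nullary.Decidable using (_×-dec_; _⊎-dec_; toWitness; dec-true; dec-false; T?)
open import Algebra.Properties.CommutativeMonoid.Sum +-0-commutativeMonoid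
  using (sum; sum-cong-≗; ∑-distrib-+; ∑-comm)

-- Residual networks

-- A flow is present only as residual capacities on half-edges, with total 2 per undirected edge,
-- and conservation is one identity over all vertex sets: outflow plus value at the source equals
-- crossing edges plus value at the sink. For an (s,t)-cut it says that the outflow is the excess of
-- the capacity over the maximum flow value, so residual units are all that a search has to control,
-- and pushing along a path is verified by telescoping over every vertex set at once. Prescribing
-- the sides of the query endpoints makes the change of capacity a constant. The stored network is
-- therefore searched as it is: a failed edge, stored or not, acts on the search only through the
-- pattern. The running time must not contain n when m is smaller. Hence visited vertices are
-- counted against half-edges, and no memory is ever cleared: every search takes untouched zero
-- regions. The number of attempts is constant, so this costs only address space, polynomial in n,
-- which words of 30 ⌈log₂ n⌉ bits can address.

bit : Bool → ℕ
bit b = if b then 1 else 0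

bit≤1 : ∀ b → bit b ≤ 1
bit≤1 true  = ≤-refl
bit≤1 false = z≤n

sum-≡0 : ∀ {m} {f : Fin m → ℕ} → (∀ i → f i ≡ 0) → sum f ≡ 0
sum-≡0 {zero}  eq = refl
sum-≡0 {suc m} eq = cong₂ _+_ (eq zero) (sum-≡0 (eq ∘ suc))

sum-≤-at : ∀ {m} (f : Fin m → ℕ) i → f i ≤ sum f
sum-≤-at f zero    = m≤m+n _ _
sum-≤-at f (suc i) = ≤-trans (sum-≤-at (f ∘ suc) i) (m≤n+m _ _)

-- Changing a single summand, without subtraction: each side adds the summand that the other sum has
-- in that place.
sum-exchange : ∀ {m} (f g : Fin m → ℕ) i → (∀ j → j ≢ i → f j ≡ g j) → sum f + g i ≡ sum g + f i
sum-exchange f g zero eq = begin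
  f zero + sum (f ∘ suc) + g zero   ≡⟨ cong (λ z → f zero + z + g zero) (sum-cong-≗ (λ j → eq (suc j) λ ())) ⟩
  f zero + sum (g ∘ suc) + g zero   ≡⟨ swap (f zero) (sum (g ∘ suc)) (g zero) ⟩
  g zero + sum (g ∘ suc) + f zero   ∎
  where
  open ≡-Reasoning
  swap : ∀ a b c → a + b + c ≡ c + b + a
  swap = solve-∀
sum-exchange f g (suc i) eq = begin
  f zero + sum (f ∘ suc) + g (suc i)     ≡⟨ +-assoc (f zero) _ _ ⟩
  f zero + (sum (f ∘ suc) + g (suc i))   ≡⟨ cong₂ _+_ (eq zero λ ()) (sum-exchange (f ∘ suc) (g ∘ suc) i λ j ne → eq (suc j) λ { refl → ne refl }) ⟩
  g zero + (sum (g ∘ suc) + f (suc i))   ≡⟨ +-assoc (g zero) _ _ ⟨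
  g zero + sum (g ∘ suc) + f (suc i)     ∎
  where open ≡-Reasoning

-- Here `false` is the direction from the first end to the second, so an edge whose first end is the
-- one inside contributes `ρ false`.
leaving : Bool → Bool → (Bool → ℕ) → ℕ
leaving true  false ρ = ρ false
leaving false true  ρ = ρ true
leaving _     _     ρ = 0

leaving-cong : ∀ p q {f g : Bool → ℕ} → (∀ b → f b ≡ g b) → leaving p q f ≡ leaving p q g
leaving-cong true  true  eq = refl
leaving-cong true  false eq = eq false
leaving-cong false true  eq = eq true
leaving-cong false false eq = refl

module Network {n M : ℕ} (x y : Fin M → Fin n) where

  Half : Set
  Half = Fin M × Bool

  tw : Half → Half
  tw (i , b) = i , not b

  tl hd : Half → Fin n
  tl (i , false) = x i
  tl (i , true)  = y i
  hd h = tl (tw h)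

  leavingAt : (Half → ℕ) → (Fin n → Bool) → Fin M → ℕ
  leavingAt ρ χ i = leaving (χ (x i)) (χ (y i)) (λ b → ρ (i , b))

  outflow : (Half → ℕ) → (Fin n → Bool) → ℕ
  outflow ρ χ = sum (leavingAt ρ χ)

  Closed : (Half → ℕ) → (Fin n → Bool) → Set
  Closed ρ χ = ∀ h → χ (tl h) ≡ true → 0 < ρ h → χ (hd h) ≡ true

  closed⇒outflow≡0 : ∀ {ρ χ} → Closed ρ χ → outflow ρ χ ≡ 0
  closed⇒outflow≡0 {ρ} {χ} closed = sum-≡0 edge≡0
    where
    edge≡0 : ∀ i → leavingAt ρ χ i ≡ 0
    edge≡0 i with χ (x i) in ex | χ (y i) in ey | ρ (i , false) in ef | ρ (i , true) in et
    ... | true  | true  | _     | _     = refl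
    ... | false | false | _     | _     = refl
    ... | true  | false | zero  | _     = ef
    ... | false | true  | _     | zero  = et
    ... | true  | false | suc k | _     with () ← trans (sym (closed (i , false) ex (subst (0 <_) (sym ef) z<s))) ey
    ... | false | true  | _     | suc k with () ← trans (sym (closed (i , true) ey (subst (0 <_) (sym et) z<s))) ex

  outflow≡0⇒closed : ∀ {ρ χ} → outflow ρ χ ≡ 0 → Closed ρ χ
  outflow≡0⇒closed {ρ} {χ} o≡0 (i , b) in-tl ρ>0 with χ (hd (i , b)) in e
  ... | true  = refl
  ... | false = ⊥-elim (<-irrefl refl (<-≤-trans ρ>0 (≤-trans (bound b in-tl e) (≤-trans (sum-≤-at (leavingAt ρ χ) i) (≤-reflexive o≡0)))))
    where
    bound : ∀ b → χ (tl (i , b)) ≡ true → χ (hd (i , b)) ≡ false → ρ (i , b) ≤ leavingAt ρ χ i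
    bound false p q rewrite p | q = ≤-refl
    bound true  p q rewrite p | q = ≤-refl

  -- The four positions of the ends relative to `χ` collapse into one equation once the indicator
  -- bits are added crosswise. Along a path these bits telescope, and only those of its two ends
  -- remain.
  outflow-push : ∀ {ρ ρ′} h → (∀ j b → j ≢ proj₁ h → ρ′ (j , b) ≡ ρ (j , b)) →
    suc (ρ′ h) ≡ ρ h → ρ′ (tw h) ≡ suc (ρ (tw h)) →
    ∀ χ → outflow ρ′ χ + bit (χ (tl h)) ≡ outflow ρ χ + bit (χ (hd h))
  outflow-push {ρ} {ρ′} (i , b) others down up χ = +-cancelʳ-≡ (leavingAt ρ χ i) _ _ (begin
    outflow ρ′ χ + bit (χ (tl h)) + leavingAt ρ χ i   ≡⟨ swap (outflow ρ′ χ) _ _ ⟩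
    outflow ρ′ χ + leavingAt ρ χ i + bit (χ (tl h))   ≡⟨ cong (_+ bit (χ (tl h))) (sum-exchange (leavingAt ρ′ χ) (leavingAt ρ χ) i rest) ⟩
    outflow ρ χ + leavingAt ρ′ χ i + bit (χ (tl h))   ≡⟨ +-assoc (outflow ρ χ) _ _ ⟩
    outflow ρ χ + (leavingAt ρ′ χ i + bit (χ (tl h))) ≡⟨ cong (outflow ρ χ +_) (local b down up) ⟩
    outflow ρ χ + (bit (χ (hd h)) + leavingAt ρ χ i)  ≡⟨ +-assoc (outflow ρ χ) _ _ ⟨
    outflow ρ χ + bit (χ (hd h)) + leavingAt ρ χ i    ∎)
    where
    open ≡-Reasoning
    h = i , b
    swap : ∀ a b c → a + b + c ≡ a + c + b
    swap = solve-∀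
    rest : ∀ j → j ≢ i → leavingAt ρ′ χ j ≡ leavingAt ρ χ j
    rest j ne = leaving-cong (χ (x j)) (χ (y j)) (λ b → others j b ne)
    local : ∀ b → suc (ρ′ (i , b)) ≡ ρ (i , b) → ρ′ (i , not b) ≡ suc (ρ (i , not b)) →
      leavingAt ρ′ χ i + bit (χ (tl (i , b))) ≡ bit (χ (hd (i , b))) + leavingAt ρ χ i
    local false d u with χ (x i) | χ (y i)
    ... | true  | true  = refl
    ... | true  | false = trans (+-comm _ 1) d
    ... | false | true  = trans (+-identityʳ _) u
    ... | false | false = refl
    local true d u with χ (x i) | χ (y i)
    ... | true  | true  = refl
    ... | true  | false = trans (+-identityʳ _) u
    ... | false | true  = trans (+-comm _ 1) d
    ... | false | false = refl

-- Executing programs symbolically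

<ᵇ-true : ∀ {x y} → x < y → (x <ᵇ y) ≡ true
<ᵇ-true {x} {y} x<y with x <ᵇ y | <⇒<ᵇ x<y
... | true | _ = refl

<ᵇ-false : ∀ {x y} → ¬ x < y → (x <ᵇ y) ≡ false
<ᵇ-false {x} {y} x≮y with x <ᵇ y | <ᵇ⇒< x y
... | true  | f = ⊥-elim (x≮y (f tt))
... | false | _ = refl

≡ᵇ-true : ∀ {x y} → x ≡ y → (x ≡ᵇ y) ≡ true
≡ᵇ-true {x} {y} eq with x ≡ᵇ y | ≡⇒≡ᵇ x y eq
... | true | _ = refl

≡ᵇ-false : ∀ {x y} → x ≢ y → (x ≡ᵇ y) ≡ false
≡ᵇ-false {x} {y} neq with x ≡ᵇ y | ≡ᵇ⇒≡ x y
... | true  | f = ⊥-elim (neq (f tt))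
... | false | _ = refl

upd-same : ∀ (f : ℕ → ℕ) {a b v} → a ≡ b → (f [ a ↦ v ]) b ≡ v
upd-same f eq rewrite ≡ᵇ-true eq = refl

upd-other : ∀ (f : ℕ → ℕ) {a b v} → a ≢ b → (f [ a ↦ v ]) b ≡ f b
upd-other f neq rewrite ≡ᵇ-false neq = refl

setReg : State → ℕ → ℕ → State
setReg σ r v = record σ { regs = regs σ [ r ↦ v ] }

setMem : State → ℕ → ℕ → State
setMem σ a v = record σ { mem = mem σ [ a ↦ v ] }

module _ (w : ℕ) where

  -- Total correctness with a time bound. The postcondition may itself be a `Run`, so a sequence of
  -- statements is verified in continuation style, in the order of execution.
  Run : Program → State → ℕ → (State → Set) → Set
  Run P σ t Q = ∃[ σ′ ] ∃[ τ ] (Exec w P σ σ′ τ × τ ≤ t × Q σ′)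

  -- A record instead of the bare equation lets unification recover the expression and its value,
  -- which it could not do through `eval`.
  record Ev (σ : State) (e : Expr) (v : ℕ) : Set where
    constructor ev
    field value : eval w σ e ≡ v

module _ {w : ℕ} where

  run-weaken : ∀ {P σ t u} {Q R : State → Set} → Run w P σ t Q → t ≤ u →
               (∀ {σ′} → Q σ′ → R σ′) → Run w P σ u R
  run-weaken (σ′ , τ , x , b , q) t≤u f = σ′ , τ , x , ≤-trans b t≤u , f q

  within : ∀ {P σ t u} {Q : State → Set} {_ : T (t ≤ᵇ u)} → Run w P σ t Q → Run w P σ u Q
  within {t = t} {u} {_} {p} x = run-weaken x (≤ᵇ⇒≤ t u p) (λ q → q)

  run-skip : ∀ {σ} {Q : State → Set} → Q σ → Run w skip σ 1 Q
  run-skip q = _ , _ , skip , ≤-refl , q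

  run-:= : ∀ {r e σ v} {Q : State → Set} → Ev w σ e v → Q (setReg σ r v) →
           Run w (r := e) σ (1 + cost e) Q
  run-:= (ev refl) q = _ , _ , assign , ≤-refl , q

  run-store : ∀ {a e σ x v} {Q : State → Set} → Ev w σ a x → Ev w σ e v → Q (setMem σ x v) →
              Run w (store a e) σ (1 + cost a + cost e) Q
  run-store (ev refl) (ev refl) q = _ , _ , store , ≤-refl , q

  run-output : ∀ {e σ v} {Q : State → Set} → Ev w σ e v →
               Q (record σ { out = out σ ++ [ v ] }) → Run w (output e) σ (1 + cost e) Q
  run-output (ev refl) q = _ , _ , output , ≤-refl , q

  run-⨟ : ∀ {P P′ σ t u} {R : State → Set} → Run w P σ t (λ σ′ → Run w P′ σ′ u R) →
          Run w (P ⨟ P′) σ (t + u) R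
  run-⨟ (σ′ , τ , x , b , σ″ , τ′ , x′ , b′ , q) =
    σ″ , _ , seq x x′ , +-mono-≤ b b′ , q

  run-then : ∀ {e P P′ σ v t} {Q : State → Set} → Ev w σ e v → v ≢ 0 → Run w P σ t Q →
             Run w (ifnz e P P′) σ (1 + cost e + t) Q
  run-then {e = e} (ev refl) v≢0 (σ′ , τ , x , b , q) = σ′ , _ , if-nz v≢0 x , +-monoʳ-≤ (1 + cost e) b , q

  run-else : ∀ {e P P′ σ v t} {Q : State → Set} → Ev w σ e v → v ≡ 0 → Run w P′ σ t Q →
             Run w (ifnz e P P′) σ (1 + cost e + t) Q
  run-else {e = e} (ev refl) v≡0 (σ′ , τ , x , b , q) = σ′ , _ , if-z v≡0 x , +-monoʳ-≤ (1 + cost e) b , q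

  -- φ is a potential: it bounds the number of iterations still to come.

  run-while : ∀ {e P K} {I : ℕ → State → Set} {Q : State → Set} →
    (∀ φ {σ} → I φ σ → ∃[ v ] Ev w σ e v × (v ≡ 0 → Q σ) ×
      (v ≢ 0 → Run w P σ K (λ σ′ → ∃[ φ′ ] φ′ < φ × I φ′ σ′))) →
    ∀ φ {σ} → I φ σ → Run w (whilenz e P) σ (1 + cost e + φ * (1 + cost e + K)) Q
  run-while {e} {P} {K} {I} {Q} step φ i = go φ ≤-refl i
    where
    c = 1 + cost e + K
    go : ∀ {φ} b {σ} → φ ≤ b → I φ σ → Run w (whilenz e P) σ (1 + cost e + b * c) Q
    go {φ} b {σ} φ≤b i with step φ i
    ... | zero , ev val , stop , _ =
      σ , _ , while-z val , m≤m+n _ _ , stop refl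
    ... | suc v , ev val , _ , more with more (λ ())
    go {φ} zero {σ} φ≤b i | suc v , ev val , _ , _ | _ , _ , _ , _ , φ′ , φ′<φ , _ =
      ⊥-elim (n≮0 (≤-trans φ′<φ φ≤b))
    go {φ} (suc b) {σ} φ≤b i | suc v , ev val , _ , _ | σ′ , τ , x , τ≤K , φ′ , φ′<φ , i′
      with go b (s≤s⁻¹ (≤-trans φ′<φ φ≤b)) i′
    ... | σ″ , τ′ , x′ , τ′≤ , q =
      σ″ , _ , while-nz (λ eq → 0≢1+n (trans (sym eq) val)) x x′ , bound , q
      where
      bound : 1 + cost e + τ + τ′ ≤ 1 + cost e + (c + b * c)
      bound = begin
        1 + cost e + τ + τ′                    ≤⟨ +-mono-≤ (+-monoʳ-≤ (1 + cost e) τ≤K) τ′≤ ⟩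
        c + (1 + cost e + b * c)               ≡⟨ +-assoc c (1 + cost e) (b * c) ⟨
        c + (1 + cost e) + b * c               ≡⟨ cong (_+ b * c) (+-comm c (1 + cost e)) ⟩
        1 + cost e + c + b * c                 ≡⟨ +-assoc (1 + cost e) c (b * c) ⟩
        1 + cost e + (c + b * c)               ∎
        where open ≤-Reasoning

  wrap-< : ∀ {x} → x < 2 ^ w → wrap w x ≡ x
  wrap-< x< = m<n⇒m%n≡m {{m^n≢0 2 w}} x<

  ev-lit : ∀ {σ x} → x < 2 ^ w → Ev w σ (lit x) x
  ev-lit x< = ev (wrap-< x<)

  ev-reg : ∀ {σ r v} → regs σ r ≡ v → Ev w σ (reg r) v
  ev-reg = ev

  ev-load : ∀ {σ a x v} → Ev w σ a x → mem σ x ≡ v → Ev w σ (load a) v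
  ev-load (ev refl) q = ev q

  ev-add : ∀ {σ a b x y} → Ev w σ a x → Ev w σ b y → x + y < 2 ^ w → Ev w σ (op add a b) (x + y)
  ev-add (ev refl) (ev refl) x< = ev (wrap-< x<)

  ev-sub : ∀ {σ a b x y} → Ev w σ a x → Ev w σ b y → x < 2 ^ w → Ev w σ (op sub a b) (x ∸ y)
  ev-sub {x = x} {y} (ev refl) (ev refl) x< = ev (wrap-< (≤-<-trans (m∸n≤m x y) x<))

  ev-mul : ∀ {σ a b x y} → Ev w σ a x → Ev w σ b y → x * y < 2 ^ w → Ev w σ (op mul a b) (x * y)
  ev-mul (ev refl) (ev refl) x< = ev (wrap-< x<)

  ev-lt : ∀ {σ a b x y} → Ev w σ a x → Ev w σ b y → 1 < 2 ^ w → x < y → Ev w σ (op less a b) 1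
  ev-lt (ev refl) (ev refl) 1< x<y = ev (trans (cong (λ b → wrap w (if b then 1 else 0)) (<ᵇ-true x<y)) (wrap-< 1<))

  ev-≮ : ∀ {σ a b x y} → Ev w σ a x → Ev w σ b y → 1 < 2 ^ w → ¬ x < y → Ev w σ (op less a b) 0
  ev-≮ (ev refl) (ev refl) 1< x≮y = ev (trans (cong (λ b → wrap w (if b then 1 else 0)) (<ᵇ-false x≮y)) (wrap-< (<-trans z<s 1<)))

  ev-eq : ∀ {σ a b x y} → Ev w σ a x → Ev w σ b y → 1 < 2 ^ w → x ≡ y → Ev w σ (op equal a b) 1
  ev-eq (ev refl) (ev refl) 1< x≡y = ev (trans (cong (λ b → wrap w (if b then 1 else 0)) (≡ᵇ-true x≡y)) (wrap-< 1<))

  ev-≢ : ∀ {σ a b x y} → Ev w σ a x → Ev w σ b y → 1 < 2 ^ w → x ≢ y → Ev w σ (op equal a b) 0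
  ev-≢ (ev refl) (ev refl) 1< x≢y = ev (trans (cong (λ b → wrap w (if b then 1 else 0)) (≡ᵇ-false x≢y)) (wrap-< (<-trans z<s 1<)))

-- The query program

-- With Z the word at address 3, the memory consists of regions of Z words.  Region 0 holds s, t, the end of
-- the records, Z, and a record (tail, head, residual capacity, twin) per half-edge; region 1 the first and
-- region 2 the next half-edges of the adjacency lists.  Each search marks vertices in the region that starts
-- at register 5, queues them in the region behind it, and reads the sent flow from the one at register 6.
-- Registers: 7 half-edge, 8 and 9 ends of the queue, 10 sink reached, 11 whether there is one, 12 scratch,
-- 13 number of reported edges.
-- A mark is 1 for a source, and otherwise the half-edge (at address 4 or more) through which the search came.

sizeᵉ : Expr
sizeᵉ = load (lit 3)

firstᵉ nextᵉ markᵉ queueᵉ usedᵉ : Expr → Expr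
firstᵉ e = op add sizeᵉ e
nextᵉ e  = op add (op add sizeᵉ sizeᵉ) e
markᵉ e  = op add (reg 5) e
queueᵉ e = op add (op add (reg 5) sizeᵉ) e
usedᵉ e  = op add (reg 6) e

visit : Expr → Program
visit m = ifnz (load (markᵉ (reg 12))) skip
  (store (markᵉ (reg 12)) m ⨟ store (queueᵉ (reg 8)) (reg 12) ⨟ 8 := op add (reg 8) (lit 1))

-- Tests `u h < r h + u (tw h)`, positivity of the residual capacity after the sent flow, with the
-- subtraction moved to the other side.
liveᵉ : Expr
liveᵉ = op less (load (usedᵉ (reg 7)))
  (op add (load (op add (reg 7) (lit 2))) (load (usedᵉ (load (op add (reg 7) (lit 3))))))

scan : Program
scan = ifnz liveᵉ (12 := load (op add (reg 7) (lit 1)) ⨟ visit (reg 7)) skip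
     ⨟ 7 := load (nextᵉ (reg 7))

-- Scanning one half-edge and popping one vertex are alternative bodies of a single loop, so that
-- one potential bounds the whole search. Addresses of half-edges are at least 4, hence 0 in
-- register 7 means an exhausted adjacency list.
explore : Program
explore = ifnz (reg 7) scan
  (7 := load (firstᵉ (load (queueᵉ (reg 9)))) ⨟ 9 := op add (reg 9) (lit 1))

plant : List Expr → Program
plant []       = skip
plant (e ∷ es) = (12 := e ⨟ visit (lit 1)) ⨟ plant es

search : List Expr → Program
search es = 8 := lit 0 ⨟ 9 := lit 0 ⨟ 7 := lit 0 ⨟ plant es ⨟
  whilenz (op add (reg 7) (op less (reg 9) (reg 8))) explore

-- A reached vertex has mark 1 or an address of at least 4, so mark minus one vanishes exactly at a
-- source.
unwind : Program
unwind = whilenz (op sub (load (markᵉ (reg 10))) (lit 1))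
  (12 := load (markᵉ (reg 10)) ⨟ store (usedᵉ (reg 12)) (lit 1) ⨟ 10 := load (reg 12))

probe : List Expr → Program
probe []       = skip
probe (e ∷ es) = 12 := e ⨟ ifnz (load (markᵉ (reg 12))) (11 := lit 1 ⨟ 10 := reg 12) skip ⨟ probe es

-- Separates the addresses `4 + 8 * i` of forward half-edges from the addresses `8 + 8 * j` of
-- backward ones.
4*odd : ∀ i j → 8 * i ≢ 4 + 8 * j
4*odd zero    j ()
4*odd (suc i) zero eq = 1+n≢0 (+-cancelˡ-≡ 4 (suc (3 + 8 * i)) 0 (trans (sym (*-suc 8 i)) eq))
4*odd (suc i) (suc j) eq = 4*odd i j (+-cancelˡ-≡ 8 _ _ (trans (sym (*-suc 8 i)) (trans eq (cong (4 +_) (*-suc 8 j)))))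

forEdges : Program → Program
forEdges P = 7 := lit 4 ⨟ whilenz (op less (reg 7) (load (lit 2))) (P ⨟ 7 := op add (reg 7) (lit 8))

link : Expr → Program
link e = store (nextᵉ e) (load (firstᵉ (load e))) ⨟ store (firstᵉ (load e)) e

prepare : Program
prepare = forEdges (link (reg 7) ⨟ link (op add (reg 7) (lit 4))) ⨟ 5 := op add (op add sizeᵉ sizeᵉ) sizeᵉ

-- A pattern prescribes the sides of the four endpoints of the query edges.

Pattern : Set
Pattern = Vec Bool 4

ends : Bool → Pattern → List (Fin 4)
ends b π = filter (λ i → Vec.lookup π i ≟ᵇ b) (allFin 4)

endᵉ : Fin 4 → Expr
endᵉ i = reg (suc (toℕ i))

sourcesᵉ sinksᵉ : Pattern → List Expr
sourcesᵉ π = load (lit 0) ∷ map endᵉ (ends true π)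
sinksᵉ   π = load (lit 1) ∷ map endᵉ (ends false π)

advanceᵉ : Expr → Expr
advanceᵉ e = op add (op add e sizeᵉ) sizeᵉ

explorePattern : Pattern → Program
explorePattern π = search (sourcesᵉ π) ⨟ 11 := lit 0 ⨟ probe (sinksᵉ π)

-- With register 5 at region j, the marks, the queue and the sent flow occupy regions j, j+1 and
-- j+2. The retry moves its marks to region j+3 but leaves register 6 alone, so it explores the
-- network as changed by `unwind`.
attempt : Pattern → Bool → Program
attempt π slack = 6 := advanceᵉ (reg 5) ⨟ explorePattern π ⨟
  (if slack then ifnz (reg 11) (unwind ⨟ 5 := op add (advanceᵉ (reg 5)) sizeᵉ ⨟ explorePattern π) skip else skip)

outflow-cong : ∀ {n M} (x y : Fin M → Fin n) {ρ ρ′} → (∀ h → ρ h ≡ ρ′ h) → ∀ χ →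
  Network.outflow x y ρ χ ≡ Network.outflow x y ρ′ χ
outflow-cong x y eq χ = sum-cong-≗ (λ i → leaving-cong (χ (x i)) (χ (y i)) (λ b → eq (i , b)))

-- Linear running-time bounds

abstract

  -- The search cost for at most 5 seeds, the source and four query ends, and `2 * m` half-edges;
  -- then 2 for resetting register 11 and 1 + 5 · 30 for probing at most 5 sinks.
  exploreCost : ℕ → ℕ
  exploreCost m = 100 + 5 * 40 + (2 * (2 * m) + 5 * suc (2 * m)) * 100 + (2 + 151)

  exploreCost-def : ∀ m → 100 + 5 * 40 + (2 * (2 * m) + 5 * suc (2 * m)) * 100 + (2 + 151) ≡ exploreCost m
  exploreCost-def m = refl

Linear : (ℕ → ℕ) → Set
Linear f = ∃[ c ] ∀ m → f m ≤ c * suc m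

linear-const : ∀ k → Linear (λ _ → k)
linear-const k = k , λ m → m≤m*n k (suc m)

linear-id : Linear (λ m → m)
linear-id = 1 , λ m → ≤-trans (n≤1+n m) (≤-reflexive (sym (*-identityˡ (suc m))))

linear-+ : ∀ {f g} → Linear f → Linear g → Linear (λ m → f m + g m)
linear-+ (c , f≤) (d , g≤) = c + d , λ m → ≤-trans (+-mono-≤ (f≤ m) (g≤ m)) (≤-reflexive (sym (*-distribʳ-+ (suc m) c d)))

linear-* : ∀ {f} k → Linear f → Linear (λ m → f m * k)
linear-* {f} k (c , f≤) = c * k , λ m → ≤-trans (*-monoˡ-≤ k (f≤ m)) (≤-reflexive (arith c (suc m) k))
  where
  arith : ∀ a b c → a * b * c ≡ a * c * b
  arith = solve-∀

abstract

  exploreCost-linear : Linear exploreCost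
  exploreCost-linear = linear-+ (linear-+ (linear-const (100 + 5 * 40)) (linear-* 100 (linear-+
      (linear-+ twice (linear-+ twice (linear-const 0)))
      (linear-+ (linear-+ (linear-const 1) twice) (linear-+ (linear-+ (linear-const 1) twice) (linear-+ (linear-+ (linear-const 1) twice)
        (linear-+ (linear-+ (linear-const 1) twice) (linear-+ (linear-+ (linear-const 1) twice) (linear-const 0)))))))))
    (linear-const (2 + 151))
    where
    twice : Linear (λ m → 2 * m)
    twice = linear-+ linear-id (linear-+ linear-id (linear-const 0))

-- The term 160 + 60 m is 10 + 30 (5 + 2 m): the search path has at most as many arcs as there are
-- seeds and half-edges. The 11 pays for moving register 5, the 8 for setting register 6.
retryCost attemptCost : ℕ → ℕ
retryCost m = 2 + (160 + m * 60 + (11 + exploreCost m))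
attemptCost m = 8 + (exploreCost m + retryCost m)

attemptCost-linear : Linear attemptCost
attemptCost-linear = linear-+ (linear-const 8) (linear-+ exploreCost-linear
  (linear-+ (linear-const 2) (linear-+ (linear-+ (linear-const 160) (linear-* 60 linear-id))
    (linear-+ (linear-const 11) exploreCost-linear))))

-- Reporting a cut

isZeroᵉ : Expr → Expr
isZeroᵉ e = op equal e (lit 0)

-- Marks of reached vertices are various nonzero numbers, so each mark is first reduced to a bit;
-- only then does comparison tell the sides apart.
crossᵉ : Expr → Expr → Expr
crossᵉ e f = isZeroᵉ (op equal (isZeroᵉ (load (markᵉ e))) (isZeroᵉ (load (markᵉ f))))

end₁ᵉ end₂ᵉ : Expr
end₁ᵉ = load (reg 7)
end₂ᵉ = load (op add (reg 7) (lit 1))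

listVertices : Program
listVertices = 7 := reg 8 ⨟ whilenz (reg 7) (7 := op sub (reg 7) (lit 1) ⨟ output (load (queueᵉ (reg 7))))

tallyExtra emitExtra : List (Expr × Expr) → Program
tallyExtra []             = skip
tallyExtra ((e , f) ∷ es) = 13 := op add (reg 13) (crossᵉ e f) ⨟ tallyExtra es
emitExtra []              = skip
emitExtra ((e , f) ∷ es)  = ifnz (crossᵉ e f) (output e ⨟ output f) skip ⨟ emitExtra es

-- The number of edges precedes the edges in the output, hence a counting pass and an emitting pass
-- over the same records.
report : Expr → List (Expr × Expr) → Program
report keep xs = output (reg 8) ⨟ listVertices ⨟ 13 := lit 0 ⨟ tallyExtra xs ⨟
  forEdges (12 := keep ⨟ 13 := op add (reg 13) (op mul (crossᵉ end₁ᵉ end₂ᵉ) (reg 12))) ⨟ output (reg 13) ⨟ emitExtra xs ⨟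
  forEdges (12 := keep ⨟ ifnz (op mul (crossᵉ end₁ᵉ end₂ᵉ) (reg 12)) (output end₁ᵉ ⨟ output end₂ᵉ) skip)

filterᵇ-∷ʳ : ∀ {A : Set} (p : A → Bool) xs x → filterᵇ p (xs ∷ʳ x) ≡ filterᵇ p xs ++ (if p x then [ x ] else [])
filterᵇ-∷ʳ p [] x with p x
... | true  = refl
... | false = refl
filterᵇ-∷ʳ p (y ∷ xs) x with p y
... | true  = cong (y ∷_) (filterᵇ-∷ʳ p xs x)
... | false = filterᵇ-∷ʳ p xs x

crosses : ∀ {n} → (Fin n → Bool) → Edge n → Bool
crosses χ e = χ (end₁ e) xor χ (end₂ e)

reportCost : ℕ → ℕ → ℕ
reportCost k m = 2 + ((4 + (5 + 2 * m) * 14) + (2 + (41 + ((10 + m * (10 + (1 + k + 25))) + (2 + (51 + (10 + m * (10 + (1 + k + 40)))))))))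

reportCost-linear : ∀ k → Linear (reportCost k)
reportCost-linear k = linear-+ (linear-const 2) (linear-+ (linear-+ (linear-const 4) (linear-* 14 (linear-+ (linear-const 5) twice)))
  (linear-+ (linear-const 2) (linear-+ (linear-const 41) (linear-+ (linear-+ (linear-const 10) (linear-* _ linear-id))
  (linear-+ (linear-const 2) (linear-+ (linear-const 51) (linear-+ (linear-const 10) (linear-* _ linear-id))))))))
  where
  twice : Linear (λ m → 2 * m)
  twice = linear-+ linear-id (linear-+ linear-id (linear-const 0))

-- The schedule of patterns and slacks

Try : Set
Try = Pattern × Bool

bools : ∀ k → List (Vec Bool k)
bools zero    = [ [] ]
bools (suc k) = map (true ∷_) (bools k) ++ map (false ∷_) (bools k)

∈-bools : ∀ {k} (v : Vec Bool k) → v ∈ bools k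
∈-bools []          = here refl
∈-bools (true ∷ v)  = ∈-++⁺ˡ (∈-map⁺ (true ∷_) (∈-bools v))
∈-bools (false ∷ v) = ∈-++⁺ʳ (map (true ∷_) (bools _)) (∈-map⁺ (false ∷_) (∈-bools v))

crossings : Pattern → ℕ
crossings π = bit (Vec.lookup π (# 0) xor Vec.lookup π (# 1)) + bit (Vec.lookup π (# 2) xor Vec.lookup π (# 3))

-- The change of the capacity caused by the query, shifted by 2 for failures.

shift : Bool → Pattern → ℕ
shift inserting π = if inserting then crossings π else 2 ∸ crossings π

-- The capacity after the query of a cut with this pattern and outflow `bit slack`, up to constants
-- that are the same for all cuts.
level : Bool → Try → ℕ
level inserting (π , slack) = bit slack + shift inserting π

shift≤2 : ∀ ins π → shift ins π ≤ 2
shift≤2 true  π = +-mono-≤ (bit≤1 (Vec.lookup π (# 0) xor Vec.lookup π (# 1))) (bit≤1 (Vec.lookup π (# 2) xor Vec.lookup π (# 3)))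
shift≤2 false π = m∸n≤m 2 (crossings π)

allTries : List Try
allTries = concatMap (λ π → (π , false) ∷ (π , true) ∷ []) (bools 4)

-- A bucket sort by level; four buckets suffice because the slack contributes at most 1 and the
-- shift at most 2.
schedule : Bool → List Try
schedule ins = concatMap (λ ℓ → filter (λ t → level ins t ≟ ℓ) allTries) (upTo 4)

∈-allTries : ∀ t → t ∈ allTries
∈-allTries (π , b) = ∈-concatMap⁺ (λ π → (π , false) ∷ (π , true) ∷ []) (lose (∈-bools π) (at b))
  where
  at : ∀ b → (π , b) ∈ (π , false) ∷ (π , true) ∷ []
  at false = here refl
  at true  = there (here refl)

∈-schedule : ∀ ins t → t ∈ schedule ins
∈-schedule ins t@(π , b) = ∈-concatMap⁺ (λ ℓ → filter (λ t → level ins t ≟ ℓ) allTries)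
  (lose (∈-upTo⁺ (s≤s (+-mono-≤ (bit≤1 b) (shift≤2 ins π)))) (∈-filter⁺ (λ t′ → level ins t′ ≟ level ins t) (∈-allTries t) refl))

-- The schedules are closed lists, so their order is established by evaluating this decision.
sorted? : ∀ ins → Dec (AllPairs (λ t t′ → level ins t ≤ level ins t′) (schedule ins))
sorted? ins = allPairs? (λ t t′ → level ins t ≤? level ins t′) (schedule ins)

schedule-sorted : ∀ ins → AllPairs (λ t t′ → level ins t ≤ level ins t′) (schedule ins)
schedule-sorted false = toWitness {a? = sorted? false} tt
schedule-sorted true  = toWitness {a? = sorted? true} tt

-- What stopping at the first success gives: every try that has not already failed stands at this
-- place or later, and thus at no lower level.
sorted-least : ∀ {ins t ts} fs → AllPairs (λ t t′ → level ins t ≤ level ins t′) (fs ++ t ∷ ts) →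
  ∀ {t′} → t′ ∈ fs ++ t ∷ ts → t′ ∉ fs → level ins t ≤ level ins t′
sorted-least [] (ps ∷ _) (here refl) t′∉ = ≤-refl
sorted-least [] (ps ∷ _) (there t′∈) t′∉ = All.lookup ps t′∈
sorted-least (f ∷ fs) (_ ∷ ps) (here refl) t′∉ = ⊥-elim (t′∉ (here refl))
sorted-least (f ∷ fs) (_ ∷ ps) (there t′∈) t′∉ = sorted-least fs ps t′∈ (t′∉ ∘ there)

-- The two products test the two orientations, so the value is zero exactly when the current edge is
-- not parallel to the query edge.
differᵉ : Expr → Expr → Expr
differᵉ e f = op add (op mul (op equal end₁ᵉ e) (op equal end₂ᵉ f)) (op mul (op equal end₁ᵉ f) (op equal end₂ᵉ e))

keepᵉ : Bool → Expr
keepᵉ true  = lit 1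
keepᵉ false = isZeroᵉ (op add (differᵉ (reg 1) (reg 2)) (differᵉ (reg 3) (reg 4)))

extrasᵉ : Bool → List (Expr × Expr)
extrasᵉ true  = (reg 1 , reg 2) ∷ (reg 3 , reg 4) ∷ []
extrasᵉ false = []

tries : Bool → List Try → Program
tries ins []             = skip
tries ins ((π , b) ∷ ts) = attempt π b ⨟
  ifnz (reg 11) (5 := op add (advanceᵉ (reg 5)) sizeᵉ ⨟ tries ins ts) (report (keepᵉ ins) (extrasᵉ ins))

oracle : Program
oracle = prepare ⨟ ifnz (reg 0) (tries true (schedule true)) (tries false (schedule false))

-- The bounds for both branches of the conditional are added rather than maximised, which leaves
-- only sums in the linearity proof.
triesCost : Bool → ℕ → ℕ → ℕ
triesCost ins zero    m = 1
triesCost ins (suc k) m = attemptCost m + (2 + (11 + triesCost ins k m + reportCost (cost (keepᵉ ins)) m))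

triesCost-linear : ∀ ins k → Linear (triesCost ins k)
triesCost-linear ins zero    = linear-const 1
triesCost-linear ins (suc k) = linear-+ attemptCost-linear (linear-+ (linear-const 2)
  (linear-+ (linear-+ (linear-const 11) (triesCost-linear ins k)) (reportCost-linear (cost (keepᵉ ins)))))

-- Memory images of lists

contents-++ʳ : ∀ xs {ys} a → contents (xs ++ ys) (length xs + a) ≡ contents ys a
contents-++ʳ []       a = refl
contents-++ʳ (x ∷ xs) a = contents-++ʳ xs a

contents-++ˡ : ∀ xs {ys a} → a < length xs → contents (xs ++ ys) a ≡ contents xs a
contents-++ˡ (x ∷ xs) {a = zero}  _  = refl
contents-++ˡ (x ∷ xs) {a = suc a} a< = contents-++ˡ xs (s<s⁻¹ a<)

contents-beyond : ∀ xs {a} → length xs ≤ a → contents xs a ≡ 0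
contents-beyond []       _  = refl
contents-beyond (x ∷ xs) {suc a} le = contents-beyond xs (s≤s⁻¹ le)

module _ (k : ℕ) where

  contents-blocks : ∀ {m} (block : Fin m → List ℕ) → (∀ i → length (block i) ≡ k) →
    ∀ i {j} → j < k → contents (concat (tabulate block)) (k * toℕ i + j) ≡ contents (block i) j
  contents-blocks block len zero {j} j<k rewrite *-zeroʳ k = contents-++ˡ (block zero) (subst (j <_) (sym (len zero)) j<k)
  contents-blocks block len (suc i) {j} j<k =
    trans (cong (contents (concat (tabulate block))) (trans (cong (_+ j) (*-suc k (toℕ i))) (trans (+-assoc k _ j) (cong (_+ (k * toℕ i + j)) (sym (len zero))))))
      (trans (contents-++ʳ (block zero) _) (contents-blocks (block ∘ suc) (len ∘ suc) i j<k))

  length-blocks : ∀ {m} (block : Fin m → List ℕ) → (∀ i → length (block i) ≡ k) → length (concat (tabulate block)) ≡ m * k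
  length-blocks {zero}  block len = refl
  length-blocks {suc m} block len = trans (length-++ (block zero)) (cong₂ _+_ (len zero) (length-blocks (block ∘ suc) (len ∘ suc)))

edgeWords : ∀ {n} → List (Edge n) → List ℕ
edgeWords es = length es ∷ concatMap endpoints es

patternOf : ∀ {n} → Edge n → Edge n → (Fin n → Bool) → Pattern
patternOf e₁ e₂ χ = χ (end₁ e₁) ∷ χ (end₂ e₁) ∷ χ (end₁ e₂) ∷ χ (end₂ e₂) ∷ []

oracleCost : ℕ → ℕ
oracleCost m = (20 + m * 100) + (2 + (triesCost true (length (schedule true)) m + triesCost false (length (schedule false)) m))

oracleCost-linear : Linear oracleCost
oracleCost-linear = linear-+ (linear-+ (linear-const 20) (linear-* 100 linear-id))
  (linear-+ (linear-const 2) (linear-+ (triesCost-linear true (length (schedule true))) (triesCost-linear false (length (schedule false)))))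

module _ {n : ℕ} where
  open DecMembership (_≟ᶠ_ {n}) public using () renaming (_∈?_ to _∈ᶠ?_)

member : ∀ {n} → List (Fin n) → Fin n → Bool
member vs v = does (v ∈ᶠ? vs)

_∥ᵇ_ : ∀ {n} → Edge n → Edge n → Bool
e ∥ᵇ f = does (e ∥? f)

-- Correctness and cost of the query program

-- A region of `Z` words is indexed both by vertices and by addresses of half-edge records, hence
-- the two lower bounds on `Z`. The factor 1000 leaves room for all regions that the attempts will
-- ever take.
record Device (n M : ℕ) : Set where
  field
    ed    : Fin M → Edge n
    s t   : Fin n
    r     : Fin M × Bool → ℕ
    Z w   : ℕ
    n≤Z   : n ≤ Z
    end≤Z : 16 + 8 * M ≤ Z
    big   : 1000 * Z < 2 ^ w
    r≤2   : ∀ h → r h ≤ 2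

module Machine {n M : ℕ} (device : Device n M) where

  open Device device
  open DecMembership (_≟ᶠ_ {n}) using (_∈?_)

  x y : Fin M → Fin n
  x i = end₁ (ed i)
  y i = end₂ (ed i)

  open Network x y

  ad : Half → ℕ
  ad (i , false) = 4 + 8 * toℕ i
  ad (i , true)  = 8 + 8 * toℕ i

  residual : (Half → ℕ) → Half → ℕ
  residual u h = r h + u (tw h) ∸ u h

  ad-injective : ∀ h h′ → ad h ≡ ad h′ → h ≡ h′
  ad-injective (i , false) (j , false) eq = cong (_, false) (toℕ-injective (*-cancelˡ-≡ _ _ 8 (+-cancelˡ-≡ 4 _ _ eq)))
  ad-injective (i , true)  (j , true)  eq = cong (_, true) (toℕ-injective (*-cancelˡ-≡ _ _ 8 (+-cancelˡ-≡ 8 _ _ eq)))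
  ad-injective (i , false) (j , true)  eq = ⊥-elim (4*odd (toℕ i) (toℕ j) (+-cancelˡ-≡ 4 _ _ eq))
  ad-injective (i , true)  (j , false) eq = ⊥-elim (4*odd (toℕ j) (toℕ i) (+-cancelˡ-≡ 4 _ _ (sym eq)))

  ad+8≤Z : ∀ h → ad h + 8 ≤ Z
  ad+8≤Z h = ≤-trans (bound h) end≤Z
    where
    step : ∀ (i : Fin M) → 8 + 8 * toℕ i ≤ 8 * M
    step i = subst (_≤ 8 * M) (*-suc 8 (toℕ i)) (*-monoʳ-≤ 8 (toℕ<n i))
    bound : ∀ h → ad h + 8 ≤ 16 + 8 * M
    bound (i , false) = subst (_≤ 16 + 8 * M) (+-comm 8 (ad (i , false)))
      (≤-trans (+-monoʳ-≤ 4 (step i)) (+-monoˡ-≤ (8 * M) {4} {16} (≤ᵇ⇒≤ _ _ tt)))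
    bound (i , true) = subst (_≤ 16 + 8 * M) (+-comm 8 (ad (i , true)))
      (≤-trans (+-monoʳ-≤ 8 (step i)) (+-monoˡ-≤ (8 * M) {8} {16} (≤ᵇ⇒≤ _ _ tt)))

  ad+4<Z : ∀ h → ad h + 4 < Z
  ad+4<Z h = ≤-trans (subst (_≤ ad h + 8) (+-suc (ad h) 4) (+-monoʳ-≤ (ad h) {5} {8} (≤ᵇ⇒≤ _ _ tt))) (ad+8≤Z h)

  ad<Z : ∀ h → ad h < Z
  ad<Z h = ≤-<-trans (m≤m+n _ 4) (ad+4<Z h)

  4≤ad : ∀ h → 4 ≤ ad h
  4≤ad (i , false) = m≤m+n 4 _
  4≤ad (i , true)  = ≤-trans (≤ᵇ⇒≤ 4 8 tt) (m≤m+n 8 _)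

  node<Z : ∀ (v : Fin n) → toℕ v < Z
  node<Z v = <-≤-trans (toℕ<n v) n≤Z

  16≤Z : 16 ≤ Z
  16≤Z = ≤-trans (m≤m+n 16 _) end≤Z

  fits : ∀ {a} → a ≤ 1000 * Z → a < 2 ^ w
  fits a≤ = ≤-<-trans a≤ big

  fits-Z : ∀ {a} → a ≤ Z → a < 2 ^ w
  fits-Z a≤ = fits (≤-trans a≤ (m≤n*m Z 1000))

  fits-3Z : ∀ {a} → a ≤ Z + Z + Z → a < 2 ^ w
  fits-3Z {a} a≤ = fits (≤-trans a≤ (subst (_≤ 1000 * Z) (three Z) (*-monoˡ-≤ Z {3} {1000} (≤ᵇ⇒≤ _ _ tt))))
    where
    three : ∀ z → 3 * z ≡ z + z + z
    three = solve-∀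

  fits-lit : ∀ a {_ : T (a ≤ᵇ 16)} → a < 2 ^ w
  fits-lit a {p} = fits-Z (≤-trans (≤ᵇ⇒≤ a 16 p) 16≤Z)

  record Env (μ : ℕ → ℕ) : Set where
    field
      source : μ 0 ≡ toℕ s
      sink   : μ 1 ≡ toℕ t
      end    : μ 2 ≡ 4 + 8 * M
      size   : μ 3 ≡ Z
      tails  : ∀ h → μ (ad h) ≡ toℕ (tl h)
      heads  : ∀ h → μ (ad h + 1) ≡ toℕ (hd h)
      caps   : ∀ h → μ (ad h + 2) ≡ r h
      twins  : ∀ h → μ (ad h + 3) ≡ ad (tw h)

  Chain : (ℕ → ℕ) → ℕ → List Half → Set
  Chain μ p []       = p ≡ 0
  Chain μ p (h ∷ hs) = p ≡ ad h × Chain μ (μ (Z + Z + ad h)) hs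

  adj : List Half → Fin n → List Half
  adj hs v = filter (λ h → tl h ≟ᶠ v) hs

  -- Half-edges at unvisited tails are the resource that pays for visits: a new vertex uses up its
  -- own half-edges, which bounds the search by the number of edges rather than of vertices.
  unseen : List Half → List (Fin n) → ℕ
  unseen hs vs = length (filter (λ h → ¬? (tl h ∈? vs)) hs)

  unseen-∷ : ∀ hs {v vs} → v ∉ vs → unseen hs vs ≡ unseen hs (v ∷ vs) + length (adj hs v)
  unseen-∷ [] v∉ = refl
  unseen-∷ (h ∷ hs) {v} {vs} v∉ with tl h ∈? vs | tl h ∈? (v ∷ vs) | tl h ≟ᶠ v
  ... | yes a | yes b         | yes refl = ⊥-elim (v∉ a)
  ... | yes a | yes b         | no ¬c    = unseen-∷ hs v∉
  ... | yes a | no ¬b         | _        = ⊥-elim (¬b (there a))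
  ... | no ¬a | yes _         | yes c    = trans (cong suc (unseen-∷ hs v∉)) (sym (+-suc _ _))
  ... | no ¬a | yes (here c)  | no ¬c    = ⊥-elim (¬c c)
  ... | no ¬a | yes (there b) | no ¬c    = ⊥-elim (¬a b)
  ... | no ¬a | no ¬b         | yes c    = ⊥-elim (¬b (here c))
  ... | no ¬a | no ¬b         | no ¬c    = cong suc (unseen-∷ hs v∉)

  -- Searching the residual network

  record Exploration : Set where
    field
      all      : List Half
      every    : ∀ h → h ∈ all
      σ₀       : State
      B O      : ℕ
      u        : Half → ℕ
      S        : List (Fin n)
      env      : Env (mem σ₀)
      chains   : ∀ v → Chain (mem σ₀) (mem σ₀ (Z + toℕ v)) (adj all v)
      base     : regs σ₀ 5 ≡ B
      usedBase : regs σ₀ 6 ≡ O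
      3Z≤B     : Z + Z + Z ≤ B
      B≤       : B + (Z + Z + Z) ≤ 1000 * Z
      O≤       : O + Z ≤ 1000 * Z
      -- In a first exploration the flow region lies behind the marks and the queue; in the retry it
      -- lies before them.
      apart    : O + Z ≤ B ⊎ B + (Z + Z) ≤ O
      used     : ∀ h → mem σ₀ (O + ad h) ≡ u h
      u≤1      : ∀ h → u h ≤ 1
      K<Z      : length S + length all < Z

  module Search (exploration : Exploration) where

    open Exploration exploration
    open Env env

    Live : Half → Set
    Live h = u h < r h + u (tw h)

    -- The number is the mark as stored in memory, so a mark alone certifies how its vertex was
    -- reached.
    data Origin (vs : List (Fin n)) (v : Fin n) : ℕ → Set where
      seed : v ∈ S → Origin vs v 1
      via  : ∀ h → hd h ≡ v → tl h ∈ vs → Live h → Origin vs v (ad h)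

    -- The list has the newest vertex first, and each origin refers only to older vertices;
    -- following marks backwards therefore ends at a seed.
    data Tree (μ : ℕ → ℕ) : List (Fin n) → Set where
      []   : Tree μ []
      grow : ∀ {v vs} → v ∉ vs → Origin vs v (μ (B + toℕ v)) → Tree μ vs → Tree μ (v ∷ vs)

    Queue : (ℕ → ℕ) → List (Fin n) → Set
    Queue μ vs = ∀ ys v zs → vs ≡ ys ++ v ∷ zs → μ (B + Z + length zs) ≡ toℕ v

    record Frame (σ : State) : Set where
      field
        regs-kept : ∀ q → q < 7 → regs σ q ≡ regs σ₀ q
        mem-kept  : ∀ a → a < B ⊎ B + (Z + Z) ≤ a → mem σ a ≡ mem σ₀ a
        out-kept  : out σ ≡ out σ₀

    open Frame

    frame-reg : ∀ {σ q v} → 7 ≤ q → Frame σ → Frame (setReg σ q v)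
    frame-reg {σ} {q} 7≤q F = record
      { regs-kept = λ p p<7 → trans (upd-other (regs σ) (>⇒≢ (<-≤-trans p<7 7≤q))) (regs-kept F p p<7)
      ; mem-kept  = mem-kept F
      ; out-kept  = out-kept F }

    frame-mem : ∀ {σ a v} → B ≤ a → a < B + (Z + Z) → Frame σ → Frame (setMem σ a v)
    frame-mem {σ} {a} B≤a a< F = record
      { regs-kept = regs-kept F
      ; mem-kept  = λ b o → trans (upd-other (mem σ) (ne b o)) (mem-kept F b o)
      ; out-kept  = out-kept F }
      where
      ne : ∀ b → b < B ⊎ B + (Z + Z) ≤ b → a ≢ b
      ne b (inj₁ b<B) = >⇒≢ (<-≤-trans b<B B≤a)
      ne b (inj₂ ≤b)  = <⇒≢ (<-≤-trans a< ≤b)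

    static : ∀ {σ a} → Frame σ → a < Z + Z + Z → mem σ a ≡ mem σ₀ a
    static F a< = mem-kept F _ (inj₁ (<-≤-trans a< 3Z≤B))

    low : ∀ {a} → a < Z → a < Z + Z + Z
    low a<Z = <-≤-trans a<Z (≤-trans (m≤m+n Z Z) (m≤m+n (Z + Z) Z))

    ev-5 : ∀ {σ} → Frame σ → Ev w σ (reg 5) B
    ev-5 F = ev-reg (trans (regs-kept F 5 (<ᵇ⇒< _ _ tt)) base)

    ev-6 : ∀ {σ} → Frame σ → Ev w σ (reg 6) O
    ev-6 F = ev-reg (trans (regs-kept F 6 (<ᵇ⇒< _ _ tt)) usedBase)

    ev-size : ∀ {σ} → Frame σ → Ev w σ sizeᵉ Z
    ev-size {σ} F = ev-load (ev-lit (fits-lit 3))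
      (trans (static F (low (<-≤-trans (<ᵇ⇒< 3 16 tt) 16≤Z))) size)

    ev-mark : ∀ {σ e v} → Frame σ → Ev w σ e (toℕ v) → Ev w σ (markᵉ e) (B + toℕ v)
    ev-mark {σ} {e} {v} F e⇓ = ev-add (ev-5 F) e⇓
      (fits (≤-trans (+-monoʳ-≤ B (≤-trans (<⇒≤ (node<Z v)) (m≤n+m Z (Z + Z)))) B≤))

    ev-queue : ∀ {σ e i} → Frame σ → Ev w σ e i → i < Z → Ev w σ (queueᵉ e) (B + Z + i)
    ev-queue {σ} {e} {i} F e⇓ i<Z =
      ev-add (ev-add (ev-5 F) (ev-size F)
        (fits (≤-trans (+-monoʳ-≤ B (m≤n+m Z (Z + Z))) B≤))) e⇓
        (fits (≤-trans (≤-trans (≤-reflexive (+-assoc B Z i)) (+-monoʳ-≤ B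
          (≤-trans (+-monoʳ-≤ Z (<⇒≤ i<Z)) (m≤m+n (Z + Z) Z)))) B≤))

    ev-used : ∀ {σ e h} → Frame σ → Ev w σ e (ad h) → Ev w σ (load (usedᵉ e)) (u h)
    ev-used {σ} {e} {h} F e⇓ = ev-load
      (ev-add (ev-6 F) e⇓ (fits (≤-trans (+-monoʳ-≤ O (<⇒≤ (ad<Z h))) O≤)))
      (trans (mem-kept F (O + ad h) (side apart)) (used h))
      where
      side : O + Z ≤ B ⊎ B + (Z + Z) ≤ O → O + ad h < B ⊎ B + (Z + Z) ≤ O + ad h
      side (inj₁ le) = inj₁ (<-≤-trans (+-monoʳ-< O (ad<Z h)) le)
      side (inj₂ le) = inj₂ (≤-trans le (m≤m+n O _))

    K : ℕ
    K = length S + length all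

    record Visited (σ : State) (vs : List (Fin n)) : Set where
      field
        frame  : Frame σ
        count  : regs σ 8 ≡ length vs
        queue  : Queue (mem σ) vs
        tree   : Tree (mem σ) vs
        fresh  : ∀ v → v ∉ vs → mem σ (B + toℕ v) ≡ 0

    open Visited

    visited-reg : ∀ {σ vs q v} → 7 ≤ q → q ≢ 8 → Visited σ vs → Visited (setReg σ q v) vs
    visited-reg {σ} 7≤q q≢8 V = record
      { frame = frame-reg 7≤q (frame V) ; count = trans (upd-other (regs σ) q≢8) (count V)
      ; queue = queue V ; tree = tree V ; fresh = fresh V }

    origin-positive : ∀ {vs v k} → Origin vs v k → k ≢ 0
    origin-positive (seed _) = λ ()
    origin-positive (via h _ _ _) = >⇒≢ (≤-trans z<s (4≤ad h))

    marked : ∀ {μ vs v} → Tree μ vs → v ∈ vs → μ (B + toℕ v) ≢ 0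
    marked (grow _ o _) (here refl) = origin-positive o
    marked (grow _ _ T) (there v∈)  = marked T v∈

    tree-cong : ∀ {μ μ′ vs} → (∀ v → v ∈ vs → μ′ (B + toℕ v) ≡ μ (B + toℕ v)) → Tree μ vs → Tree μ′ vs
    tree-cong eq [] = []
    tree-cong eq (grow v∉ o T) =
      grow v∉ (subst (Origin _ _) (sym (eq _ (here refl))) o) (tree-cong (λ v v∈ → eq v (there v∈)) T)

    mark≢mark : ∀ {v v′ : Fin n} → v ≢ v′ → B + toℕ v ≢ B + toℕ v′
    mark≢mark v≢ eq = v≢ (toℕ-injective (+-cancelˡ-≡ B _ _ eq))

    queue≢mark : ∀ {i} (v : Fin n) → B + Z + i ≢ B + toℕ v
    queue≢mark {i} v = >⇒≢ (<-≤-trans (+-monoʳ-< B (node<Z v)) (m≤m+n (B + Z) i))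

    Grew : List (Fin n) → Fin n → List (Fin n) → Set
    Grew vs v vs′ = (v ∈ vs × vs′ ≡ vs) ⊎ (v ∉ vs × vs′ ≡ v ∷ vs)

    run-visit : ∀ {σ vs v m k} → Visited σ vs → regs σ 12 ≡ toℕ v → Ev w σ m k → cost m ≡ 1 →
      Origin vs v k → length vs < Z →
      Run w (visit m) σ 30 (λ σ′ → ∃[ vs′ ] Grew vs v vs′ × Visited σ′ vs′ ×
        regs σ′ 7 ≡ regs σ 7 × regs σ′ 9 ≡ regs σ 9)
    run-visit {σ} {vs} {v} {m} {k} V r12 evm cm o len<Z with v ∈? vs
    ... | yes v∈ = within (run-then
            (ev-load (ev-mark (frame V) (ev-reg r12)) refl)
            (marked (tree V) v∈)
            (run-skip (vs , inj₁ (v∈ , refl) , V , refl , refl)))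
    ... | no v∉ = run-weaken (run-else
            (ev-load (ev-mark (frame V) (ev-reg r12)) refl)
            (fresh V v v∉)
            (run-⨟ (run-store (ev-mark (frame V) (ev-reg r12)) evm
            (run-⨟ (run-store (ev-queue F₁ (ev-reg (count V)) len<Z) (ev-reg r12)
            (run-:=
              (ev-add (ev-reg (count V)) (ev-lit (fits-lit 1)) 1+len< )
              (v ∷ vs , inj₂ (v∉ , refl) , V′ , refl , refl)))))))
            (≤-trans (≤-reflexive (cong (λ c → 5 + ((4 + c) + 12)) cm)) (≤ᵇ⇒≤ 22 30 tt)) id
      where
      1+len< : length vs + 1 < 2 ^ w
      1+len< = fits-Z (subst (_≤ Z) (+-comm 1 (length vs)) len<Z)
      F₁ = frame-mem {v = k} (m≤m+n B (toℕ v)) (+-monoʳ-< B (<-≤-trans (node<Z v) (m≤m+n Z Z))) (frame V)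
      ℓ = length vs
      ℓ< : B + Z + ℓ < B + (Z + Z)
      ℓ< = subst (_< B + (Z + Z)) (sym (+-assoc B Z ℓ)) (+-monoʳ-< B (+-monoʳ-< Z len<Z))
      F₂ = frame-mem {v = toℕ v} (≤-trans (m≤m+n B Z) (m≤m+n (B + Z) ℓ)) ℓ< F₁
      μ₁ = mem σ [ B + toℕ v ↦ k ]
      μ₂ = μ₁ [ B + Z + ℓ ↦ toℕ v ]
      at-v : μ₂ (B + toℕ v) ≡ k
      at-v = trans (upd-other μ₁ (queue≢mark v)) (upd-same (mem σ) refl)
      at : ∀ v′ → v ≢ v′ → μ₂ (B + toℕ v′) ≡ mem σ (B + toℕ v′)
      at v′ ne = trans (upd-other μ₁ (queue≢mark v′)) (upd-other (mem σ) (mark≢mark ne))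
      q′ : Queue μ₂ (v ∷ vs)
      q′ [] .v .vs refl = upd-same μ₁ {a = B + Z + ℓ} refl
      q′ (_ ∷ ys) v′ zs refl = trans (upd-other μ₁ (λ eq → >⇒≢ shorter (+-cancelˡ-≡ (B + Z) _ _ eq)))
        (trans (upd-other (mem σ) (λ eq → queue≢mark v (sym eq))) (queue V ys v′ zs refl))
        where
        shorter : length zs < length vs
        shorter = subst (length zs <_) (sym (length-++ ys)) (m≤n+m _ (length ys))
      V′ : Visited _ (v ∷ vs)
      V′ = record
        { frame = frame-reg (≤ᵇ⇒≤ 7 8 tt) F₂
        ; count = +-comm (length vs) 1
        ; queue = q′
        ; tree  = grow v∉ (subst (Origin vs v) (sym at-v) o) (tree-cong (λ v′ v′∈ → at v′ (λ { refl → v∉ v′∈ })) (tree V))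
        ; fresh = λ v′ v′∉ → trans (at v′ (λ eq → v′∉ (here (sym eq)))) (fresh V v′ (v′∉ ∘ there)) }

    Denotes : Expr → Fin n → Set
    Denotes e v = cost e ≤ 2 × (∀ {σ} → Frame σ → Ev w σ e (toℕ v))

    grew-⊇ : ∀ {vs v vs′} → Grew vs v vs′ → ∀ {v′} → v′ ∈ vs → v′ ∈ vs′
    grew-⊇ (inj₁ (_ , refl)) m = m
    grew-⊇ (inj₂ (_ , refl)) m = there m

    grew-∋ : ∀ {vs v vs′} → Grew vs v vs′ → v ∈ vs′
    grew-∋ (inj₁ (v∈ , refl)) = v∈
    grew-∋ (inj₂ (_ , refl))  = here refl

    grew-length : ∀ {vs v vs′} → Grew vs v vs′ → length vs′ ≤ suc (length vs)
    grew-length (inj₁ (_ , refl)) = n≤1+n _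
    grew-length (inj₂ (_ , refl)) = ≤-refl

    run-plant : ∀ {es S′ σ vs} → Pointwise Denotes es S′ → (∀ v → v ∈ S′ → v ∈ S) → Visited σ vs →
      length vs + length S′ ≤ length S →
      Run w (plant es) σ (1 + length es * 40) (λ σ′ → ∃[ vs′ ] Visited σ′ vs′ × length vs′ ≤ length S ×
        (∀ v → v ∈ S′ → v ∈ vs′) × (∀ v → v ∈ vs → v ∈ vs′) ×
        regs σ′ 7 ≡ regs σ 7 × regs σ′ 9 ≡ regs σ 9)
    run-plant {vs = vs} [] ⊆S V small =
      run-skip (vs , V , ≤-trans (m≤m+n _ _) small , (λ _ ()) , (λ _ m → m) , refl , refl)
    run-plant {e ∷ es} {v ∷ S′} {σ} {vs} ((c , d) ∷ ds) ⊆S V small =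
      run-weaken (run-⨟ (run-weaken (run-⨟ (run-:= (d (frame V))
        (run-visit (visited-reg (≤ᵇ⇒≤ 7 12 tt) (λ ()) V) refl
          (ev-lit (fits-lit 1)) refl (seed (⊆S _ (here refl))) len<Z)))
        (+-mono-≤ {x = 1 + cost e} (s≤s c) (≤-refl {30}))
        (λ (vs₁ , g , V₁ , eq7 , eq9) →
          run-weaken (run-plant {es} {S′} ds (λ v′ m → ⊆S v′ (there m)) V₁ (≤-trans (+-monoˡ-≤ (length S′) (grew-length g)) (subst (_≤ length S) (+-suc _ _) small))) ≤-refl
            (λ (vs₂ , V₂ , small₂ , in₂ , sub₂ , e7 , e9) →
              vs₂ , V₂ , small₂ , (λ { _ (here refl) → sub₂ _ (grew-∋ g) ; _ (there m) → in₂ _ m }) , (λ v m → sub₂ v (grew-⊇ g m))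
              , trans e7 eq7 , trans e9 eq9))))
      (≤-trans (m≤m+n _ 7) (≤-reflexive (arith (length es * 40)))) id
      where
      len<Z : length vs < Z
      len<Z = ≤-<-trans (≤-trans (m≤m+n _ (suc (length S′))) (≤-trans small (m≤m+n _ _))) K<Z
      arith : ∀ z → 33 + (1 + z) + 7 ≡ 1 + (40 + z)
      arith = solve-∀

    weight : List (Fin n) → ℕ
    weight vs = List.sum (map (λ v → suc (length (adj all v))) vs)

    weight-∷ʳ : ∀ vs v → weight (vs ∷ʳ v) ≡ weight vs + suc (length (adj all v))
    weight-∷ʳ [] v = +-identityʳ _
    weight-∷ʳ (v′ ∷ vs) v = trans (cong (suc (length (adj all v′)) +_) (weight-∷ʳ vs v)) (sym (+-assoc (suc (length (adj all v′))) (weight vs) _))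

    -- `don` are the popped vertices and `cs` is the unscanned rest of the current adjacency list.
    -- Visiting a vertex of degree d lowers `unseen` by d, raises the pending weight by d + 1 and
    -- consumes one element of `cs`; with the factor 2 on `unseen` the potential falls by d. The
    -- field `small` bounds the visited vertices by seeds plus half-edges.
    record Loop (φ : ℕ) (cs : List Half) (σ : State) : Set where
      field
        vs pend don : List (Fin n)
        split       : vs ≡ pend ++ don
        visited     : Visited σ vs
        head        : regs σ 9 ≡ length don
        chain       : Chain (mem σ₀) (regs σ 7) cs
        local       : ∀ h → h ∈ cs → tl h ∈ vs
        closed      : ∀ h → tl h ∈ don → Live h → hd h ∈ vs ⊎ h ∈ cs
        seeds       : ∀ v → v ∈ S → v ∈ vs
        small       : length vs + unseen all vs ≤ K
        potential   : 2 * unseen all vs + weight pend + length cs ≡ φ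

    record Found (σ : State) : Set where
      field
        vs      : List (Fin n)
        visited : Visited σ vs
        closed  : ∀ h → tl h ∈ vs → Live h → hd h ∈ vs
        seeds   : ∀ v → v ∈ S → v ∈ vs
        small   : length vs ≤ K

    ev-live : ∀ {σ h} → Frame σ → regs σ 7 ≡ ad h → (Live h → Ev w σ liveᵉ 1) × (¬ Live h → Ev w σ liveᵉ 0)
    ev-live {σ} {h} F r7 = (λ l → ev-lt left right (fits-lit 1) l)
                         , (λ l → ev-≮ left right (fits-lit 1) l)
      where
      a = load (usedᵉ (reg 7))
      cap = load (op add (reg 7) (lit 2))
      opp = load (op add (reg 7) (lit 3))
      b = op add cap (load (usedᵉ opp))
      field-ev : ∀ k {v} {_ : T (k ≤ᵇ 4)} → mem σ₀ (ad h + k) ≡ v → Ev w σ (load (op add (reg 7) (lit k))) v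
      field-ev k {v} {p} eq = ev-load
        (ev-add (ev-reg r7) (ev-lit (fits-Z (≤-trans (≤-trans (≤ᵇ⇒≤ k 4 p) (≤ᵇ⇒≤ 4 16 tt)) 16≤Z)))
          (fits-Z (<⇒≤ k<)))
        (trans (static F (low k<)) eq)
        where
        k< : ad h + k < Z
        k< = ≤-<-trans (+-monoʳ-≤ (ad h) (≤ᵇ⇒≤ k 4 p)) (ad+4<Z h)
      left : Ev w σ a (u h)
      left = ev-used {h = h} F (ev-reg r7)
      right : Ev w σ b (r h + u (tw h))
      right = ev-add (field-ev 2 (caps h))
        (ev-used {h = tw h} F (field-ev 3 (twins h)))
        (fits-Z (≤-trans (+-mono-≤ (r≤2 h) (u≤1 (tw h))) (≤-trans (≤ᵇ⇒≤ 3 16 tt) 16≤Z)))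

    run-scan : ∀ {φ σ h cs} (L : Loop φ (h ∷ cs) σ) →
      Run w scan σ 70 (λ σ′ → ∃[ φ′ ] φ′ < φ × ∃[ cs′ ] Loop φ′ cs′ σ′)
    run-scan {φ} {σ} {h} {cs} L = body (u h <? r h + u (tw h))
      where
      open Loop L
      F = frame visited
      r7 : regs σ 7 ≡ ad h
      r7 = proj₁ chain
      ev-next : ∀ {σ′} → Frame σ′ → regs σ′ 7 ≡ regs σ 7 →
        Ev w σ′ (load (nextᵉ (reg 7))) (mem σ₀ (Z + Z + ad h))
      ev-next {σ′} F′ e7 = ev-load
        (ev-add
          (ev-add (ev-size F′) (ev-size F′) (fits-3Z (m≤m+n (Z + Z) Z)))
          (ev-reg (trans e7 r7)) (fits-3Z (+-monoʳ-≤ (Z + Z) (<⇒≤ (ad<Z h)))))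
        (static F′ (+-monoʳ-< (Z + Z) (ad<Z h)))
      finish : ∀ {σ′ vs′} → Grew vs (hd h) vs′ ⊎ (¬ Live h × vs′ ≡ vs) → Visited σ′ vs′ →
        regs σ′ 7 ≡ regs σ 7 → regs σ′ 9 ≡ regs σ 9 →
        Run w (7 := load (nextᵉ (reg 7))) σ′ 10 (λ σ″ → ∃[ φ′ ] φ′ < φ × ∃[ cs′ ] Loop φ′ cs′ σ″)
      finish {σ′} {vs′} g V e7 e9 = within (run-:= (ev-next (frame V) e7)
        (case g))
        where
        V″ = visited-reg {q = 7} {v = mem σ₀ (Z + Z + ad h)} ≤-refl (λ ()) V
        same : vs′ ≡ vs → (Live h → hd h ∈ vs) → ∃[ φ′ ] φ′ < φ × ∃[ cs′ ] Loop φ′ cs′ (setReg σ′ 7 (mem σ₀ (Z + Z + ad h)))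
        same refl live∈ = _ , subst (2 * unseen all vs + weight pend + length cs <_) potential
            (+-monoʳ-< (2 * unseen all vs + weight pend) (n<1+n _)) , cs , record
          { split = split ; visited = V″ ; head = trans e9 head ; chain = proj₂ chain
          ; local = λ h′ m → local h′ (there m)
          ; closed = λ h′ t∈ l → keep l (closed h′ t∈ l)
          ; seeds = seeds ; small = small ; potential = refl }
          where
          keep : ∀ {h′} → Live h′ → hd h′ ∈ vs ⊎ h′ ∈ h ∷ cs → hd h′ ∈ vs ⊎ h′ ∈ cs
          keep l (inj₁ m) = inj₁ m
          keep l (inj₂ (here refl)) = inj₁ (live∈ l)
          keep l (inj₂ (there m)) = inj₂ m
        case : Grew vs (hd h) vs′ ⊎ (¬ Live h × vs′ ≡ vs) → ∃[ φ′ ] φ′ < φ × ∃[ cs′ ] Loop φ′ cs′ (setReg σ′ 7 (mem σ₀ (Z + Z + ad h)))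
        case (inj₂ (dead , eq)) = same eq (λ l → ⊥-elim (dead l))
        case (inj₁ (inj₁ (v∈ , eq))) = same eq (λ _ → v∈)
        case (inj₁ (inj₂ (v∉ , refl))) = _ , subst (φ₁ <_) potential drop , cs , record
          { vs = hd h ∷ vs ; pend = hd h ∷ pend
          ; split = cong (hd h ∷_) split ; visited = V″ ; head = trans e9 head ; chain = proj₂ chain
          ; local = λ h′ m → there (local h′ (there m))
          ; closed = λ h′ t∈ l → keep (closed h′ t∈ l)
          ; seeds = λ v m → there (seeds v m)
          ; small = ≤-trans less₂ small
          ; potential = refl }
          where
          a = length (adj all (hd h))
          -- The twin of `h` starts at the new vertex, so its degree is positive; both the fall of
          -- the potential and the bound `small` rest on this.
          a>0 : 0 < a
          a>0 = ∈-length (∈-filter⁺ (λ h′ → tl h′ ≟ᶠ hd h) (every (tw h)) refl)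
          U = unseen all (hd h ∷ vs)
          uns : unseen all vs ≡ U + a
          uns = unseen-∷ all v∉
          φ₁ = 2 * U + weight (hd h ∷ pend) + length cs
          drop : φ₁ < 2 * unseen all vs + weight pend + length (h ∷ cs)
          drop = subst (λ z → φ₁ < 2 * z + weight pend + suc (length cs)) (sym uns)
            (subst₂ _<_ (arith₁ U a (weight pend) (length cs)) (arith₂ U a (weight pend) (length cs)) (m<m+n _ a>0))
            where
            arith₁ : ∀ U a W c → 2 * U + (W + c + suc a) ≡ 2 * U + (suc a + W) + c
            arith₁ = solve-∀
            arith₂ : ∀ U a W c → 2 * U + (W + c + suc a) + a ≡ 2 * (U + a) + W + suc c
            arith₂ = solve-∀
          less₂ : suc (length vs) + U ≤ length vs + unseen all vs
          less₂ = subst₂ _≤_ (+-suc (length vs) U) (cong (length vs +_) (sym uns))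
            (+-monoʳ-≤ (length vs) (subst (_≤ U + a) (+-comm U 1) (+-monoʳ-≤ U a>0)))
          keep : ∀ {h′} → hd h′ ∈ vs ⊎ h′ ∈ h ∷ cs → hd h′ ∈ hd h ∷ vs ⊎ h′ ∈ cs
          keep (inj₁ m) = inj₁ (there m)
          keep (inj₂ (here refl)) = inj₁ (here refl)
          keep (inj₂ (there m)) = inj₂ m
      len<Z : length vs < Z
      len<Z = ≤-<-trans (≤-trans (m≤m+n _ _) small) K<Z
      ev-head : Ev w σ (load (op add (reg 7) (lit 1))) (toℕ (hd h))
      ev-head = ev-load (ev-add (ev-reg r7) (ev-lit (fits-lit 1)) (fits-Z (<⇒≤ k<)))
        (trans (static F (low k<)) (heads h))
        where
        k< : ad h + 1 < Z
        k< = ≤-<-trans (+-monoʳ-≤ (ad h) (≤ᵇ⇒≤ 1 4 tt)) (ad+4<Z h)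
      body : Dec (Live h) → Run w scan σ 70 (λ σ′ → ∃[ φ′ ] φ′ < φ × ∃[ cs′ ] Loop φ′ cs′ σ′)
      body (yes l) = within (run-⨟ (run-then (proj₁ (ev-live {h = h} F r7) l) (λ ())
        (run-⨟ (run-:= ev-head
          (run-weaken (run-visit (visited-reg {q = 12} (≤ᵇ⇒≤ 7 12 tt) (λ ()) visited) refl (ev-reg r7) refl
            (via h refl (local h (here refl)) l) len<Z) ≤-refl
            (λ (vs′ , g , V , e7 , e9) → finish (inj₁ g) V e7 e9))))))
      body (no ¬l) = within (run-⨟ (run-else (proj₂ (ev-live {h = h} F r7) ¬l) refl
        (run-skip (finish {vs′ = vs} (inj₂ (¬l , refl)) visited refl refl))))

    run-pop : ∀ {φ σ} (L : Loop φ [] σ) → length (Loop.don L) < length (Loop.vs L) →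
      Run w (7 := load (firstᵉ (load (queueᵉ (reg 9)))) ⨟ 9 := op add (reg 9) (lit 1)) σ 70
        (λ σ′ → ∃[ φ′ ] φ′ < φ × ∃[ cs′ ] Loop φ′ cs′ σ′)
    run-pop {φ} {σ} L more = go (initLast pend) refl
      where
      open Loop L
      F = frame visited
      don<Z : length don < Z
      don<Z = <-trans more (≤-<-trans (≤-trans (m≤m+n _ _) small) K<Z)
      go : ∀ {zs} → InitLast zs → pend ≡ zs → Run w _ σ 70 (λ σ′ → ∃[ φ′ ] φ′ < φ × ∃[ cs′ ] Loop φ′ cs′ σ′)
      go [] refl = ⊥-elim (<-irrefl refl (subst (λ z → length don < length z) split more))
      go (pend′ ∷ʳ′ v) refl = within (run-⨟ (run-:=
        (ev-load (ev-add (ev-size F) (ev-load (ev-queue F (ev-reg head) don<Z) at-head)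
          (fits-Z₂ (+-monoʳ-≤ Z (<⇒≤ (node<Z v)))))
          (static F (<-≤-trans (+-monoʳ-< Z (node<Z v)) (m≤m+n (Z + Z) Z))))
        (run-:= (ev-add (ev-reg head) (ev-lit (fits-lit 1))
          (fits-Z (subst (_≤ Z) (+-comm 1 (length don)) don<Z)))
        (_ , drop , adj all v , record
          { vs = vs ; pend = pend′ ; don = v ∷ don ; split = split′
          ; visited = visited-reg {q = 9} (≤ᵇ⇒≤ 7 9 tt) (λ ()) (visited-reg {q = 7} ≤-refl (λ ()) visited)
          ; head = +-comm (length don) 1 ; chain = chains v
          ; local = λ h m → subst (_∈ vs) (sym (proj₂ (∈-filter⁻ (λ h → tl h ≟ᶠ v) {xs = all} m))) v∈
          ; closed = closed′ ; seeds = seeds ; small = small ; potential = refl }))))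
        where
        fits-Z₂ : ∀ {a} → a ≤ Z + Z → a < 2 ^ w
        fits-Z₂ a≤ = fits-3Z (≤-trans a≤ (m≤m+n (Z + Z) Z))
        split′ : vs ≡ pend′ ++ v ∷ don
        split′ = trans split (++-assoc pend′ [ v ] don)
        at-head : mem σ (B + Z + length don) ≡ toℕ v
        at-head = queue visited pend′ v don split′
        v∈ : v ∈ vs
        v∈ = subst (v ∈_) (sym split′) (∈-++⁺ʳ pend′ (here refl))
        closed′ : ∀ h → tl h ∈ v ∷ don → Live h → hd h ∈ vs ⊎ h ∈ adj all v
        closed′ h (here eq) l = inj₂ (∈-filter⁺ (λ h → tl h ≟ᶠ v) (every h) eq)
        closed′ h (there m) l with closed h m l
        ... | inj₁ i = inj₁ i
        -- The popped vertex gives up its degree plus one, of which the new chain takes back only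
        -- the degree.
        drop : 2 * unseen all vs + weight pend′ + length (adj all v) < φ
        drop = subst (2 * unseen all vs + weight pend′ + length (adj all v) <_)
          (trans (arith (2 * unseen all vs) (weight pend′) (length (adj all v)))
            (trans (cong (λ z → 2 * unseen all vs + z + 0) (sym (weight-∷ʳ pend′ v))) potential))
          (n<1+n _)
          where
          arith : ∀ U W a → suc (U + W + a) ≡ U + (W + suc a) + 0
          arith = solve-∀

    -- The guard is a sum: it vanishes only if no half-edge is current and the queue is empty. Then
    -- `don` is all of `vs`, and the invariant `closed` becomes closure of the visited set.
    loop-step : ∀ φ {σ} → (∃[ cs ] Loop φ cs σ) →
      ∃[ v ] Ev w σ (op add (reg 7) (op less (reg 9) (reg 8))) v × (v ≡ 0 → Found σ) ×
        (v ≢ 0 → Run w explore σ 80 (λ σ′ → ∃[ φ′ ] φ′ < φ × ∃[ cs ] Loop φ′ cs σ′))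
    loop-step φ {σ} ([] , L) = case (length don <? length vs)
      where
      open Loop L
      case : Dec (length don < length vs) → _
      case (yes more) = 0 + 1 , ev-add (ev-reg chain) (ev-lt (ev-reg head) (ev-reg (count visited)) (fits-lit 1) more) (fits-lit 1)
        , (λ ()) , λ _ → within (run-else (ev-reg chain) refl (run-pop L more))
      case (no ¬more) = 0 + 0 , ev-add (ev-reg chain) (ev-≮ (ev-reg head) (ev-reg (count visited)) (fits-lit 1) ¬more) (fits-lit 0)
        , (λ _ → record { vs = vs ; visited = visited ; closed = done ; seeds = seeds ; small = ≤-trans (m≤m+n _ _) small })
        , λ nz → ⊥-elim (nz refl)
        where
        all-done : ∀ zs → vs ≡ zs ++ don → vs ≡ don
        all-done [] eq = eq
        all-done (z ∷ zs) refl = ⊥-elim (¬more (s≤s (subst (length don ≤_) (sym (length-++ zs)) (m≤n+m _ _))))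
        done : ∀ h → tl h ∈ vs → Live h → hd h ∈ vs
        done h m l with closed h (subst (tl h ∈_) (all-done pend split) m) l
        ... | inj₁ i = i
    loop-step φ {σ} (h ∷ cs , L) = case (length don <? length vs)
      where
      open Loop L
      room : ∀ k {_ : T (k ≤ᵇ 4)} → ad h + k < 2 ^ w
      room k {p} = fits-Z (<⇒≤ (≤-<-trans (+-monoʳ-≤ (ad h) (≤ᵇ⇒≤ k 4 p)) (ad+4<Z h)))
      pos : ad h ≢ 0
      pos = >⇒≢ (≤-trans z<s (4≤ad h))
      r7 = ev-reg {w = w} {σ = σ} (proj₁ chain)
      body = within {u = 80} (run-then {P′ = 7 := load (firstᵉ (load (queueᵉ (reg 9)))) ⨟ 9 := op add (reg 9) (lit 1)} r7 pos (run-scan L))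
      case : Dec (length don < length vs) → _
      case (yes more) = ad h + 1 , ev-add r7 (ev-lt (ev-reg head) (ev-reg (count visited)) (fits-lit 1) more) (room 1)
        , (λ eq → ⊥-elim (pos (m+n≡0⇒m≡0 (ad h) eq))) , λ _ → body
      case (no ¬more) = ad h + 0 , ev-add r7 (ev-≮ (ev-reg head) (ev-reg (count visited)) (fits-lit 1) ¬more) (room 0)
        , (λ eq → ⊥-elim (pos (m+n≡0⇒m≡0 (ad h) eq))) , λ _ → body

    -- The factor of 100 is the initial potential: all half-edges may be unseen, and each of the
    -- seeds may be pending with every half-edge at it.
    searchCost : ℕ
    searchCost = 100 + length S * 40 + (2 * length all + length S * suc (length all)) * 100

    run-search : ∀ {es} → Pointwise Denotes es S → (∀ v → mem σ₀ (B + toℕ v) ≡ 0) →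
      Run w (search es) σ₀ searchCost Found
    run-search {es} ds clear = run-weaken
      (run-⨟ (run-:= (ev-lit (fits-lit 0)) (run-⨟ (run-:= (ev-lit (fits-lit 0))
        (run-⨟ (run-:= (ev-lit (fits-lit 0)) (run-⨟ (run-weaken
          (run-plant {vs = []} ds (λ _ m → m) start ≤-refl) ≤-refl loop))))))))
      (≤-trans (≤-reflexive (cong (λ z → 2 + (2 + (2 + (1 + z * 40 + (6 + φ₀ * 86))))) (Pointwise-length ds)))
        (bound (length S) φ₀)) id
      where
      φ₀ = 2 * length all + length S * suc (length all)
      unseen-small : ∀ vs → unseen all vs ≤ length all
      unseen-small vs = length-filter (λ h → ¬? (tl h ∈? vs)) all
      adj-small : ∀ v → length (adj all v) ≤ length all
      adj-small v = length-filter (λ h → tl h ≟ᶠ v) all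
      weight-small : ∀ vs → weight vs ≤ length vs * suc (length all)
      weight-small [] = z≤n
      weight-small (v ∷ vs) = +-mono-≤ (s≤s (adj-small v)) (weight-small vs)
      potential-small : ∀ vs → length vs ≤ length S → 2 * unseen all vs + weight vs + 0 ≤ φ₀
      potential-small vs few = subst (_≤ φ₀) (sym (+-identityʳ _)) (+-mono-≤ (*-monoʳ-≤ 2 (unseen-small vs))
        (≤-trans (weight-small vs) (*-monoˡ-≤ (suc (length all)) few)))
      start : Visited (setReg (setReg (setReg σ₀ 8 0) 9 0) 7 0) []
      start = record
        { frame = frame-reg {q = 7} ≤-refl (frame-reg {q = 9} (≤ᵇ⇒≤ 7 9 tt) (frame-reg {q = 8} (≤ᵇ⇒≤ 7 8 tt)
            (record { regs-kept = λ _ _ → refl ; mem-kept = λ _ _ → refl ; out-kept = refl })))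
        ; count = refl ; queue = λ { [] v zs () ; (_ ∷ _) v zs () } ; tree = [] ; fresh = λ v _ → clear v }
      loop : ∀ {σ} → (∃[ vs ] Visited σ vs × length vs ≤ length S × (∀ v → v ∈ S → v ∈ vs) ×
        (∀ v → v ∈ [] → v ∈ vs) × regs σ 7 ≡ 0 × regs σ 9 ≡ 0) →
        Run w (whilenz (op add (reg 7) (op less (reg 9) (reg 8))) explore) σ (6 + φ₀ * 86) Found
      loop (vs , V , few , in-S , _ , e7 , e9) =
        run-weaken (run-while {I = λ φ σ → ∃[ cs ] Loop φ cs σ} loop-step _ ([] , record
          { pend = vs ; don = [] ; split = sym (++-identityʳ vs) ; visited = V ; head = e9 ; chain = e7
          ; local = λ _ () ; closed = λ _ () ; seeds = in-S ; small = +-mono-≤ few (unseen-small vs)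
          ; potential = refl })) (+-monoʳ-≤ 6 (*-monoˡ-≤ 86 (potential-small vs few))) id
      bound : ∀ a φ → 2 + (2 + (2 + (1 + a * 40 + (6 + φ * 86)))) ≤ 100 + a * 40 + φ * 100
      bound a φ = subst (_≤ 100 + a * 40 + φ * 100) (sym (arith a φ)) (+-mono-≤ (+-monoˡ-≤ (a * 40) {13} {100} (≤ᵇ⇒≤ _ _ tt)) (*-monoʳ-≤ φ {86} {100} (≤ᵇ⇒≤ _ _ tt)))
        where
        arith : ∀ a φ → 2 + (2 + (2 + (1 + a * 40 + (6 + φ * 86)))) ≡ 13 + a * 40 + φ * 86
        arith = solve-∀

    residual-live : ∀ {h} → Live h → 0 < residual u h
    residual-live l = m<n⇒0<n∸m l

    -- Along the tree every vertex is a seed or the head of a residual arc from an older vertex, so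
    -- a closed set that contains the seeds cannot miss it.
    tree⊆closed : ∀ {χ μ vs} → (∀ v → v ∈ S → χ v ≡ true) → Closed (residual u) χ → Tree μ vs →
      ∀ v → v ∈ vs → χ v ≡ true
    tree⊆closed seeds closed (grow _ o T) v (there v∈) = tree⊆closed seeds closed T v v∈
    tree⊆closed {χ} seeds closed (grow {vs = vs} _ o T) v (here refl) = go o
      where
      go : ∀ {k} → Origin vs v k → χ v ≡ true
      go (seed v∈) = seeds v v∈
      go (via h refl t∈ l) = closed h (tree⊆closed seeds closed T _ t∈) (residual-live l)

    -- The failing half of the duality: a reached vertex outside `χ` shows that `χ` is not closed.
    separating⇒outflow>0 : ∀ {σ} (f : Found σ) {χ v} → (∀ v → v ∈ S → χ v ≡ true) → v ∈ Found.vs f → χ v ≡ false →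
      0 < outflow (residual u) χ
    separating⇒outflow>0 f {χ} {v} seeds v∈ out-v with outflow (residual u) χ in eq
    ... | suc _ = z<s
    ... | zero with () ← trans (sym out-v) (tree⊆closed seeds (outflow≡0⇒closed {ρ = residual u} {χ} eq) (tree (Found.visited f)) v v∈)

    -- The succeeding half of the duality: when no sink is reached, the visited set itself is a cut
    -- that no residual unit leaves.
    found-closed : ∀ {σ} (f : Found σ) → outflow (residual u) (member (Found.vs f)) ≡ 0
    found-closed f = closed⇒outflow≡0 {ρ = residual u} {member (Found.vs f)} closed
      where
      closed : Closed (residual u) (member (Found.vs f))
      closed h t∈ l with tl h ∈? Found.vs f
      ... | yes m = dec-true (hd h ∈? Found.vs f) (Found.closed f h m (m∸n≢0⇒n<m (>⇒≢ l)))

    found-reg : ∀ {σ q v} → 7 ≤ q → q ≢ 8 → Found σ → Found (setReg σ q v)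
    found-reg 7≤q q≢8 f = record { vs = vs ; visited = visited-reg 7≤q q≢8 visited ; closed = closed ; seeds = seeds ; small = small }
      where open Found f

    -- A later hit overwrites an earlier one in register 10; any reached sink serves as the end of
    -- the path.
    data Probed (Ts : List (Fin n)) (σ : State) : Set where
      hit  : (f : Found σ) (v : Fin n) → regs σ 11 ≢ 0 → regs σ 10 ≡ toℕ v → v ∈ Ts → v ∈ Found.vs f → Probed Ts σ
      miss : (f : Found σ) → regs σ 11 ≡ 0 → (∀ v → v ∈ Ts → v ∉ Found.vs f) → Probed Ts σ

    run-probe : ∀ {es Us σ} Ts → Pointwise Denotes es Us → Probed Ts σ →
      Run w (probe es) σ (1 + length es * 30) (Probed (Ts ++ Us))
    run-probe Ts [] p = run-skip (subst (λ z → Probed z _) (sym (++-identityʳ Ts)) p)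
    run-probe {e ∷ es} {v ∷ Us} {σ} Ts ((c , d) ∷ ds) p = run-weaken
      (run-⨟ (run-:= (d (F p)) (run-⨟ (one p))))
      (≤-trans (+-monoˡ-≤ _ (s≤s c)) (≤-trans (m≤m+n _ 17) (≤-reflexive (arith (length es * 30))))) id
      where
      arith : ∀ z → 3 + (10 + (1 + z)) + 17 ≡ 1 + (30 + z)
      arith = solve-∀
      found : ∀ {Ts σ} → Probed Ts σ → Found σ
      found (hit f _ _ _ _ _) = f
      found (miss f _ _) = f
      F : ∀ {Ts σ} → Probed Ts σ → Frame σ
      F p = frame (Found.visited (found p))
      σ₁ = setReg σ 12 (toℕ v)
      rest : ∀ {σ} → Probed (Ts ++ [ v ]) σ → Run w (probe es) σ (1 + length es * 30) (Probed (Ts ++ v ∷ Us))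
      rest p = subst (λ z → Run w (probe es) _ (1 + length es * 30) (Probed z)) (++-assoc Ts [ v ] Us) (run-probe (Ts ++ [ v ]) ds p)
      one : Probed Ts σ → Run w (ifnz (load (markᵉ (reg 12))) (11 := lit 1 ⨟ 10 := reg 12) skip) σ₁ 10
        (λ σ′ → Run w (probe es) σ′ (1 + length es * 30) (Probed (Ts ++ v ∷ Us)))
      one p with v ∈? Found.vs (found p)
      ... | yes v∈ = within (run-then (ev-load (ev-mark (frame-reg (≤ᵇ⇒≤ 7 12 tt) (F p)) (ev-reg refl)) refl)
              (marked (tree (Found.visited (found p))) v∈)
              (run-⨟ (run-:= (ev-lit (fits-lit 1)) (run-:= (ev-reg refl)
                (rest (hit (found-reg (≤ᵇ⇒≤ 7 10 tt) (λ ()) (found-reg (≤ᵇ⇒≤ 7 11 tt) (λ ()) (found-reg (≤ᵇ⇒≤ 7 12 tt) (λ ()) (found p))))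
                  v (λ ()) refl (∈-++⁺ʳ Ts (here refl)) v∈))))))
      one p@(hit f v′ fl at i₁ i₂) | no v∉ =
        within (run-else (ev-load (ev-mark (frame-reg (≤ᵇ⇒≤ 7 12 tt) (F p)) (ev-reg refl)) (fresh (Found.visited f) v v∉)) refl
          (run-skip (rest (hit (found-reg (≤ᵇ⇒≤ 7 12 tt) (λ ()) f) v′ fl at (∈-++⁺ˡ i₁) i₂))))
      one p@(miss f fl none) | no v∉ =
        within (run-else (ev-load (ev-mark (frame-reg (≤ᵇ⇒≤ 7 12 tt) (F p)) (ev-reg refl)) (fresh (Found.visited f) v v∉)) refl
          (run-skip (rest (miss (found-reg (≤ᵇ⇒≤ 7 12 tt) (λ ()) f) fl none′))))
        where
        none′ : ∀ v′ → v′ ∈ Ts ++ [ v ] → v′ ∉ Found.vs f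
        none′ v′ m with ∈-++⁻ Ts m
        ... | inj₁ m′ = none v′ m′
        ... | inj₂ (here refl) = v∉

    -- Sending one unit along the search path

    record Unwound (goal : Fin n) (σ₁ σ : State) : Set where
      field
        regs-kept : ∀ q → q < 7 → regs σ q ≡ regs σ₀ q
        mem-kept  : ∀ a → a < O ⊎ O + Z ≤ a → mem σ a ≡ mem σ₁ a
        out-kept  : out σ ≡ out σ₀
        root      : Fin n
        root-seed : root ∈ S
        u′        : Half → ℕ
        u′≤1      : ∀ h → u′ h ≤ 1
        used′     : ∀ h → mem σ (O + ad h) ≡ u′ h
        conserved : ∀ χ → outflow (residual u′) χ + bit (χ root) ≡ outflow r χ + bit (χ goal)

    module Unwinding (idle : ∀ h → u h ≡ 0) (after : B + (Z + Z) ≤ O) {σ₁ : State} (F₁ : Frame σ₁) (goal : Fin n) where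

      record Climb (φ : ℕ) (σ : State) : Set where
        field
          vs        : List (Fin n)
          v         : Fin n
          at        : regs σ 10 ≡ toℕ v
          path      : Tree (mem σ₁) (v ∷ vs)
          depth     : length vs ≤ φ
          regs-kept : ∀ q → q < 7 → regs σ q ≡ regs σ₀ q
          mem-kept  : ∀ a → a < O ⊎ O + Z ≤ a → mem σ a ≡ mem σ₁ a
          out-kept  : out σ ≡ out σ₀
          u′        : Half → ℕ
          u′≤1      : ∀ h → u′ h ≤ 1
          used′     : ∀ h → mem σ (O + ad h) ≡ u′ h
          unused    : ∀ h → tl h ∈ v ∷ vs → hd h ∈ v ∷ vs → u′ h ≡ 0
          conserved : ∀ χ → outflow (residual u′) χ + bit (χ v) ≡ outflow r χ + bit (χ goal)

      -- The tail of the recorded arc need not be the vertex visited just before; forgetting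
      -- everything newer than it gives the tree for the next step.
      tree-from : ∀ {μ v vs} → Tree μ vs → v ∈ vs →
        ∃[ ws ] Tree μ (v ∷ ws) × length ws < length vs × (∀ z → z ∈ v ∷ ws → z ∈ vs)
      tree-from T@(grow {vs = vs} _ _ _) (here refl) = vs , T , ≤-refl , λ _ m → m
      tree-from (grow _ _ T) (there m) with tree-from T m
      ... | ws , T′ , l , inc = ws , T′ , m≤n⇒m≤1+n l , λ z i → there (inc z i)

      B+Z≤O : B + Z ≤ O
      B+Z≤O = ≤-trans (+-monoʳ-≤ B (m≤m+n Z Z)) after

      climb : ∀ φ {σ} → Climb φ σ →
        ∃[ k ] Ev w σ (op sub (load (markᵉ (reg 10))) (lit 1)) k × (k ≡ 0 → Unwound goal σ₁ σ) ×
          (k ≢ 0 → Run w (12 := load (markᵉ (reg 10)) ⨟ store (usedᵉ (reg 12)) (lit 1) ⨟ 10 := load (reg 12)) σ 20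
            (λ σ′ → ∃[ φ′ ] φ′ < φ × Climb φ′ σ′))
      climb φ {σ} C with Climb.path C
      ... | grow {vs = vs} v∉ o T = go o refl
        where
        open Climb C hiding (vs) renaming (regs-kept to regsᶜ; mem-kept to memᶜ; out-kept to outᶜ)
        mark-ev : ∀ {k} → mem σ₁ (B + toℕ v) ≡ k → Ev w σ (load (markᵉ (reg 10))) k
        mark-ev eq = ev-load (ev-add (ev-reg (trans (regsᶜ 5 (<ᵇ⇒< _ _ tt)) base)) (ev-reg at)
            (fits (≤-trans (+-monoʳ-≤ B (≤-trans (<⇒≤ (node<Z v)) (m≤n+m Z (Z + Z)))) B≤)))
          (trans (memᶜ _ (inj₁ (<-≤-trans (+-monoʳ-< B (node<Z v)) B+Z≤O))) eq)
        go : ∀ {k} → Origin vs v k → mem σ₁ (B + toℕ v) ≡ k →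
          ∃[ k ] Ev w σ (op sub (load (markᵉ (reg 10))) (lit 1)) k × (k ≡ 0 → Unwound goal σ₁ σ) ×
          (k ≢ 0 → Run w (12 := load (markᵉ (reg 10)) ⨟ store (usedᵉ (reg 12)) (lit 1) ⨟ 10 := load (reg 12)) σ 20
            (λ σ′ → ∃[ φ′ ] φ′ < φ × Climb φ′ σ′))
        go (seed v∈S) eq = 0 , ev-sub (mark-ev eq) (ev-lit (fits-lit 1)) (fits-lit 1)
          , (λ _ → record { regs-kept = regsᶜ ; mem-kept = memᶜ ; out-kept = outᶜ ; root = v ; root-seed = v∈S
                          ; u′ = u′ ; u′≤1 = u′≤1 ; used′ = used′ ; conserved = conserved })
          , λ nz → ⊥-elim (nz refl)
        go (via h hd≡v t∈ live) eq = ad h ∸ 1 , ev-sub (mark-ev eq) (ev-lit (fits-lit 1)) (fits-Z (<⇒≤ (ad<Z h)))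
          , (λ z → ⊥-elim (<-irrefl (sym z) (m<n⇒0<n∸m (≤-trans (≤ᵇ⇒≤ 2 4 tt) (4≤ad h)))))
          , λ _ → within (run-⨟ (run-:= (mark-ev eq) (run-⨟ (run-store
              (ev-add (ev-reg (trans (regsᶜ 6 (<ᵇ⇒< _ _ tt)) usedBase)) (ev-reg refl)
                (fits (≤-trans (+-monoʳ-≤ O (<⇒≤ (ad<Z h))) O≤)))
              (ev-lit (fits-lit 1))
              (run-:= (ev-load (ev-reg refl) tail-here) next)))))
          where
          μ′ = mem σ [ O + ad h ↦ 1 ]
          low-O : ∀ {a} → a < Z → a < O
          low-O a<Z = <-≤-trans a<Z (≤-trans (m≤n+m Z B) B+Z≤O)
          kept : ∀ a → a < O ⊎ O + Z ≤ a → μ′ a ≡ mem σ₁ a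
          kept a o = trans (upd-other (mem σ) (apart′ o)) (memᶜ a o)
            where
            apart′ : a < O ⊎ O + Z ≤ a → O + ad h ≢ a
            apart′ (inj₁ lt) = >⇒≢ (<-≤-trans lt (m≤m+n O _))
            apart′ (inj₂ le) = <⇒≢ (<-≤-trans (+-monoʳ-< O (ad<Z h)) le)
          tail-here : μ′ (ad h) ≡ toℕ (tl h)
          tail-here = trans (kept (ad h) (inj₁ (low-O (ad<Z h)))) (trans (static F₁ (low (ad<Z h))) (tails h))
          _≟ʰ_ : (h h′ : Half) → Dec (h ≡ h′)
          _≟ʰ_ = ≡-dec _≟ᶠ_ Data.Bool._≟_
          u″ : Half → ℕ
          u″ h′ = if does (h ≟ʰ h′) then 1 else u′ h′
          u″-at : u″ h ≡ 1
          u″-at with h ≟ʰ h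
          ... | yes _ = refl
          ... | no ne = ⊥-elim (ne refl)
          u″-other : ∀ {h′} → h ≢ h′ → u″ h′ ≡ u′ h′
          u″-other {h′} ne with h ≟ʰ h′
          ... | yes e = ⊥-elim (ne e)
          ... | no _  = refl
          used″ : ∀ h′ → μ′ (O + ad h′) ≡ u″ h′
          used″ h′ with h ≟ʰ h′
          ... | yes refl = upd-same (mem σ) {a = O + ad h} refl
          ... | no ne    = trans (upd-other (mem σ) (λ e → ne (ad-injective h h′ (+-cancelˡ-≡ O _ _ e)))) (used′ h′)
          v≡ : ∀ {z} → z ∈ vs → z ≢ hd h
          v≡ z∈ refl = v∉ (subst (_∈ vs) hd≡v z∈)
          h≢tw : h ≢ tw h
          h≢tw e = v≡ t∈ (cong tl e)
          u′h : u′ h ≡ 0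
          u′h = unused h (there t∈) (here hd≡v)
          u′tw : u′ (tw h) ≡ 0
          u′tw = unused (tw h) (here hd≡v) (there (subst (λ b → tl (proj₁ h , b) ∈ vs) (sym (not-involutive (proj₂ h))) t∈))
          r>0 : 0 < r h
          r>0 = subst₂ _<_ (idle h) (trans (cong (r h +_) (idle (tw h))) (+-identityʳ _)) live
          tw-tw : tw (tw h) ≡ h
          tw-tw = cong (proj₁ h ,_) (not-involutive (proj₂ h))
          down : suc (residual u″ h) ≡ residual u′ h
          down = begin
            suc (r h + u″ (tw h) ∸ u″ h)  ≡⟨ cong₂ (λ a b → suc (r h + a ∸ b)) (trans (u″-other h≢tw) u′tw) u″-at ⟩
            suc (r h + 0 ∸ 1)             ≡⟨ cong (λ z → suc (z ∸ 1)) (+-identityʳ (r h)) ⟩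
            suc (r h ∸ 1)                 ≡⟨ m+[n∸m]≡n r>0 ⟩
            r h                           ≡⟨ +-identityʳ (r h) ⟨
            r h + 0 ∸ 0                   ≡⟨ cong₂ (λ a b → r h + a ∸ b) u′tw u′h ⟨
            residual u′ h                 ∎
            where open ≡-Reasoning
          up : residual u″ (tw h) ≡ suc (residual u′ (tw h))
          up = begin
            r (tw h) + u″ (tw (tw h)) ∸ u″ (tw h)  ≡⟨ cong₂ (λ a b → r (tw h) + a ∸ b) (trans (cong u″ tw-tw) u″-at) (trans (u″-other h≢tw) u′tw) ⟩
            r (tw h) + 1 ∸ 0                       ≡⟨ +-comm (r (tw h)) 1 ⟩
            suc (r (tw h))                         ≡⟨ cong suc (+-identityʳ _) ⟨
            suc (r (tw h) + 0 ∸ 0)                 ≡⟨ cong₂ (λ a b → suc (r (tw h) + a ∸ b)) (trans (cong u′ tw-tw) u′h) u′tw ⟨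
            suc (residual u′ (tw h))               ∎
            where open ≡-Reasoning
          others : ∀ j b → j ≢ proj₁ h → residual u″ (j , b) ≡ residual u′ (j , b)
          others j b ne = cong₂ (λ p q → r (j , b) + p ∸ q) (u″-other (λ e → ne (cong proj₁ (sym e)))) (u″-other (λ e → ne (cong proj₁ (sym e))))
          next : ∃[ φ′ ] φ′ < φ × Climb φ′ _
          next with tree-from T t∈
          ... | ws , T′ , l , inc = length ws , <-≤-trans l depth , record
            { vs = ws ; v = tl h ; at = refl ; path = T′ ; depth = ≤-refl
            ; regs-kept = λ q q<7 → trans (upd-other (regs (setReg σ 12 _)) (>⇒≢ (<-≤-trans q<7 (≤ᵇ⇒≤ 7 10 tt))))
                (trans (upd-other (regs σ) (>⇒≢ (<-≤-trans q<7 (≤ᵇ⇒≤ 7 12 tt)))) (regsᶜ q q<7))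
            ; mem-kept = kept ; out-kept = outᶜ ; u′ = u″
            ; u′≤1 = u″≤1 ; used′ = used″
            -- The arc just used ends at the vertex left behind, which is absent from the older part
            -- of the tree, so the update does not touch the half-edges that remain.
            ; unused = λ h′ t∈′ h∈′ → trans (u″-other (λ { refl → v≡ (inc _ h∈′) refl })) (unused h′ (there (inc _ t∈′)) (there (inc _ h∈′)))
            ; conserved = λ χ → trans (outflow-push h others down up χ) (subst (λ z → outflow (residual u′) χ + bit (χ z) ≡ outflow r χ + bit (χ goal)) (sym hd≡v) (conserved χ)) }
            where
            u″≤1 : ∀ h′ → u″ h′ ≤ 1
            u″≤1 h′ with h ≟ʰ h′
            ... | yes _ = ≤-refl
            ... | no _  = u′≤1 h′

      run-unwind : (f : Found σ₁) → regs σ₁ 10 ≡ toℕ goal → goal ∈ Found.vs f →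
        Run w unwind σ₁ (10 + K * 30) (Unwound goal σ₁)
      run-unwind f at goal∈ with tree-from (tree (Found.visited f)) goal∈
      ... | ws , T , l , _ = run-weaken (run-while {I = Climb} climb K (record
          { vs = ws ; v = goal ; at = at ; path = T ; depth = ≤-trans (<⇒≤ l) (Found.small f)
          ; regs-kept = Frame.regs-kept F₁ ; mem-kept = λ _ _ → refl ; out-kept = Frame.out-kept F₁
          ; u′ = u ; u′≤1 = u≤1 ; used′ = λ h → trans (Frame.mem-kept F₁ _ (inj₂ (≤-trans after (m≤m+n O _)))) (used h)
          ; unused = λ h _ _ → idle h
          ; conserved = λ χ → cong (λ z → z + bit (χ goal)) (sum-cong-≗ (λ i → leaving-cong (χ (x i)) (χ (y i)) (λ b →
              trans (cong₂ (λ p q → r (i , b) + p ∸ q) (idle _) (idle _)) (+-identityʳ _)))) }))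
          (+-mono-≤ (≤ᵇ⇒≤ 7 10 tt) (*-monoʳ-≤ K (≤ᵇ⇒≤ 27 30 tt))) id

  -- Register 7 belongs to the loop: the invariant must survive any assignment to it, and the body
  -- must return it unchanged.
  run-forEdges : ∀ {P K σ} (I : ℕ → State → Set) →
    (∀ {i σ} → I i σ → mem σ 2 ≡ 4 + 8 * M) →
    (∀ {i σ} v → I i σ → I i (setReg σ 7 v)) →
    (∀ (i : Fin M) {σ} → I (toℕ i) σ → regs σ 7 ≡ ad (i , false) →
      Run w P σ K (λ σ′ → I (suc (toℕ i)) σ′ × regs σ′ 7 ≡ ad (i , false))) →
    I 0 σ → Run w (forEdges P) σ (10 + M * (10 + K)) (I M)
  run-forEdges {P} {K} {σ} I end stable step init = run-weaken
    (run-⨟ (run-:= (ev-lit (fits-lit 4)) (run-while {K = K + 4} {I = Ahead} next M (0 , refl , refl , stable 4 init))))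
    (+-mono-≤ (≤ᵇ⇒≤ 7 10 tt) (*-monoʳ-≤ M (subst (_≤ 10 + K) (cong (5 +_) (+-comm 4 K)) (n≤1+n (9 + K))))) id
    where
    Ahead : ℕ → State → Set
    Ahead φ σ = ∃[ i ] i + φ ≡ M × regs σ 7 ≡ 4 + 8 * i × I i σ
    in-range : ∀ {i} → i ≤ M → 4 + 8 * i ≤ Z
    in-range i≤M = ≤-trans (+-mono-≤ (≤ᵇ⇒≤ 4 16 tt) (*-monoʳ-≤ 8 i≤M)) end≤Z
    next : ∀ φ {σ} → Ahead φ σ → ∃[ v ] Ev w σ (op less (reg 7) (load (lit 2))) v × (v ≡ 0 → I M σ) ×
      (v ≢ 0 → Run w (P ⨟ 7 := op add (reg 7) (lit 8)) σ (K + 4) (λ σ′ → ∃[ φ′ ] φ′ < φ × Ahead φ′ σ′))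
    next zero {σ} (i , eq , r7 , I-i) = 0
      , ev-≮ (ev-reg r7) (ev-load (ev-lit (fits-lit 2)) (end I-i)) (fits-lit 1) (λ lt → <-irrefl (cong (λ i → 4 + 8 * i) i≡M) lt)
      , (λ _ → subst (λ i → I i σ) i≡M I-i) , λ nz → ⊥-elim (nz refl)
      where
      i≡M : i ≡ M
      i≡M = trans (sym (+-identityʳ i)) eq
    next (suc φ) {σ} (i , eq , r7 , I-i) = 1
      , ev-lt (ev-reg r7) (ev-load (ev-lit (fits-lit 2)) (end I-i)) (fits-lit 1) (+-monoʳ-< 4 (*-monoʳ-< 8 i<M))
      , (λ ()) , λ _ → run-⨟ (run-weaken
          (step (fromℕ< i<M) (subst (λ i → I i σ) (sym at) I-i) (trans r7 (cong (λ i → 4 + 8 * i) (sym at)))) ≤-refl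
          λ (I′ , r7′) → run-:= (ev-add (ev-reg r7′) (ev-lit (fits-lit 8))
              (fits-Z (subst (λ i → 4 + 8 * i + 8 ≤ Z) (sym at) (subst (_≤ Z) (arith i) (in-range i<M)))))
            (φ , ≤-refl , suc i , trans (sym (+-suc i φ)) eq , trans (cong (λ i → 4 + 8 * i + 8) at) (sym (arith i))
            , stable _ (subst (λ i → I (suc i) _) at I′)))
      where
      i<M : i < M
      i<M = subst (i <_) eq (m<m+n i z<s)
      at : toℕ (fromℕ< i<M) ≡ i
      at = toℕ-fromℕ< i<M
      arith : ∀ i → 4 + 8 * suc i ≡ 4 + 8 * i + 8
      arith = solve-∀

  -- Building the adjacency lists

  heads-of : List Half → Fin n → ℕ
  heads-of []       v = 0
  heads-of (h ∷ hs) v = if does (tl h ≟ᶠ v) then ad h else heads-of hs v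

  -- Each next pointer is the first half-edge that the list of its tail had before the insertion,
  -- that is, the value of `heads-of` on the older half-edges.
  Linked : (ℕ → ℕ) → List Half → Set
  Linked μ []       = ⊤
  Linked μ (h ∷ hs) = μ (Z + Z + ad h) ≡ heads-of hs (tl h) × Linked μ hs

  linked⇒chain : ∀ {μ} hs → Linked μ hs → ∀ v → Chain μ (heads-of hs v) (adj hs v)
  linked⇒chain [] _ v = refl
  linked⇒chain {μ} (h ∷ hs) (eq , L) v with tl h ≟ᶠ v
  ... | yes refl = refl , subst (λ p → Chain μ p (adj hs v)) (sym eq) (linked⇒chain hs L v)
  ... | no _     = linked⇒chain hs L v

  linked-cong : ∀ {μ μ′} hs → (∀ h → h ∈ hs → μ′ (Z + Z + ad h) ≡ μ (Z + Z + ad h)) → Linked μ hs → Linked μ′ hs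
  linked-cong [] eq L = tt
  linked-cong (h ∷ hs) eq (e , L) = trans (eq h (here refl)) e , linked-cong hs (λ h′ m → eq h′ (there m)) L

  module _ (σ₀ : State) (env : Env (mem σ₀)) (clear : ∀ a → Z ≤ a → mem σ₀ a ≡ 0) where

    open Env env

    -- Half-edges are inserted by increasing address; `below` records this and shows that writing a
    -- new next pointer spares the older ones.
    record Linking (hs : List Half) (b : ℕ) (σ : State) : Set where
      field
        regs-kept : ∀ q → q < 5 → regs σ q ≡ regs σ₀ q
        out-kept  : out σ ≡ out σ₀
        low       : ∀ a → a < Z → mem σ a ≡ mem σ₀ a
        high      : ∀ a → Z + Z + Z ≤ a → mem σ a ≡ 0
        below     : ∀ h → h ∈ hs → ad h < b
        linked    : Linked (mem σ) hs
        firsts    : ∀ v → mem σ (Z + toℕ v) ≡ heads-of hs v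

    open Linking

    ev-sizeᵢ : ∀ {hs b σ} → Linking hs b σ → Ev w σ sizeᵉ Z
    ev-sizeᵢ L = ev-load (ev-lit (fits-lit 3)) (trans (low L 3 (<-≤-trans (<ᵇ⇒< 3 16 tt) 16≤Z)) size)

    run-link : ∀ {e hs b σ} h → Linking hs b σ → b ≤ ad h → cost e ≤ 3 →
      (∀ {σ′} → regs σ′ 7 ≡ regs σ 7 → Ev w σ′ e (ad h)) →
      Run w (link e) σ 40 (λ σ′ → Linking (h ∷ hs) (ad h + 4) σ′ × regs σ′ 7 ≡ regs σ 7)
    run-link {e} {hs} {b} {σ} h L b≤ c ev-e = run-weaken (run-⨟
      (run-store (ev-add (ev-add (ev-sizeᵢ L) (ev-sizeᵢ L) (fits-3Z (m≤m+n _ _))) (ev-e refl) (fits-3Z (+-monoʳ-≤ (Z + Z) (<⇒≤ (ad<Z h)))))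
        (ev-load (ev-add (ev-sizeᵢ L) (ev-load (ev-e refl) (trans (low L _ (ad<Z h)) (tails h))) fit₂) (firsts L (tl h)))
      (run-store (ev-add (ev-load (ev-lit (fits-lit 3)) (trans (at-low (<-≤-trans (<ᵇ⇒< 3 16 tt) 16≤Z)) size))
          (ev-load (ev-e refl) (trans (at-low (ad<Z h)) (tails h))) fit₂) (ev-e refl)
        (L′ , refl))))
      (≤-trans (≤-reflexive (arith (cost e))) (≤-trans (+-monoʳ-≤ 17 (*-monoʳ-≤ 4 c)) (≤ᵇ⇒≤ _ _ tt))) id
      where
      arith : ∀ c → 1 + (1 + (1 + 2 + 2) + c) + (1 + (1 + 2 + (1 + c))) + (1 + (1 + 2 + (1 + c)) + c) ≡ 17 + 4 * c
      arith = solve-∀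
      fit₂ : Z + toℕ (tl h) < 2 ^ w
      fit₂ = fits-3Z (≤-trans (+-monoʳ-≤ Z (<⇒≤ (node<Z (tl h)))) (m≤m+n (Z + Z) Z))
      μ₁ = mem σ [ Z + Z + ad h ↦ heads-of hs (tl h) ]
      μ₂ = μ₁ [ Z + toℕ (tl h) ↦ ad h ]
      at-low : ∀ {a} → a < Z → μ₁ a ≡ mem σ₀ a
      at-low {a} a<Z = trans (upd-other (mem σ) (>⇒≢ (<-≤-trans a<Z (≤-trans (m≤m+n Z Z) (m≤m+n _ _))))) (low L a a<Z)
      first<next : ∀ (v : Fin n) k → Z + toℕ v < Z + Z + k
      first<next v k = <-≤-trans (+-monoʳ-< Z (node<Z v)) (m≤m+n _ k)
      firsts′ : ∀ v → μ₂ (Z + toℕ v) ≡ heads-of (h ∷ hs) v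
      firsts′ v with tl h ≟ᶠ v
      ... | yes refl = upd-same μ₁ {a = Z + toℕ (tl h)} refl
      ... | no ne = trans (upd-other μ₁ (λ eq → ne (toℕ-injective (+-cancelˡ-≡ Z _ _ eq))))
                      (trans (upd-other (mem σ) (>⇒≢ (first<next v (ad h)))) (firsts L v))
      L′ : Linking (h ∷ hs) (ad h + 4) (setMem (setMem σ (Z + Z + ad h) (heads-of hs (tl h))) (Z + toℕ (tl h)) (ad h))
      L′ = record
        { regs-kept = regs-kept L ; out-kept = out-kept L
        ; low = λ a a<Z → trans (upd-other μ₁ (>⇒≢ (<-≤-trans a<Z (m≤m+n Z _)))) (at-low a<Z)
        ; high = λ a ≤a → trans (upd-other μ₁ (<⇒≢ (<-≤-trans (first<next (tl h) Z) ≤a)))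
            (trans (upd-other (mem σ) (<⇒≢ (<-≤-trans (+-monoʳ-< (Z + Z) (ad<Z h)) ≤a))) (high L a ≤a))
        ; below = λ { _ (here refl) → m<m+n _ z<s ; h′ (there m) → <-≤-trans (below L h′ m) (≤-trans b≤ (m≤m+n _ 4)) }
        ; linked = trans (upd-other μ₁ (<⇒≢ (first<next (tl h) (ad h)))) (upd-same (mem σ) {a = Z + Z + ad h} refl)
            , linked-cong hs (λ h′ m → trans (upd-other μ₁ (<⇒≢ (first<next (tl h) (ad h′))))
                (upd-other (mem σ) (λ eq → <⇒≢ (<-≤-trans (below L h′ m) b≤) (sym (+-cancelˡ-≡ (Z + Z) _ _ eq))))) (linked L)
        ; firsts = firsts′ }

    record Prepared (σ : State) : Set where
      field
        regs-kept : ∀ q → q < 5 → regs σ q ≡ regs σ₀ q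
        base      : regs σ 5 ≡ Z + Z + Z
        out-kept  : out σ ≡ out σ₀
        low       : ∀ a → a < Z → mem σ a ≡ mem σ₀ a
        high      : ∀ a → Z + Z + Z ≤ a → mem σ a ≡ 0
        hs        : List Half
        every     : ∀ h → h ∈ hs
        few       : length hs ≤ 2 * M
        chains    : ∀ v → Chain (mem σ) (mem σ (Z + toℕ v)) (adj hs v)

    run-prepare : Run w prepare σ₀ (20 + M * 100) Prepared
    run-prepare = run-weaken
      (run-⨟ (run-weaken (run-forEdges {K = 80} I
          (λ (_ , _ , _ , L) → trans (low L 2 (<-≤-trans (<ᵇ⇒< 2 16 tt) 16≤Z)) end)
          (λ {_} {σ} v (hs , f , e , L) → hs , f , e , record { regs-kept = λ q q<5 → trans (upd-other (regs σ) (>⇒≢ (<-trans q<5 (<ᵇ⇒< 5 7 tt)))) (regs-kept L q q<5)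
            ; out-kept = out-kept L ; low = low L ; high = high L ; below = below L ; linked = linked L ; firsts = firsts L })
          step
          ([] , z≤n , (λ _ ()) , record { regs-kept = λ _ _ → refl ; out-kept = refl ; low = λ _ _ → refl
            ; high = λ a ≤a → clear a (≤-trans (m≤n+m Z (Z + Z)) ≤a) ; below = λ _ () ; linked = tt ; firsts = λ v → clear _ (m≤m+n Z _) }))
        ≤-refl λ {σ} (hs , f , e , L) →
          run-:= (ev-add (ev-add (ev-sizeᵢ L) (ev-sizeᵢ L) (fits-3Z (m≤m+n _ _))) (ev-sizeᵢ L) (fits-3Z ≤-refl))
            (record { regs-kept = λ q q<5 → trans (upd-other (regs σ) (>⇒≢ q<5)) (regs-kept L q q<5)
              ; base = refl ; out-kept = out-kept L ; low = low L ; high = high L ; hs = hs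
              ; every = λ (i , b) → e i (toℕ<n i) b
              ; few = f ; chains = λ v → subst (λ p → Chain _ p (adj hs v)) (sym (firsts L v)) (linked⇒chain hs (linked L) v) })))
      (≤-trans (≤-reflexive (+-comm _ 9)) (≤-trans (+-monoʳ-≤ 9 (+-monoʳ-≤ 10 (*-monoʳ-≤ M (≤ᵇ⇒≤ 90 100 tt)))) (n≤1+n _))) id
      where
      I : ℕ → State → Set
      I i σ = ∃[ hs ] length hs ≤ 2 * i × (∀ (j : Fin M) → toℕ j < i → ∀ b → (j , b) ∈ hs) × Linking hs (4 + 8 * i) σ
      step : ∀ (i : Fin M) {σ} → I (toℕ i) σ → regs σ 7 ≡ ad (i , false) →
        Run w (link (reg 7) ⨟ link (op add (reg 7) (lit 4))) σ 80 (λ σ′ → I (suc (toℕ i)) σ′ × regs σ′ 7 ≡ ad (i , false))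
      step i {σ} (hs , f , e , L) r7 = within (run-⨟ (run-weaken
        (run-link (i , false) L ≤-refl (≤ᵇ⇒≤ 1 3 tt) (λ eq → ev-reg (trans eq r7))) ≤-refl
        λ (L₁ , e₁) → run-weaken (run-link (i , true) L₁ (≤-reflexive (+-comm _ 4)) ≤-refl
            (λ eq → subst (Ev w _ _) (+-comm _ 4) (ev-add (ev-reg (trans eq (trans e₁ r7))) (ev-lit (fits-lit 4)) (fits-Z (<⇒≤ (ad+4<Z (i , false)))))))
          ≤-refl
          λ {σ″} (L₂ , e₂) → ((i , true) ∷ (i , false) ∷ hs
            , subst (2 + length hs ≤_) (sym (*-suc 2 (toℕ i))) (+-monoʳ-≤ 2 f)
            , every′ , subst (λ b → Linking ((i , true) ∷ (i , false) ∷ hs) b σ″) (arith (toℕ i)) L₂) , trans e₂ (trans e₁ r7)))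
        where
        arith : ∀ i → 8 + 8 * i + 4 ≡ 4 + 8 * suc i
        arith = solve-∀
        every′ : ∀ j → toℕ j < suc (toℕ i) → ∀ b → (j , b) ∈ (i , true) ∷ (i , false) ∷ hs
        every′ j j< b with j ≟ᶠ i
        every′ j j< false | yes refl = there (here refl)
        every′ j j< true  | yes refl = here refl
        every′ j j< b     | no ne    = there (there (e j (≤∧≢⇒< (s≤s⁻¹ j<) (λ eq → ne (toℕ-injective eq))) b))

  ev-equal : ∀ {σ a b p q} → Ev w σ a p → Ev w σ b q → Ev w σ (op equal a b) (bit (p ≡ᵇ q))
  ev-equal {p = p} {q} ep eq with p ≟ q
  ... | yes e = subst (Ev w _ _) (cong bit (sym (≡ᵇ-true e))) (ev-eq ep eq (fits-lit 1) e)
  ... | no ne = subst (Ev w _ _) (cong bit (sym (≡ᵇ-false ne))) (ev-≢ ep eq (fits-lit 1) ne)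

  ev-isZero : ∀ {σ e k} → Ev w σ e k → Ev w σ (isZeroᵉ e) (bit (k ≡ᵇ 0))
  ev-isZero ek = ev-equal ek (ev-lit (fits-lit 0))

  -- The words of the data structure

  halfRecord : Half → List ℕ
  halfRecord h = toℕ (tl h) ∷ toℕ (hd h) ∷ r h ∷ ad (tw h) ∷ []

  edgeRecord : Fin M → List ℕ
  edgeRecord i = halfRecord (i , false) ++ halfRecord (i , true)

  layout : List ℕ
  layout = toℕ s ∷ toℕ t ∷ 4 + 8 * M ∷ Z ∷ concat (tabulate edgeRecord)

  layout-length : length layout ≡ 4 + M * 8
  layout-length = cong (4 +_) (length-blocks 8 edgeRecord (λ _ → refl))

  layout-fits : Fits w layout
  layout-fits = fits-Z (<⇒≤ (node<Z s)) ∷ fits-Z (<⇒≤ (node<Z t)) ∷ fits-Z (≤-trans (+-monoˡ-≤ (8 * M) (≤ᵇ⇒≤ 4 16 tt)) end≤Z) ∷ fits-Z ≤-refl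
    ∷ All.concat⁺ (All.tabulate⁺ (λ i → half (i , false) (half (i , true) [])))
    where
    half : ∀ h {D} → Fits w D → Fits w (halfRecord h ++ D)
    half h ps = fits-Z (<⇒≤ (node<Z (tl h))) ∷ fits-Z (<⇒≤ (node<Z (hd h))) ∷ fits-Z (≤-trans (r≤2 h) (≤-trans (≤ᵇ⇒≤ 2 16 tt) 16≤Z))
      ∷ fits-Z (<⇒≤ (ad<Z (tw h))) ∷ ps

  layout-env : Env (contents layout)
  layout-env = record
    { source = refl ; sink = refl ; end = refl ; size = refl
    ; tails = λ { (i , false) → at₀ i ; (i , true) → at i 4 (<ᵇ⇒< 4 8 tt) (arith₈₀ i) }
    ; heads = λ { (i , false) → at i 1 (<ᵇ⇒< 1 8 tt) (+-assoc 4 (8 * toℕ i) 1) ; (i , true) → at i 5 (<ᵇ⇒< 5 8 tt) (arith₈ i 1) }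
    ; caps  = λ { (i , false) → at i 2 (<ᵇ⇒< 2 8 tt) (+-assoc 4 (8 * toℕ i) 2) ; (i , true) → at i 6 (<ᵇ⇒< 6 8 tt) (arith₈ i 2) }
    ; twins = λ { (i , false) → at i 3 (<ᵇ⇒< 3 8 tt) (+-assoc 4 (8 * toℕ i) 3) ; (i , true) → at i 7 (<ᵇ⇒< 7 8 tt) (arith₈ i 3) } }
    where
    at : ∀ i j → j < 8 → ∀ {a} → a ≡ 4 + (8 * toℕ i + j) → contents layout a ≡ contents (edgeRecord i) j
    at i j j<8 refl = contents-blocks 8 edgeRecord (λ _ → refl) i j<8
    at₀ : ∀ i → contents layout (4 + 8 * toℕ i) ≡ toℕ (x i)
    at₀ i = at i 0 (<ᵇ⇒< 0 8 tt) (cong (4 +_) (sym (+-identityʳ _)))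
    lemma₁ : ∀ z k → 8 + z + k ≡ 4 + (z + (4 + k))
    lemma₁ = solve-∀
    arith₈ : ∀ (i : Fin M) k → 8 + 8 * toℕ i + k ≡ 4 + (8 * toℕ i + (4 + k))
    arith₈ i k = lemma₁ (8 * toℕ i) k
    arith₈₀ : ∀ (i : Fin M) → 8 + 8 * toℕ i ≡ 4 + (8 * toℕ i + 4)
    arith₈₀ i = trans (sym (+-identityʳ _)) (arith₈ i 0)

  -- `tight` is kept besides `best` because it is the hypothesis under which no edge outside the
  -- stored subgraph crosses the cut.
  record Solved (ins : Bool) (e₁ e₂ : Edge n) (σ : State) : Set where
    field
      vs      : List (Fin n)
      unique  : Unique vs
      source∈ : member vs s ≡ true
      sink∉   : member vs t ≡ false
      tight   : outflow r (member vs) ≤ 1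
      best    : ∀ χ → χ s ≡ true → χ t ≡ false →
                outflow r (member vs) + shift ins (patternOf e₁ e₂ (member vs)) ≤ outflow r χ + shift ins (patternOf e₁ e₂ χ)
      reports : out σ ≡ length vs ∷ map toℕ vs ++ edgeWords (filterᵇ (crosses (member vs)) (if ins then e₁ ∷ e₂ ∷ [] else [])
                  ++ filterᵇ (λ e → crosses (member vs) e ∧ (if ins then true else not (e ∥ᵇ e₁) ∧ not (e ∥ᵇ e₂))) (tabulate ed))

  -- Trying one pattern

  terminals : Edge n → Edge n → Fin 4 → Fin n
  terminals e₁ e₂ zero                   = end₁ e₁
  terminals e₁ e₂ (suc zero)             = end₂ e₁
  terminals e₁ e₂ (suc (suc zero))       = end₁ e₂
  terminals e₁ e₂ (suc (suc (suc zero))) = end₂ e₂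

  record Session : Set where
    field
      σᵢ        : State
      env       : Env (mem σᵢ)
      hs        : List Half
      every     : ∀ h → h ∈ hs
      few       : length hs ≤ 2 * M
      chains    : ∀ v → Chain (mem σᵢ) (mem σᵢ (Z + toℕ v)) (adj hs v)
      out-empty : out σᵢ ≡ []
      e₁ e₂     : Edge n
      ins       : Bool
      ends-at   : ∀ i → regs σᵢ (suc (toℕ i)) ≡ toℕ (terminals e₁ e₂ i)

  module Querying (session : Session) where

    open Session session

    p : Fin 4 → Fin n
    p = terminals e₁ e₂

    Matches : Pattern → (Fin n → Bool) → Set
    Matches π χ = χ s ≡ true × χ t ≡ false × ∀ i → χ (p i) ≡ Vec.lookup π i

    sources sinks : Pattern → List (Fin n)
    sources π = s ∷ map p (ends true π)
    sinks   π = t ∷ map p (ends false π)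

    ends-length : ∀ b π → length (ends b π) ≤ 4
    ends-length b π = length-filter (λ i → Vec.lookup π i ≟ᵇ b) (allFin 4)

    matches-side : ∀ {π χ} b → Matches π χ → ∀ v → v ∈ map p (ends b π) → χ v ≡ b
    matches-side {π} b (_ , _ , m) v v∈ with ∈-map⁻ p v∈
    ... | i , i∈ , refl = trans (m i) (proj₂ (∈-filter⁻ (λ i → Vec.lookup π i ≟ᵇ b) {xs = allFin 4} i∈))

    matches-sources : ∀ {π χ} → Matches π χ → ∀ v → v ∈ sources π → χ v ≡ true
    matches-sources (m , _ , _) v (here refl) = m
    matches-sources {π} m v (there v∈) = matches-side {π} true m v v∈

    matches-sinks : ∀ {π χ} → Matches π χ → ∀ v → v ∈ sinks π → χ v ≡ false
    matches-sinks (_ , m , _) v (here refl) = m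
    matches-sinks {π} m v (there v∈) = matches-side {π} false m v v∈

    separates⇒matches : ∀ {π χ} → (∀ v → v ∈ sources π → χ v ≡ true) → (∀ v → v ∈ sinks π → χ v ≡ false) → Matches π χ
    separates⇒matches {π} {χ} src snk = src s (here refl) , snk t (here refl) , at
      where
      at : ∀ i → χ (p i) ≡ Vec.lookup π i
      at i with Vec.lookup π i in eq
      ... | true  = src (p i) (there (∈-map⁺ p (∈-filter⁺ (λ i → Vec.lookup π i ≟ᵇ true) (∈-allFin i) eq)))
      ... | false = snk (p i) (there (∈-map⁺ p (∈-filter⁺ (λ i → Vec.lookup π i ≟ᵇ false) (∈-allFin i) eq)))

    -- There are two region numbers because after a failed attempt register 5 still points at the
    -- used region `j`, while memory is zero only from region `k` on; moving register 5 makes them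
    -- equal again.
    record Ready (j k : ℕ) (σ : State) : Set where
      field
        regs-kept : ∀ q → q < 5 → regs σ q ≡ regs σᵢ q
        base      : regs σ 5 ≡ j * Z
        low       : ∀ a → a < Z + Z + Z → mem σ a ≡ mem σᵢ a
        clear     : ∀ a → k * Z ≤ a → mem σ a ≡ 0
        out-none  : out σ ≡ []

    record Reached (B : ℕ) (vs : List (Fin n)) (σ : State) : Set where
      field
        regs-kept : ∀ q → q < 5 → regs σ q ≡ regs σᵢ q
        base      : regs σ 5 ≡ B
        low       : ∀ a → a < Z + Z + Z → mem σ a ≡ mem σᵢ a
        out-none  : out σ ≡ []
        count     : regs σ 8 ≡ length vs
        queue     : ∀ ys v zs → vs ≡ ys ++ v ∷ zs → mem σ (B + Z + length zs) ≡ toℕ v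
        marks     : ∀ v → v ∈ vs → mem σ (B + toℕ v) ≢ 0
        unmarked  : ∀ v → v ∉ vs → mem σ (B + toℕ v) ≡ 0
        unique    : Unique vs
        small     : length vs ≤ 5 + 2 * M

    data Attempted (π : Pattern) (slack : Bool) (j : ℕ) (σ : State) : Set where
      failed    : ∀ k → k ≤ 3 + j → regs σ 11 ≢ 0 → Ready k (3 + k) σ →
                  (∀ χ → Matches π χ → bit slack < outflow r χ) → Attempted π slack j σ
      succeeded : ∀ k vs → k ≤ 3 + j → regs σ 11 ≡ 0 → Reached (k * Z) vs σ →
                  Matches π (member vs) → outflow r (member vs) ≤ bit slack → Attempted π slack j σ

    pointwise-map : ∀ {R : Expr → Fin n → Set} is → (∀ i → R (endᵉ i) (p i)) → Pointwise R (map endᵉ is) (map p is)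
    pointwise-map [] f = []
    pointwise-map (i ∷ is) f = f i ∷ pointwise-map is f

    regs<5 : ∀ (i : Fin 4) → suc (toℕ i) < 5
    regs<5 i = s≤s (toℕ<n i)

    -- Covers both explorations of an attempt: the first with no flow sent, the second with the flow
    -- left by unwinding. Only the mark region is required to be zero, since queue entries are
    -- written before they are read.
    record RoundStart : Set where
      field
        σ         : State
        j o       : ℕ
        u         : Half → ℕ
        π         : Pattern
        3≤j       : 3 ≤ j
        j≤        : j ≤ 990
        o≤        : o ≤ 990
        apart     : suc o ≤ j ⊎ j + 2 ≤ o
        regs-kept : ∀ q → q < 5 → regs σ q ≡ regs σᵢ q
        base      : regs σ 5 ≡ j * Z
        usedBase  : regs σ 6 ≡ o * Z
        low-kept  : ∀ a → a < Z + Z + Z → mem σ a ≡ mem σᵢ a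
        clear     : ∀ a → j * Z ≤ a → a < j * Z + Z → mem σ a ≡ 0
        used      : ∀ h → mem σ (o * Z + ad h) ≡ u h
        u≤1       : ∀ h → u h ≤ 1

    module Round (start : RoundStart) where

      open RoundStart start

      3Z : ∀ z → 3 * z ≡ z + z + z
      3Z = solve-∀

      low-Z : ∀ {a} → a < Z → mem σ a ≡ mem σᵢ a
      low-Z a<Z = low-kept _ (<-≤-trans a<Z (≤-trans (m≤m+n Z Z) (m≤m+n (Z + Z) Z)))

      at-Z : ∀ {a b v} → a ≡ b → b < Z → mem σᵢ b ≡ v → mem σ a ≡ v
      at-Z refl b<Z eq = trans (low-Z b<Z) eq

      3≤Z : ∀ {k} → k < 4 → k < Z
      3≤Z k<4 = <-≤-trans k<4 (≤-trans (≤ᵇ⇒≤ 4 16 tt) 16≤Z)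

      env′ : Env (mem σ)
      env′ = record
        { source = at-Z refl (3≤Z (<ᵇ⇒< 0 4 tt)) source ; sink = at-Z refl (3≤Z (<ᵇ⇒< 1 4 tt)) sink
        ; end = at-Z refl (3≤Z (<ᵇ⇒< 2 4 tt)) end ; size = at-Z refl (3≤Z (<ᵇ⇒< 3 4 tt)) size
        ; tails = λ h → at-Z refl (ad<Z h) (tails h)
        ; heads = λ h → at-Z refl (≤-<-trans (+-monoʳ-≤ (ad h) (≤ᵇ⇒≤ 1 4 tt)) (ad+4<Z h)) (heads h)
        ; caps  = λ h → at-Z refl (≤-<-trans (+-monoʳ-≤ (ad h) (≤ᵇ⇒≤ 2 4 tt)) (ad+4<Z h)) (caps h)
        ; twins = λ h → at-Z refl (≤-<-trans (+-monoʳ-≤ (ad h) (≤ᵇ⇒≤ 3 4 tt)) (ad+4<Z h)) (twins h) }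
        where open Env env

      chain-cong : ∀ {q} ks → Chain (mem σᵢ) q ks → Chain (mem σ) q ks
      chain-cong [] eq = eq
      chain-cong (h ∷ ks) (eq , c) = eq , subst (λ q → Chain (mem σ) q ks) (sym (low-kept _ (+-monoʳ-< (Z + Z) (ad<Z h)))) (chain-cong ks c)

      chains′ : ∀ v → Chain (mem σ) (mem σ (Z + toℕ v)) (adj hs v)
      chains′ v = subst (λ q → Chain (mem σ) q (adj hs v))
        (sym (low-kept _ (<-≤-trans (+-monoʳ-< Z (node<Z v)) (m≤m+n (Z + Z) Z)))) (chain-cong (adj hs v) (chains v))

      multiples : ∀ {a b} c → a + c ≤ b → a * Z + c * Z ≤ b * Z
      multiples {a} c le = ≤-trans (≤-reflexive (sym (*-distribʳ-+ Z a c))) (*-monoˡ-≤ Z le)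

      apart′ : suc o ≤ j ⊎ j + 2 ≤ o → o * Z + Z ≤ j * Z ⊎ j * Z + (Z + Z) ≤ o * Z
      apart′ (inj₁ le) = inj₁ (≤-trans (≤-reflexive (+-comm (o * Z) Z)) (*-monoˡ-≤ Z le))
      apart′ (inj₂ le) = inj₂ (subst (λ z → j * Z + z ≤ o * Z) (cong (Z +_) (+-identityʳ Z)) (multiples {j} {o} 2 le))

      seeds-few : length (sources π) ≤ 5
      seeds-few = s≤s (≤-trans (≤-reflexive (length-map p (ends true π))) (ends-length true π))

      K<Z : length (sources π) + length hs < Z
      K<Z = <-≤-trans (s≤s (+-mono-≤ seeds-few few)) (≤-trans (+-mono-≤ (≤ᵇ⇒≤ 6 16 tt) (*-monoˡ-≤ M (≤ᵇ⇒≤ 2 8 tt))) end≤Z)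

      exploration : Exploration
      exploration = record
        { all = hs ; every = every ; σ₀ = σ ; B = j * Z ; O = o * Z ; u = u ; S = sources π ; env = env′ ; chains = chains′
        ; base = base ; usedBase = usedBase
        ; 3Z≤B = ≤-trans (≤-reflexive (sym (3Z Z))) (*-monoˡ-≤ Z 3≤j)
        ; B≤ = subst (λ z → j * Z + z ≤ 1000 * Z) (3Z Z) (multiples {j} {1000} 3 (≤-trans (+-monoˡ-≤ 3 j≤) (≤ᵇ⇒≤ 993 1000 tt)))
        ; O≤ = ≤-trans (≤-reflexive (+-comm (o * Z) Z)) (*-monoˡ-≤ Z {suc o} {1000} (≤-trans (s≤s o≤) (≤ᵇ⇒≤ 991 1000 tt)))
        ; apart = apart′ apart ; used = used ; u≤1 = u≤1 ; K<Z = K<Z }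

      open Search exploration public

      endDenotes : ∀ i → Denotes (endᵉ i) (p i)
      endDenotes i = ≤ᵇ⇒≤ 1 2 tt , λ F → ev-reg (trans (Frame.regs-kept F _ (<-trans (regs<5 i) (<ᵇ⇒< 5 7 tt)))
        (trans (regs-kept _ (regs<5 i)) (ends-at i)))

      source-sinks : Pointwise Denotes (sourcesᵉ π) (sources π) × Pointwise Denotes (sinksᵉ π) (sinks π)
      source-sinks =
        (≤-refl , λ F → ev-load (ev-lit (fits-lit 0)) (trans (static F (low₀ (3≤Z (<ᵇ⇒< 0 4 tt)))) (Env.source env′)))
          ∷ pointwise-map (ends true π) endDenotes ,
        (≤-refl , λ F → ev-load (ev-lit (fits-lit 1)) (trans (static F (low₀ (3≤Z (<ᵇ⇒< 1 4 tt)))) (Env.sink env′)))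
          ∷ pointwise-map (ends false π) endDenotes
        where
        low₀ : ∀ {a} → a < Z → a < Z + Z + Z
        low₀ a<Z = <-≤-trans a<Z (≤-trans (m≤m+n Z Z) (m≤m+n (Z + Z) Z))

      run-explore : Run w (explorePattern π) σ (exploreCost M) (Probed (sinks π))
      run-explore = run-weaken
        (run-⨟ (run-weaken (run-search (proj₁ source-sinks) (λ v → clear _ (m≤m+n _ _) (+-monoʳ-< (j * Z) (node<Z v)))) cost-bound
          λ f → run-⨟ (run-:= (ev-lit (fits-lit 0))
            (run-weaken (run-probe [] (proj₂ source-sinks) (miss (found-reg (≤ᵇ⇒≤ 7 11 tt) (λ ()) f) refl λ _ ()))
              (+-monoʳ-≤ 1 (*-monoˡ-≤ 30 {length (sinksᵉ π)} {5} (s≤s (≤-trans (≤-reflexive (length-map endᵉ (ends false π))) (ends-length false π))))) id))))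
        (≤-reflexive (exploreCost-def M)) id
        where
        cost-bound : searchCost ≤ 100 + 5 * 40 + (2 * (2 * M) + 5 * suc (2 * M)) * 100
        cost-bound = +-mono-≤ (+-monoʳ-≤ 100 (*-monoˡ-≤ 40 seeds-few))
          (*-monoˡ-≤ 100 (+-mono-≤ (*-monoʳ-≤ 2 few) (*-mono-≤ seeds-few (s≤s few))))

      tree⇒unique : ∀ {μ vs} → Tree μ vs → Unique vs
      tree⇒unique [] = []
      tree⇒unique (grow v∉ _ T) = All.¬Any⇒All¬ _ v∉ ∷ tree⇒unique T

      reached : ∀ {σ′} (f : Found σ′) → out σ ≡ [] → Reached (j * Z) (Found.vs f) σ′
      reached f none = record
        { regs-kept = λ q q<5 → trans (Frame.regs-kept (frame visited) q (<-trans q<5 (<ᵇ⇒< 5 7 tt))) (regs-kept q q<5)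
        ; base = trans (Frame.regs-kept (frame visited) 5 (<ᵇ⇒< 5 7 tt)) base
        ; low = λ a a< → trans (static (frame visited) a<) (low-kept a a<)
        ; out-none = trans (Frame.out-kept (frame visited)) none
        ; count = count visited ; queue = queue visited
        ; marks = λ v → marked (tree visited) ; unmarked = fresh visited ; unique = tree⇒unique (tree visited)
        ; small = ≤-trans small (+-mono-≤ seeds-few few) }
        where
        open Found f
        open Visited

      missed⇒matches : ∀ {σ′} (f : Found σ′) → (∀ v → v ∈ sinks π → v ∉ Found.vs f) → Matches π (member (Found.vs f))
      missed⇒matches f none = separates⇒matches {π} (λ v v∈ → dec-true (v ∈? Found.vs f) (Found.seeds f v v∈))
        (λ v v∈ → dec-false (v ∈? Found.vs f) (none v v∈))

    ready-env : ∀ {j k σ} → Ready j k σ → Ev w σ sizeᵉ Z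
    ready-env R = ev-load (ev-lit (fits-lit 3))
      (trans (Ready.low R 3 (<-≤-trans (<ᵇ⇒< 3 16 tt) (≤-trans 16≤Z (m≤n+m Z (Z + Z))))) (Env.size env))

    fits-multiple : ∀ {k} → k ≤ 1000 → k * Z < 2 ^ w
    fits-multiple k≤ = fits (*-monoˡ-≤ Z k≤)

    ev-advance : ∀ {σ e j} → j ≤ 990 → Ev w σ sizeᵉ Z → Ev w σ e (j * Z) → Ev w σ (advanceᵉ e) ((2 + j) * Z)
    ev-advance {j = j} j≤ z e = subst (Ev w _ _) (arith j Z)
      (ev-add (ev-add e z (subst (_< 2 ^ w) (+-comm Z (j * Z)) (fits-multiple {suc j} (≤-trans (s≤s j≤) (≤ᵇ⇒≤ 991 1000 tt))))) z
        (subst (_< 2 ^ w) (sym (arith j Z)) (fits-multiple {2 + j} (≤-trans (+-monoʳ-≤ 2 j≤) (≤ᵇ⇒≤ 992 1000 tt)))))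
      where
      arith : ∀ j z → j * z + z + z ≡ (2 + j) * z
      arith = solve-∀

    -- If the first exploration reaches a sink, every matching cut has positive outflow. After one
    -- unit is sent, its outflow is one less, so the second exploration decides whether it can be
    -- exactly one.
    run-attempt : ∀ {j σ} π slack → 3 ≤ j → j ≤ 980 → Ready j j σ →
      Run w (attempt π slack) σ (attemptCost M) (Attempted π slack j)
    run-attempt {j} {σ} π slack 3≤j j≤980 R = run-weaken
      (run-⨟ (run-:= (ev-advance j≤ (ready-env R) (ev-reg (Ready.base R))) (run-⨟ (run-weaken R₁.run-explore ≤-refl (again slack)))))
      ≤-refl id
      where
      j≤ : j ≤ 990
      j≤ = ≤-trans j≤980 (≤ᵇ⇒≤ 980 990 tt)
      start₁ : RoundStart
      start₁ = record
        { σ = setReg σ 6 ((2 + j) * Z) ; j = j ; o = 2 + j ; u = λ _ → 0 ; π = π ; 3≤j = 3≤j ; j≤ = j≤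
        ; o≤ = ≤-trans (+-monoʳ-≤ 2 j≤980) (≤ᵇ⇒≤ 982 990 tt) ; apart = inj₂ (≤-reflexive (+-comm j 2))
        ; regs-kept = λ q q<5 → trans (upd-other (regs σ) (>⇒≢ (<-trans q<5 (<ᵇ⇒< 5 6 tt)))) (Ready.regs-kept R q q<5)
        ; base = Ready.base R ; usedBase = refl ; low-kept = Ready.low R ; clear = λ a ≤a _ → Ready.clear R a ≤a
        ; used = λ h → Ready.clear R _ (≤-trans (*-monoˡ-≤ Z (m≤n+m j 2)) (m≤m+n _ _)) ; u≤1 = λ _ → z≤n }
      module R₁ = Round start₁
      residual-idle : ∀ χ → outflow (residual (λ _ → 0)) χ ≡ outflow r χ
      residual-idle = outflow-cong x y (λ h → +-identityʳ (r h))
      again : ∀ slack {σ₁} → R₁.Probed (sinks π) σ₁ → Run w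
        (if slack then ifnz (reg 11) (unwind ⨟ 5 := op add (advanceᵉ (reg 5)) sizeᵉ ⨟ explorePattern π) skip else skip)
        σ₁ (retryCost M) (Attempted π slack j)
      again slack {σ₁} (R₁.miss f r11 none) = done slack
        where
        goal : Attempted π slack j σ₁
        goal = succeeded j (R₁.Found.vs f) (m≤n+m j 3) r11 (R₁.reached f (Ready.out-none R)) (R₁.missed⇒matches f none)
          (≤-trans (≤-reflexive (trans (sym (residual-idle (member (R₁.Found.vs f)))) (R₁.found-closed f))) z≤n)
        done : ∀ b → Run w (if b then ifnz (reg 11) (unwind ⨟ 5 := op add (advanceᵉ (reg 5)) sizeᵉ ⨟ explorePattern π) skip else skip)
          σ₁ (retryCost M) (Attempted π slack j)
        done false = run-weaken (run-skip goal) (s≤s z≤n) id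
        done true  = run-weaken (run-else (ev-reg r11) refl (run-skip goal)) (s≤s (s≤s (s≤s z≤n))) id
      again false {σ₁} (R₁.hit f v r11 r10 v∈T v∈) = run-weaken (run-skip (failed j (m≤n+m j 3) r11 (record
          { regs-kept = regs-kept ; base = base ; low = low ; out-none = out-none
          ; clear = λ a ≤a → trans (R₁.Frame.mem-kept (R₁.Visited.frame (R₁.Found.visited f)) a (inj₂ (≤-trans (≤-reflexive (two j Z)) (≤-trans (*-monoˡ-≤ Z (n≤1+n (2 + j))) ≤a))))
              (Ready.clear R a (≤-trans (*-monoˡ-≤ Z (m≤n+m j 3)) ≤a)) })
          (λ χ m → subst (0 <_) (residual-idle χ)
            (R₁.separating⇒outflow>0 f {χ} (matches-sources {π} m) v∈ (matches-sinks {π} m v v∈T))))) (s≤s z≤n) id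
        where
        two : ∀ j z → j * z + (z + z) ≡ (2 + j) * z
        two = solve-∀
        open Reached (R₁.reached f (Ready.out-none R))
      again true {σ₁} (R₁.hit f v r11 r10 v∈T v∈) = run-weaken
        (run-then (ev-reg r11′) r11 (run-⨟ (run-weaken (U.run-unwind f r10 v∈) cost-unwind second)))
        ≤-refl id
        where
        r11′ : regs σ₁ 11 ≡ regs σ₁ 11
        r11′ = refl
        two : ∀ j z → j * z + (z + z) ≡ (2 + j) * z
        two = solve-∀
        F₁ = R₁.Visited.frame (R₁.Found.visited f)
        module U = R₁.Unwinding (λ _ → refl) (≤-reflexive (two j Z)) F₁ v
        cost-unwind : 10 + (length (sources π) + length hs) * 30 ≤ 160 + M * 60
        cost-unwind = ≤-trans (+-monoʳ-≤ 10 (*-monoˡ-≤ 30 (+-mono-≤ R₁.seeds-few few))) (≤-reflexive (arith₃ M))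
          where
          arith₃ : ∀ m → 10 + (5 + 2 * m) * 30 ≡ 160 + m * 60
          arith₃ = solve-∀
        second : ∀ {σ₂} → R₁.Unwound v σ₁ σ₂ → Run w (5 := op add (advanceᵉ (reg 5)) sizeᵉ ⨟ explorePattern π) σ₂
          (11 + exploreCost M) (Attempted π true j)
        second {σ₂} Un = run-weaken
          (run-⨟ (run-:= (subst (Ev w _ _) (+-comm _ Z) (ev-add (ev-advance j≤ size₂ (ev-reg (trans (regs-kept 5 (<ᵇ⇒< 5 7 tt)) (Ready.base R)))) size₂
              (subst (_< 2 ^ w) (+-comm Z _) (fits-multiple {3 + j} (≤-trans (+-monoʳ-≤ 3 j≤980) (≤ᵇ⇒≤ 983 1000 tt))))))
            (run-weaken R₂.run-explore ≤-refl final)))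
          ≤-refl id
          where
          open R₁.Unwound Un
          low₁ : ∀ a → a < Z + Z + Z → mem σ₂ a ≡ mem σᵢ a
          low₁ a a< = trans (mem-kept a (inj₁ (<-≤-trans a< (≤-trans (≤-reflexive (three Z)) (*-monoˡ-≤ Z (≤-trans 3≤j (m≤n+m j 2)))))))
            (trans (R₁.static F₁ a<) (Ready.low R a a<))
            where
            three : ∀ z → z + z + z ≡ 3 * z
            three = solve-∀
          clear₁ : ∀ a → (3 + j) * Z ≤ a → mem σ₂ a ≡ 0
          clear₁ a ≤a = trans (mem-kept a (inj₂ (≤-trans (≤-reflexive (+-comm _ Z)) ≤a)))
            (trans (R₁.Frame.mem-kept F₁ a (inj₂ (≤-trans (≤-reflexive (two j Z)) (≤-trans (*-monoˡ-≤ Z (n≤1+n (2 + j))) ≤a))))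
              (Ready.clear R a (≤-trans (*-monoˡ-≤ Z (m≤n+m j 3)) ≤a)))
          size₂ : Ev w σ₂ sizeᵉ Z
          size₂ = ev-load (ev-lit (fits-lit 3)) (trans (low₁ 3 (<-≤-trans (<ᵇ⇒< 3 16 tt) (≤-trans 16≤Z (m≤n+m Z (Z + Z))))) (Env.size env))
          start₂ : RoundStart
          -- The marks move to region 3 + j, but the flow is read from region 2 + j, where unwinding
          -- wrote it.
          start₂ = record
            { σ = setReg σ₂ 5 ((3 + j) * Z) ; j = 3 + j ; o = 2 + j ; u = u′ ; π = π ; 3≤j = ≤-trans 3≤j (m≤n+m j 3)
            ; j≤ = ≤-trans (+-monoʳ-≤ 3 j≤980) (≤ᵇ⇒≤ 983 990 tt) ; o≤ = ≤-trans (+-monoʳ-≤ 2 j≤980) (≤ᵇ⇒≤ 982 990 tt)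
            ; apart = inj₁ ≤-refl
            ; regs-kept = λ q q<5 → trans (upd-other (regs σ₂) (>⇒≢ q<5)) (trans (regs-kept q (<-trans q<5 (<ᵇ⇒< 5 7 tt)))
                (trans (upd-other (regs σ) (>⇒≢ (<-trans q<5 (<ᵇ⇒< 5 6 tt)))) (Ready.regs-kept R q q<5)))
            ; base = refl ; usedBase = regs-kept 6 (<ᵇ⇒< 6 7 tt) ; low-kept = low₁ ; clear = λ a ≤a _ → clear₁ a ≤a
            ; used = used′ ; u≤1 = u′≤1 }
          module R₂ = Round start₂
          final : ∀ {σ₃} → R₂.Probed (sinks π) σ₃ → Attempted π true j σ₃
          final (R₂.miss g r11₃ none) = succeeded (3 + j) (R₂.Found.vs g) ≤-refl r11₃ (R₂.reached g (trans out-kept (Ready.out-none R))) m (≤-reflexive value)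
            where
            χ = member (R₂.Found.vs g)
            m = R₂.missed⇒matches g none
            value : outflow r χ ≡ 1
            -- Nothing leaves the set after the unit has been sent from a seed inside it to a sink
            -- outside it, so exactly one unit could leave before.
            value = trans (sym (+-identityʳ _)) (trans (cong (λ b → outflow r χ + bit b) (sym (matches-sinks {π} {χ} m v v∈T)))
              (trans (sym (conserved χ)) (cong₂ (λ a b → a + bit b) (R₂.found-closed g) (matches-sources {π} {χ} m root root-seed))))
          final {σ₃} (R₂.hit g v′ r11₃ _ v′∈T v′∈) = failed (3 + j) ≤-refl r11₃ (record
              { regs-kept = Reached.regs-kept Re ; base = Reached.base Re ; low = Reached.low Re ; out-none = Reached.out-none Re
              ; clear = λ a ≤a → trans (R₂.Frame.mem-kept (R₂.Visited.frame (R₂.Found.visited g)) a (inj₂ (≤-trans (≤-reflexive (two (3 + j) Z)) (≤-trans (*-monoˡ-≤ Z (n≤1+n (5 + j))) ≤a))))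
                  (clear₁ a (≤-trans (*-monoˡ-≤ Z (m≤n+m (3 + j) 3)) ≤a)) })
            beyond
            where
            Re = R₂.reached g (trans out-kept (Ready.out-none R))
            beyond : ∀ χ → Matches π χ → 1 < outflow r χ
            beyond χ m = subst (1 <_) value (s≤s (R₂.separating⇒outflow>0 g {χ} (matches-sources {π} m) v′∈ (matches-sinks {π} m v′ v′∈T)))
              where
              value : suc (outflow (residual u′) χ) ≡ outflow r χ
              value = trans (+-comm 1 _) (trans (cong (λ b → outflow (residual u′) χ + bit b) (sym (matches-sources {π} {χ} m root root-seed)))
                (trans (conserved χ) (trans (cong (λ b → outflow r χ + bit b) (matches-sinks {π} {χ} m v v∈T)) (+-identityʳ _))))

    -- Writing the answer

    keptᵇ : Edge n → Bool
    keptᵇ e = if ins then true else not (e ∥ᵇ e₁) ∧ not (e ∥ᵇ e₂)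

    extraEdges : List (Edge n)
    extraEdges = if ins then e₁ ∷ e₂ ∷ [] else []

    reported : (Fin n → Bool) → List (Edge n)
    reported χ = filterᵇ (crosses χ) extraEdges ++ filterᵇ (λ e → crosses χ e ∧ keptᵇ e) (tabulate ed)

    Fails : Try → Set
    Fails (π , b) = ∀ χ → Matches π χ → bit b < outflow r χ

    record Answer (fs : List Try) (tr : Try) (σ : State) : Set where
      field
        vs      : List (Fin n)
        fails   : All Fails fs
        unique  : Unique vs
        matches : Matches (proj₁ tr) (member vs)
        within₁ : outflow r (member vs) ≤ bit (proj₂ tr)
        reports : out σ ≡ length vs ∷ map toℕ vs ++ length (reported (member vs)) ∷ concatMap endpoints (reported (member vs))

    Outcome : List Try → State → Set
    Outcome ts σ = All Fails ts ⊎ (∃[ fs ] ∃[ tr ] ∃[ ts′ ] ts ≡ fs ++ tr ∷ ts′ × Answer fs tr σ)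

    module Reporter {k vs σc} (k≤ : k ≤ 990) (Re : Reached (k * Z) vs σc) where

      open Reached Re
      open Env env

      χ : Fin n → Bool
      χ = member vs

      record Same (σ : State) : Set where
        field
          regs-same : ∀ q → q < 7 → regs σ q ≡ regs σc q
          mem-same  : ∀ a → mem σ a ≡ mem σc a

      open Same

      same-reg : ∀ {σ q v} → 7 ≤ q → Same σ → Same (setReg σ q v)
      same-reg {σ} 7≤q S = record { regs-same = λ p p<7 → trans (upd-other (regs σ) (>⇒≢ (<-≤-trans p<7 7≤q))) (regs-same S p p<7)
                                  ; mem-same = mem-same S }

      same-out : ∀ {σ o} → Same σ → Same (record σ { out = o })
      same-out S = record { regs-same = regs-same S ; mem-same = mem-same S }

      low-at : ∀ {σ a} → Same σ → a < Z → mem σ a ≡ mem σᵢ a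
      low-at S a<Z = trans (mem-same S _) (low _ (<-≤-trans a<Z (≤-trans (m≤m+n Z Z) (m≤m+n (Z + Z) Z))))

      ev-base : ∀ {σ} → Same σ → Ev w σ (reg 5) (k * Z)
      ev-base S = ev-reg (trans (regs-same S 5 (<ᵇ⇒< 5 7 tt)) base)

      ev-sizeᵣ : ∀ {σ} → Same σ → Ev w σ sizeᵉ Z
      ev-sizeᵣ S = ev-load (ev-lit (fits-lit 3)) (trans (low-at S (<-≤-trans (<ᵇ⇒< 3 16 tt) 16≤Z)) size)

      room : ∀ a {b} → a ≤ 10 → b ≤ a * Z → k * Z + b < 2 ^ w
      room a a≤ b≤ = fits (≤-trans (+-monoʳ-≤ (k * Z) b≤) (≤-trans (≤-reflexive (sym (*-distribʳ-+ Z k a))) (*-monoˡ-≤ Z (+-mono-≤ k≤ a≤))))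

      isZero-mark : ∀ {σ e v} → Same σ → Ev w σ e (toℕ v) → Ev w σ (isZeroᵉ (load (markᵉ e))) (bit (not (χ v)))
      isZero-mark {v = v} S ee = subst (Ev w _ _) value (ev-isZero (ev-load
          (ev-add (ev-base S) ee (room 1 (≤ᵇ⇒≤ 1 10 tt) (≤-trans (<⇒≤ (node<Z v)) (≤-reflexive (sym (+-identityʳ Z)))))) (mem-same S _)))
        where
        value : bit (mem σc (k * Z + toℕ v) ≡ᵇ 0) ≡ bit (not (χ v))
        value with v ∈? vs
        ... | yes v∈ = cong bit (≡ᵇ-false (marks v v∈))
        ... | no v∉  = cong bit (≡ᵇ-true (unmarked v v∉))

      ev-cross : ∀ {σ e f v v′} → Same σ → Ev w σ e (toℕ v) → Ev w σ f (toℕ v′) → Ev w σ (crossᵉ e f) (bit (χ v xor χ v′))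
      ev-cross {v = v} {v′} S ee ef = subst (Ev w _ _) (value (χ v) (χ v′)) (ev-isZero (ev-equal (isZero-mark S ee) (isZero-mark S ef)))
        where
        value : ∀ a b → bit (bit (bit (not a) ≡ᵇ bit (not b)) ≡ᵇ 0) ≡ bit (a xor b)
        value true  true  = refl
        value true  false = refl
        value false true  = refl
        value false false = refl

      ev-end₁ : ∀ {σ} (i : Fin M) → Same σ → regs σ 7 ≡ ad (i , false) → Ev w σ end₁ᵉ (toℕ (x i))
      ev-end₁ i S r7 = ev-load (ev-reg r7) (trans (low-at S (ad<Z (i , false))) (tails (i , false)))

      ev-end₂ : ∀ {σ} (i : Fin M) → Same σ → regs σ 7 ≡ ad (i , false) → Ev w σ end₂ᵉ (toℕ (y i))
      ev-end₂ i S r7 = ev-load (ev-add (ev-reg r7) (ev-lit (fits-lit 1)) (fits-Z (<⇒≤ lt))) (trans (low-at S lt) (heads (i , false)))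
        where
        lt : ad (i , false) + 1 < Z
        lt = ≤-<-trans (+-monoʳ-≤ (ad (i , false)) (≤ᵇ⇒≤ 1 4 tt)) (ad+4<Z (i , false))

      ev-end : ∀ i {σ} → Same σ → Ev w σ (endᵉ i) (toℕ (p i))
      ev-end i S = ev-reg (trans (Same.regs-same S _ (<-trans (regs<5 i) (<ᵇ⇒< 5 7 tt)))
        (trans (Reached.regs-kept Re _ (regs<5 i)) (ends-at i)))

      fits-small : ∀ {a} → a ≤ 16 → a < 2 ^ w
      fits-small a≤ = fits-Z (≤-trans a≤ 16≤Z)

      ev-same-node : ∀ {σ a b} {u v : Fin n} → Ev w σ a (toℕ u) → Ev w σ b (toℕ v) → Ev w σ (op equal a b) (bit (does (u ≟ᶠ v)))
      ev-same-node {u = u} {v} ea eb = subst (Ev w _ _) (cong bit eq) (ev-equal ea eb)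
        where
        eq : (toℕ u ≡ᵇ toℕ v) ≡ does (u ≟ᶠ v)
        eq with u ≟ᶠ v
        ... | yes refl = ≡ᵇ-true {toℕ u} refl
        ... | no ne    = ≡ᵇ-false (ne ∘ toℕ-injective)

      ev-differ : ∀ {σ e f} (i : Fin M) ε → Same σ → regs σ 7 ≡ ad (i , false) → Ev w σ e (toℕ (end₁ ε)) → Ev w σ f (toℕ (end₂ ε)) →
        ∃[ a ] a ≤ 2 × (a ≡ᵇ 0) ≡ not (ed i ∥ᵇ ε) × Ev w σ (differᵉ e f) a
      ev-differ i ε S r7 e⇓ f⇓ = _ , +-mono-≤ (bit*bit≤1 b₁ b₂) (bit*bit≤1 b₃ b₄) , value b₁ b₂ b₃ b₄
        , ev-add (ev-mul (ev-same-node x⇓ e⇓) (ev-same-node y⇓ f⇓) (fits-small (≤-trans (bit*bit≤1 b₁ b₂) (≤ᵇ⇒≤ 1 16 tt))))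
                 (ev-mul (ev-same-node x⇓ f⇓) (ev-same-node y⇓ e⇓) (fits-small (≤-trans (bit*bit≤1 b₃ b₄) (≤ᵇ⇒≤ 1 16 tt))))
                 (fits-small (≤-trans (+-mono-≤ (bit*bit≤1 b₁ b₂) (bit*bit≤1 b₃ b₄)) (≤ᵇ⇒≤ 2 16 tt)))
        where
        x⇓ = ev-end₁ i S r7
        y⇓ = ev-end₂ i S r7
        b₁ = does (x i ≟ᶠ end₁ ε)
        b₂ = does (y i ≟ᶠ end₂ ε)
        b₃ = does (x i ≟ᶠ end₂ ε)
        b₄ = does (y i ≟ᶠ end₁ ε)
        bit*bit≤1 : ∀ a b → bit a * bit b ≤ 1
        bit*bit≤1 a b = *-mono-≤ (bit≤1 a) (bit≤1 b)
        value : ∀ a b c d → (bit a * bit b + bit c * bit d ≡ᵇ 0) ≡ not ((a ∧ b) ∨ (c ∧ d))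
        value true  true  c     d     = refl
        value true  false true  true  = refl
        value true  false true  false = refl
        value true  false false d     = refl
        value false b     true  true  = refl
        value false b     true  false = refl
        value false b     false d     = refl

      ev-keep : ∀ (i : Fin M) {σ} → Same σ → regs σ 7 ≡ ad (i , false) → Ev w σ (keepᵉ ins) (bit (keptᵇ (ed i)))
      ev-keep i {σ} S r7 = for ins
        where
        zero-sum : ∀ a b → (a + b ≡ᵇ 0) ≡ (a ≡ᵇ 0) ∧ (b ≡ᵇ 0)
        zero-sum zero    b = refl
        zero-sum (suc a) b = refl
        for : ∀ b → Ev w σ (keepᵉ b) (bit (if b then true else not (ed i ∥ᵇ e₁) ∧ not (ed i ∥ᵇ e₂)))
        for true  = ev-lit (fits-lit 1)
        for false =
          let a , a≤ , a≡ , a⇓ = ev-differ i e₁ S r7 (ev-end (# 0) S) (ev-end (# 1) S)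
              b , b≤ , b≡ , b⇓ = ev-differ i e₂ S r7 (ev-end (# 2) S) (ev-end (# 3) S)
          in subst (Ev w σ (keepᵉ false)) (cong bit (trans (zero-sum a b) (cong₂ _∧_ a≡ b≡)))
               (ev-isZero (ev-add a⇓ b⇓ (fits-small (≤-trans (+-mono-≤ a≤ b≤) (≤ᵇ⇒≤ 4 16 tt)))))

      ExtraDenotes : Expr × Expr → Edge n → Set
      ExtraDenotes (e , f) ε = cost e ≡ 1 × cost f ≡ 1 × (∀ {σ} → Same σ → Ev w σ e (toℕ (end₁ ε)) × Ev w σ f (toℕ (end₂ ε)))

      extras-denote : Pointwise ExtraDenotes (extrasᵉ ins) extraEdges
      extras-denote = for ins
        where
        for : ∀ b → Pointwise ExtraDenotes (extrasᵉ b) (if b then e₁ ∷ e₂ ∷ [] else [])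
        for true  = (refl , refl , λ S → ev-end (# 0) S , ev-end (# 1) S) ∷ (refl , refl , λ S → ev-end (# 2) S , ev-end (# 3) S) ∷ []
        for false = []

      extras≤2 : length extraEdges ≤ 2
      extras≤2 = for ins
        where
        for : ∀ b → length (if b then e₁ ∷ e₂ ∷ [] else []) ≤ 2
        for true  = ≤-refl
        for false = z≤n

      edges-list : List (Edge n)
      edges-list = tabulate ed

      select : Edge n → Bool
      select e = crosses χ e ∧ keptᵇ e

      selected : List (Edge n)
      selected = filterᵇ (crosses χ) extraEdges ++ filterᵇ select edges-list

      -- Counting the queue index down emits the newest vertex first, which is the order of `vs`.
      run-vertices : ∀ {σ} → Same σ → regs σ 8 ≡ length vs → Run w listVertices σ (4 + (5 + 2 * M) * 14)
        (λ σ′ → Same σ′ × out σ′ ≡ out σ ++ map toℕ vs)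
      run-vertices {σ₀} S r8 = run-weaken (run-⨟ (run-:= (ev-reg r8) (run-while {I = I} step (length vs)
          (same-reg ≤-refl S , [] , vs , refl , refl , refl , sym (++-identityʳ (out σ₀))))))
        (+-monoʳ-≤ 4 (*-mono-≤ small (≤ᵇ⇒≤ 14 14 tt))) id
        where
        I : ℕ → State → Set
        I φ σ = Same σ × ∃[ ys ] ∃[ zs ] vs ≡ ys ++ zs × length zs ≡ φ × regs σ 7 ≡ φ × out σ ≡ out σ₀ ++ map toℕ ys
        step : ∀ φ {σ} → I φ σ → ∃[ v ] Ev w σ (reg 7) v × (v ≡ 0 → Same σ × out σ ≡ out σ₀ ++ map toℕ vs) ×
          (v ≢ 0 → Run w (7 := op sub (reg 7) (lit 1) ⨟ output (load (queueᵉ (reg 7)))) σ 12 (λ σ′ → ∃[ φ′ ] φ′ < φ × I φ′ σ′))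
        step φ (S , ys , [] , eq , refl , r7 , o) = 0 , ev-reg r7
          , (λ _ → S , trans o (cong (λ l → out σ₀ ++ map toℕ l) (sym (trans eq (++-identityʳ ys))))) , λ nz → ⊥-elim (nz refl)
        step φ {σ} (S , ys , v ∷ zs , eq , refl , r7 , o) = suc (length zs) , ev-reg r7 , (λ ())
          , λ _ → within (run-⨟ (run-:= (ev-sub (ev-reg r7) (ev-lit (fits-lit 1)) (fits-Z (<⇒≤ zs<Z)))
              (run-output (ev-load (ev-add (ev-add (ev-base S′) (ev-sizeᵣ S′) (room 1 (≤ᵇ⇒≤ 1 10 tt) (≤-reflexive (sym (+-identityʳ Z)))))
                  (ev-reg refl) (subst (_< 2 ^ w) (sym (+-assoc (k * Z) Z _)) (room 2 (≤ᵇ⇒≤ 2 10 tt)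
                    (+-monoʳ-≤ Z (≤-trans (<⇒≤ (≤-<-trans (n≤1+n _) zs<Z)) (≤-reflexive (sym (+-identityʳ Z))))))))
                  (trans (mem-same S _) (queue ys v zs eq)))
                (length zs , ≤-refl , same-out S′ , ys ∷ʳ v , zs , trans eq (sym (++-assoc ys [ v ] zs)) , refl , refl , out′))))
          where
          S′ = same-reg {v = suc (length zs) ∸ 1} ≤-refl S
          vs≥ : suc (length zs) ≤ length vs
          vs≥ = subst (suc (length zs) ≤_) (sym (trans (cong length eq) (length-++ ys))) (m≤n+m _ (length ys))
          zs<Z : suc (length zs) < Z
          zs<Z = ≤-<-trans (≤-trans vs≥ small) (<-≤-trans (s≤s (+-monoʳ-≤ 5 (*-monoˡ-≤ M (≤ᵇ⇒≤ 2 8 tt)))) (≤-trans (+-monoˡ-≤ (8 * M) (≤ᵇ⇒≤ 6 16 tt)) end≤Z))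
          out′ : out σ ++ [ toℕ v ] ≡ out σ₀ ++ map toℕ (ys ∷ʳ v)
          out′ = trans (cong (_++ [ toℕ v ]) o) (trans (++-assoc (out σ₀) (map toℕ ys) [ toℕ v ]) (cong (out σ₀ ++_) (sym (map-++ toℕ ys [ v ]))))

      filterᵇ-≤ : ∀ {A : Set} (p : A → Bool) as → length (filterᵇ p as) ≤ length as
      filterᵇ-≤ p [] = z≤n
      filterᵇ-≤ p (a ∷ as) with p a
      ... | true  = s≤s (filterᵇ-≤ p as)
      ... | false = m≤n⇒m≤1+n (filterᵇ-≤ p as)

      run-tallyExtra : ∀ {es ds c σ} → Pointwise ExtraDenotes es ds →
        Same σ → regs σ 13 ≡ c → c + length ds ≤ 2 → Run w (tallyExtra es) σ (1 + length ds * 20)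
        (λ σ′ → Same σ′ × regs σ′ 13 ≡ c + length (filterᵇ (crosses χ) ds) × out σ′ ≡ out σ)
      run-tallyExtra [] S r13 c≤ = run-skip (S , trans r13 (sym (+-identityʳ _)) , refl)
      run-tallyExtra {(e , f) ∷ es} {ε ∷ ds} {c} {σ} ((ce , cf , ev-ef) ∷ ps) S r13 c≤ =
        run-weaken (run-⨟ (run-:= (ev-add (ev-reg r13) (ev-cross S (proj₁ (ev-ef S)) (proj₂ (ev-ef S)))
            (fits-Z (≤-trans (≤-trans (+-monoʳ-≤ c (≤-trans (bit≤1 _) (s≤s z≤n))) c≤) (≤-trans (≤ᵇ⇒≤ 2 16 tt) 16≤Z))))
          (run-weaken (run-tallyExtra ps (same-reg (≤ᵇ⇒≤ 7 13 tt) S) refl (≤-trans (≤-reflexive (+-assoc c (bit (crosses χ ε)) (length ds))) (≤-trans (+-monoʳ-≤ c (+-monoˡ-≤ (length ds) (bit≤1 _))) c≤)))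
            ≤-refl λ (S′ , r13′ , o) → S′ , trans r13′ (trans (+-assoc c _ _) (cong (c +_) count′)) , o)))
        (≤-trans (≤-reflexive (cong₂ (λ a b → 1 + (2 + (1 + (1 + (1 + (3 + a) + 1) + (1 + (3 + b) + 1)) + 1)) + (1 + length ds * 20)) ce cf))
          (≤-trans (n≤1+n _) (≤-trans (n≤1+n _) (≤-reflexive (arith (length ds)))))) id
        where
        arith : ∀ z → 2 + (1 + (2 + (1 + (1 + (1 + (3 + 1) + 1) + (1 + (3 + 1) + 1)) + 1)) + (1 + z * 20)) ≡ 1 + (20 + z * 20)
        arith = solve-∀
        count′ : bit (crosses χ ε) + length (filterᵇ (crosses χ) ds) ≡ length (filterᵇ (crosses χ) (ε ∷ ds))
        count′ with crosses χ ε
        ... | true  = refl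
        ... | false = refl

      run-emitExtra : ∀ {es ds σ} → Pointwise ExtraDenotes es ds →
        Same σ → Run w (emitExtra es) σ (1 + length ds * 25)
        (λ σ′ → Same σ′ × out σ′ ≡ out σ ++ concatMap endpoints (filterᵇ (crosses χ) ds))
      run-emitExtra [] S = run-skip (S , sym (++-identityʳ _))
      run-emitExtra {(e , f) ∷ es} {ε ∷ ds} {σ} ((ce , cf , ev-ef) ∷ ps) S =
        run-weaken (run-⨟ (first (crosses χ ε) refl)) (≤-reflexive (+-suc 25 (length ds * 25))) id
        where
        rest : ∀ b {σ₁} → crosses χ ε ≡ b → Same σ₁ → out σ₁ ≡ out σ ++ (if b then endpoints ε else []) →
          Run w (emitExtra es) σ₁ (1 + length ds * 25)
            (λ σ′ → Same σ′ × out σ′ ≡ out σ ++ concatMap endpoints (filterᵇ (crosses χ) (ε ∷ ds)))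
        rest b eq S₁ o = run-weaken (run-emitExtra ps S₁) ≤-refl
          λ (S₂ , o₂) → S₂ , trans o₂ (trans (cong (_++ _) o) (trans (++-assoc (out σ) _ _) (cong (out σ ++_) (here≡ b eq))))
          where
          here≡ : ∀ b → crosses χ ε ≡ b → (if b then endpoints ε else []) ++ concatMap endpoints (filterᵇ (crosses χ) ds)
            ≡ concatMap endpoints (filterᵇ (crosses χ) (ε ∷ ds))
          here≡ true  eq rewrite eq = refl
          here≡ false eq rewrite eq = refl
        guard = ev-cross S (proj₁ (ev-ef S)) (proj₂ (ev-ef S))
        cost≡ : cost (crossᵉ e f) ≡ 15
        cost≡ = cong₂ (λ a b → 1 + (1 + (1 + (3 + a) + 1) + (1 + (3 + b) + 1)) + 1) ce cf
        first : ∀ b → crosses χ ε ≡ b → Run w (ifnz (crossᵉ e f) (output e ⨟ output f) skip) σ 25 (λ σ₁ →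
          Run w (emitExtra es) σ₁ (1 + length ds * 25)
            (λ σ′ → Same σ′ × out σ′ ≡ out σ ++ concatMap endpoints (filterᵇ (crosses χ) (ε ∷ ds))))
        first true eq = run-weaken (run-then (subst (λ z → Ev w σ (crossᵉ e f) (bit z)) eq guard) (λ ())
          (run-⨟ (run-output (proj₁ (ev-ef S)) (run-output (proj₂ (ev-ef (same-out S)))
            (rest true eq (same-out (same-out {o = out σ ++ [ toℕ (end₁ ε) ]} S)) (++-assoc (out σ) _ _))))))
          (≤-trans (≤-reflexive (cong₂ (λ c d → 1 + c + d) cost≡ (cong₂ (λ a b → 1 + a + (1 + b)) ce cf))) (≤ᵇ⇒≤ 20 25 tt)) id
        first false eq = run-weaken (run-else (subst (λ z → Ev w σ (crossᵉ e f) (bit z)) eq guard) refl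
          (run-skip (rest false eq S (sym (++-identityʳ (out σ))))))
          (≤-trans (≤-reflexive (cong (λ c → 1 + c + 1) cost≡)) (≤ᵇ⇒≤ 17 25 tt)) id

      prefix : ℕ → List (Edge n)
      prefix i = filterᵇ select (take i edges-list)

      prefix-suc : ∀ (i : Fin M) → prefix (suc (toℕ i)) ≡ prefix (toℕ i) ++ (if select (ed i) then [ ed i ] else [])
      prefix-suc i = trans (cong (filterᵇ select) (take-suc-tabulate ed i)) (filterᵇ-∷ʳ select (take (toℕ i) edges-list) (ed i))

      prefix-all : prefix M ≡ filterᵇ select edges-list
      prefix-all = cong (filterᵇ select) (trans (cong (λ m → take m edges-list) (sym (length-tabulate ed))) (take-all (length edges-list) edges-list ≤-refl))

      prefix-length : ∀ i → length (prefix i) ≤ M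
      prefix-length i = ≤-trans (filterᵇ-≤ select (take i edges-list)) (≤-trans (≤-reflexive (length-take i edges-list))
        (≤-trans (m⊓n≤n i _) (≤-reflexive (length-tabulate ed))))

      ev-select : ∀ {σ} (i : Fin M) → Same σ → regs σ 7 ≡ ad (i , false) → regs σ 12 ≡ bit (keptᵇ (ed i)) →
        Ev w σ (op mul (crossᵉ end₁ᵉ end₂ᵉ) (reg 12)) (bit (select (ed i)))
      ev-select i S r7 r12 = subst (Ev w _ _) (value (crosses χ (ed i)) (keptᵇ (ed i)))
        (ev-mul (ev-cross S (ev-end₁ i S r7) (ev-end₂ i S r7)) (ev-reg r12)
          (fits-Z (≤-trans (*-mono-≤ (bit≤1 (crosses χ (ed i))) (bit≤1 (keptᵇ (ed i)))) (≤-trans (≤ᵇ⇒≤ 1 16 tt) 16≤Z))))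
        where
        value : ∀ a b → bit a * bit b ≡ bit (a ∧ b)
        value true  true  = refl
        value true  false = refl
        value false true  = refl
        value false false = refl

      end-same : ∀ {σ} → Same σ → mem σ 2 ≡ 4 + 8 * M
      end-same S = trans (low-at S (<-≤-trans (<ᵇ⇒< 2 16 tt) 16≤Z)) end

      run-tally : ∀ {c σ} → c ≤ 2 → Same σ → regs σ 13 ≡ c →
        Run w (forEdges (12 := (keepᵉ ins) ⨟ 13 := op add (reg 13) (op mul (crossᵉ end₁ᵉ end₂ᵉ) (reg 12)))) σ (10 + M * (10 + (1 + cost (keepᵉ ins) + 25)))
          (λ σ′ → Same σ′ × regs σ′ 13 ≡ c + length (filterᵇ select edges-list) × out σ′ ≡ out σ)
      run-tally {c} {σ₀} c≤2 S r13 = run-weaken (run-forEdges I (λ (S , _) → end-same S) (λ v (S , eq , o) → same-reg ≤-refl S , eq , o) step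
          (S , trans r13 (sym (+-identityʳ c)) , refl)) ≤-refl
        λ (S′ , eq , o) → S′ , trans eq (cong (λ l → c + length l) prefix-all) , o
        where
        I : ℕ → State → Set
        I i σ = Same σ × regs σ 13 ≡ c + length (prefix i) × out σ ≡ out σ₀
        step : ∀ (i : Fin M) {σ} → I (toℕ i) σ → regs σ 7 ≡ ad (i , false) →
          Run w (12 := (keepᵉ ins) ⨟ 13 := op add (reg 13) (op mul (crossᵉ end₁ᵉ end₂ᵉ) (reg 12))) σ (1 + cost (keepᵉ ins) + 25) (λ σ′ → I (suc (toℕ i)) σ′ × regs σ′ 7 ≡ ad (i , false))
        step i {σ} (S , eq , o) r7 = run-weaken (run-⨟ (run-:= (ev-keep i S r7)
          (run-:= (ev-add (ev-reg eq) (ev-select i (same-reg (≤ᵇ⇒≤ 7 12 tt) S) r7 refl)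
              (fits-Z (≤-trans (+-mono-≤ (+-mono-≤ c≤2 (prefix-length (toℕ i))) (bit≤1 (select (ed i)))) (≤-trans (≤-reflexive (arith M)) (≤-trans (+-mono-≤ (≤ᵇ⇒≤ 3 16 tt) (m≤n*m M 8)) end≤Z)))))
            ((same-reg (≤ᵇ⇒≤ 7 13 tt) (same-reg (≤ᵇ⇒≤ 7 12 tt) S) , trans (+-assoc c _ _) (cong (c +_) more) , o) , r7))))
            (+-monoʳ-≤ (1 + cost (keepᵉ ins)) (≤ᵇ⇒≤ 24 25 tt)) id
          where
          arith : ∀ m → 2 + m + 1 ≡ 3 + m
          arith = solve-∀
          bit-length : ∀ b → bit b ≡ length (if b then [ ed i ] else [])
          bit-length true  = refl
          bit-length false = refl
          more : length (prefix (toℕ i)) + bit (select (ed i)) ≡ length (prefix (suc (toℕ i)))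
          more = trans (cong (length (prefix (toℕ i)) +_) (bit-length (select (ed i)))) (trans (sym (length-++ (prefix (toℕ i)))) (cong length (sym (prefix-suc i))))

      run-emit : ∀ {σ} → Same σ →
        Run w (forEdges (12 := (keepᵉ ins) ⨟ ifnz (op mul (crossᵉ end₁ᵉ end₂ᵉ) (reg 12)) (output end₁ᵉ ⨟ output end₂ᵉ) skip)) σ (10 + M * (10 + (1 + cost (keepᵉ ins) + 40)))
          (λ σ′ → Same σ′ × out σ′ ≡ out σ ++ concatMap endpoints (filterᵇ select edges-list))
      run-emit {σ₀} S = run-weaken (run-forEdges I (λ (S , _) → end-same S) (λ v (S , o) → same-reg ≤-refl S , o) step
          (S , sym (++-identityʳ (out σ₀)))) ≤-refl
        λ (S′ , o) → S′ , trans o (cong (λ l → out σ₀ ++ concatMap endpoints l) prefix-all)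
        where
        I : ℕ → State → Set
        I i σ = Same σ × out σ ≡ out σ₀ ++ concatMap endpoints (prefix i)
        step : ∀ (i : Fin M) {σ} → I (toℕ i) σ → regs σ 7 ≡ ad (i , false) →
          Run w (12 := (keepᵉ ins) ⨟ ifnz (op mul (crossᵉ end₁ᵉ end₂ᵉ) (reg 12)) (output end₁ᵉ ⨟ output end₂ᵉ) skip) σ (1 + cost (keepᵉ ins) + 40) (λ σ′ → I (suc (toℕ i)) σ′ × regs σ′ 7 ≡ ad (i , false))
        step i {σ} (S , o) r7 = run-⨟ (run-:= (ev-keep i S r7) (choose (select (ed i)) refl))
          where
          S₁ = same-reg {v = bit (keptᵇ (ed i))} (≤ᵇ⇒≤ 7 12 tt) S
          σ₁ = setReg σ 12 (bit (keptᵇ (ed i)))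
          guard = ev-select i S₁ r7 refl
          next : ∀ b → select (ed i) ≡ b → out σ ++ (if b then endpoints (ed i) else []) ≡ out σ₀ ++ concatMap endpoints (prefix (suc (toℕ i)))
          next b eq = trans (cong (_++ _) o) (trans (++-assoc (out σ₀) _ _) (cong (out σ₀ ++_)
            (trans (cong (concatMap endpoints (prefix (toℕ i)) ++_) (one b eq))
              (trans (sym (concatMap-++ endpoints (prefix (toℕ i)) _)) (cong (concatMap endpoints) (sym (prefix-suc i)))))))
            where
            one : ∀ b → select (ed i) ≡ b → (if b then endpoints (ed i) else []) ≡ concatMap endpoints (if select (ed i) then [ ed i ] else [])
            one true  eq rewrite eq = refl
            one false eq rewrite eq = refl
          choose : ∀ b → select (ed i) ≡ b → Run w (ifnz (op mul (crossᵉ end₁ᵉ end₂ᵉ) (reg 12)) (output end₁ᵉ ⨟ output end₂ᵉ) skip) σ₁ 40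
            (λ σ′ → I (suc (toℕ i)) σ′ × regs σ′ 7 ≡ ad (i , false))
          choose true eq = within (run-then (subst (λ z → Ev w σ₁ _ (bit z)) eq guard) (λ ())
            (run-⨟ (run-output (ev-end₁ i S₁ r7) (run-output (ev-end₂ i (same-out S₁) r7)
              ((same-out (same-out {o = out σ ++ [ toℕ (end₁ (ed i)) ]} S₁) , trans (++-assoc (out σ) _ _) (next true eq)) , r7)))))
          choose false eq = within (run-else (subst (λ z → Ev w σ₁ _ (bit z)) eq guard) refl
            (run-skip ((S₁ , trans (sym (++-identityʳ (out σ))) (next false eq)) , r7)))

      run-report : Run w (report (keepᵉ ins) (extrasᵉ ins)) σc (reportCost (cost (keepᵉ ins)) M) (λ σ′ → out σ′ ≡ length vs ∷ map toℕ vs ++ length selected ∷ concatMap endpoints selected)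
      run-report =
        run-⨟ (run-output (ev-reg count) (
        run-⨟ (run-weaken (run-vertices (same-out S₀) count) ≤-refl (λ (S₁ , o₁) →
        run-⨟ (run-:= (ev-lit (fits-lit 0)) (
        run-⨟ (run-weaken (run-tallyExtra extras-denote (same-reg (≤ᵇ⇒≤ 7 13 tt) S₁) refl extras≤2) (+-monoʳ-≤ 1 (*-monoˡ-≤ 20 extras≤2)) (λ (S₂ , r13 , o₂) →
        run-⨟ (run-weaken (run-tally (≤-trans (filterᵇ-≤ (crosses χ) extraEdges) extras≤2) S₂ r13) ≤-refl (λ (S₃ , r13′ , o₃) →
        run-⨟ (run-output (ev-reg r13′) (
        run-⨟ (run-weaken (run-emitExtra extras-denote (same-out S₃)) (+-monoʳ-≤ 1 (*-monoˡ-≤ 25 extras≤2)) (λ (S₄ , o₄) →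
        run-weaken (run-emit S₄) ≤-refl (λ (S₅ , o₅) → assemble o₁ (trans o₃ o₂) o₄ o₅)))))))))))))))
        where
        S₀ : Same σc
        S₀ = record { regs-same = λ _ _ → refl ; mem-same = λ _ → refl }
        a = filterᵇ (crosses χ) extraEdges
        b = filterᵇ select edges-list
        assemble : ∀ {o₁ o₃ o₄ o₅} → o₁ ≡ (out σc ++ [ length vs ]) ++ map toℕ vs → o₃ ≡ o₁ →
          o₄ ≡ (o₃ ++ [ length a + length b ]) ++ concatMap endpoints a → o₅ ≡ o₄ ++ concatMap endpoints b →
          o₅ ≡ length vs ∷ map toℕ vs ++ length (a ++ b) ∷ concatMap endpoints (a ++ b)
        assemble refl refl refl refl rewrite out-none | length-++ a {b} | concatMap-++ endpoints a b =
          cong (length vs ∷_) (trans (++-assoc (map toℕ vs ++ _) (concatMap endpoints a) (concatMap endpoints b)) (++-assoc (map toℕ vs) _ _))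

    -- A failed try moves register 5 by at most 6 regions: 3 for its retry and 3 for leaving it. The
    -- hypothesis reserves these for all remaining tries.
    run-tries : ∀ ts {j σ} → 3 ≤ j → j + 6 * length ts ≤ 980 → Ready j j σ →
      Run w (tries ins ts) σ (triesCost ins (length ts) M) (Outcome ts)
    run-tries [] 3≤j j≤ R = run-skip (inj₁ [])
    run-tries ((π , b) ∷ ts) {j} {σ} 3≤j j≤ R = run-⨟ (run-weaken (run-attempt π b 3≤j (≤-trans (m≤m+n j _) j≤) R) ≤-refl next)
      where
      next : ∀ {σ} → Attempted π b j σ → Run w (ifnz (reg 11) (5 := op add (advanceᵉ (reg 5)) sizeᵉ ⨟ tries ins ts) (report (keepᵉ ins) (extrasᵉ ins))) σ
        (2 + (11 + triesCost ins (length ts) M + reportCost (cost (keepᵉ ins)) M)) (Outcome ((π , b) ∷ ts))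
      next (succeeded k vs k≤ r11 Re m o≤) = run-weaken (run-else (ev-reg r11) refl (Reporter.run-report {k} {vs} k≤990 Re))
        (+-monoʳ-≤ 2 (m≤n+m (reportCost (cost (keepᵉ ins)) M) (11 + triesCost ins (length ts) M)))
        λ o → inj₂ ([] , (π , b) , ts , refl , record { vs = vs ; fails = [] ; unique = Reached.unique Re ; matches = m ; within₁ = o≤ ; reports = o })
        where
        k≤990 : k ≤ 990
        k≤990 = ≤-trans k≤ (≤-trans (+-monoʳ-≤ 3 (≤-trans (m≤m+n j _) j≤)) (≤ᵇ⇒≤ 983 990 tt))
      next {σ} (failed k k≤ r11 R fail) = run-weaken (run-then (ev-reg refl) r11 (run-⨟ (run-:=
          (subst (Ev w _ _) (+-comm _ Z) (ev-add (ev-advance k≤990 (ready-env R) (ev-reg (Ready.base R))) (ready-env R)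
            (subst (_< 2 ^ w) (+-comm Z _) (fits-multiple {3 + k} (≤-trans (+-monoʳ-≤ 3 k≤990) (≤ᵇ⇒≤ 993 1000 tt))))))
          (run-weaken (run-tries ts (m≤m+n 3 k) j′≤ R′) ≤-refl (prepend fail)))))
          (+-monoʳ-≤ 2 (m≤m+n (11 + triesCost ins (length ts) M) (reportCost (cost (keepᵉ ins)) M))) id
        where
        k≤990 : k ≤ 990
        k≤990 = ≤-trans k≤ (≤-trans (+-monoʳ-≤ 3 (≤-trans (m≤m+n j _) j≤)) (≤ᵇ⇒≤ 983 990 tt))
        j′≤ : 3 + k + 6 * length ts ≤ 980
        j′≤ = ≤-trans (+-monoˡ-≤ (6 * length ts) (+-monoʳ-≤ 3 k≤)) (≤-trans (≤-reflexive (arith j (length ts))) j≤)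
          where
          arith : ∀ j l → 3 + (3 + j) + 6 * l ≡ j + 6 * suc l
          arith = solve-∀
        R′ : Ready (3 + k) (3 + k) (setReg σ 5 ((3 + k) * Z))
        R′ = record { regs-kept = λ q q<5 → trans (upd-other (regs σ) (>⇒≢ q<5)) (Ready.regs-kept R q q<5)
                    ; base = refl ; low = Ready.low R ; clear = Ready.clear R ; out-none = Ready.out-none R }
        prepend : ∀ {σ} → Fails (π , b) → Outcome ts σ → Outcome ((π , b) ∷ ts) σ
        prepend f (inj₁ fs) = inj₁ (f ∷ fs)
        prepend f (inj₂ (fs , tr , ts′ , eq , A)) = inj₂ ((π , b) ∷ fs , tr , ts′ , cong ((π , b) ∷_) eq
          , record { vs = vs ; fails = f ∷ fails ; unique = unique ; matches = matches ; within₁ = within₁ ; reports = reports })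
          where open Answer A

    -- Optimality of the first success

    pattern-matches : ∀ χ → χ s ≡ true → χ t ≡ false → Matches (patternOf e₁ e₂ χ) χ
    pattern-matches χ χs χt = χs , χt , at
      where
      at : ∀ i → χ (p i) ≡ Vec.lookup (patternOf e₁ e₂ χ) i
      at zero                   = refl
      at (suc zero)             = refl
      at (suc (suc zero))       = refl
      at (suc (suc (suc zero))) = refl

    matches⇒pattern : ∀ {π χ} → Matches π χ → patternOf e₁ e₂ χ ≡ π
    matches⇒pattern {a ∷ b ∷ c ∷ d ∷ []} (_ , _ , m)
      rewrite m zero | m (suc zero) | m (suc (suc zero)) | m (suc (suc (suc zero))) = refl

    module _ (χ₀ : Fin n → Bool) (χ₀s : χ₀ s ≡ true) (χ₀t : χ₀ t ≡ false) (χ₀-closed : outflow r χ₀ ≡ 0) where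

      -- The cut `χ₀` of outflow 0 refutes the failure of its own pattern with slack 0, so some try
      -- succeeds. A rival of outflow 0 or 1 likewise shows that its own try had not failed before,
      -- and the order of the schedule compares the two.
      solved : ∀ {σ′} → Outcome (schedule ins) σ′ → Solved ins e₁ e₂ σ′
      solved (inj₁ fails) = ⊥-elim (<-irrefl (sym χ₀-closed)
        (All.lookup fails (∈-schedule ins (patternOf e₁ e₂ χ₀ , false)) χ₀ (pattern-matches χ₀ χ₀s χ₀t)))
      solved (inj₂ (fs , tr , ts , eq , A)) = record
        { vs = vs ; unique = unique ; source∈ = proj₁ matches ; sink∉ = proj₁ (proj₂ matches)
        ; tight = ≤-trans within₁ (bit≤1 _) ; best = best ; reports = reports }
        where
        open Answer A
        χ = member vs
        least : ∀ tr′ → tr′ ∉ fs → level ins tr ≤ level ins tr′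
        least tr′ = sorted-least fs (subst (AllPairs _) eq (schedule-sorted ins)) (subst (tr′ ∈_) eq (∈-schedule ins tr′))
        reached : outflow r χ + shift ins (patternOf e₁ e₂ χ) ≤ level ins tr
        reached = +-mono-≤ within₁ (≤-reflexive (cong (shift ins) (matches⇒pattern {proj₁ tr} {χ} matches)))
        beats : ∀ {χ′} b → χ′ s ≡ true → χ′ t ≡ false → outflow r χ′ ≡ bit b → level ins tr ≤ outflow r χ′ + shift ins (patternOf e₁ e₂ χ′)
        beats {χ′} b s∈ t∉ o≡ = subst (λ z → level ins tr ≤ z + shift ins (patternOf e₁ e₂ χ′)) (sym o≡)
          (least (patternOf e₁ e₂ χ′ , b) (λ m → <-irrefl (sym o≡) (All.lookup fails m χ′ (pattern-matches χ′ s∈ t∉))))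
        best : ∀ χ′ → χ′ s ≡ true → χ′ t ≡ false → outflow r χ + shift ins (patternOf e₁ e₂ χ) ≤ outflow r χ′ + shift ins (patternOf e₁ e₂ χ′)
        best χ′ s∈ t∉ with outflow r χ′ in o≡
        ... | 0 = ≤-trans reached (subst (λ z → level ins tr ≤ z + shift ins (patternOf e₁ e₂ χ′)) o≡ (beats {χ′} false s∈ t∉ o≡))
        ... | 1 = ≤-trans reached (subst (λ z → level ins tr ≤ z + shift ins (patternOf e₁ e₂ χ′)) o≡ (beats {χ′} true s∈ t∉ o≡))
        -- A rival of outflow at least 2 loses to `χ₀`, whose outflow is 0 and whose shift is at
        -- most 2.
        ... | suc (suc o) = ≤-trans reached (≤-trans (beats {χ₀} false χ₀s χ₀t χ₀-closed)
            (≤-trans (≤-reflexive (cong (_+ shift ins (patternOf e₁ e₂ χ₀)) χ₀-closed))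
              (≤-trans (shift≤2 ins (patternOf e₁ e₂ χ₀)) (≤-trans (s≤s (s≤s z≤n)) (m≤m+n (2 + o) _)))))

      pick : ∀ b → regs σᵢ 0 ≡ bit b → Run w (tries b (schedule b)) σᵢ (triesCost b (length (schedule b)) M) (Solved ins e₁ e₂) →
        Run w (ifnz (reg 0) (tries true (schedule true)) (tries false (schedule false))) σᵢ
          (2 + (triesCost true (length (schedule true)) M + triesCost false (length (schedule false)) M)) (Solved ins e₁ e₂)
      pick true  r0 T = run-weaken (run-then (ev-reg r0) (λ ()) T) (+-monoʳ-≤ 2 (m≤m+n _ (triesCost false (length (schedule false)) M))) id
      pick false r0 T = run-weaken (run-else (ev-reg r0) refl T) (+-monoʳ-≤ 2 (m≤n+m _ (triesCost true (length (schedule true)) M))) id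

      enough : ∀ b → 3 + 6 * length (schedule b) ≤ 980
      enough true  = ≤ᵇ⇒≤ _ 980 tt
      enough false = ≤ᵇ⇒≤ _ 980 tt

      run-schedule : Ready 3 3 σᵢ → regs σᵢ 0 ≡ bit ins →
        Run w (ifnz (reg 0) (tries true (schedule true)) (tries false (schedule false))) σᵢ
          (2 + (triesCost true (length (schedule true)) M + triesCost false (length (schedule false)) M)) (Solved ins e₁ e₂)
      run-schedule ready r0 = pick ins r0 (run-weaken (run-tries (schedule ins) ≤-refl (enough ins) ready) ≤-refl solved)

  run-oracle : ∀ (χ₀ : Fin n → Bool) → χ₀ s ≡ true → χ₀ t ≡ false → outflow r χ₀ ≡ 0 →
    ∀ ins e₁ e₂ {σ₀} → mem σ₀ ≡ contents layout → out σ₀ ≡ [] →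
    (∀ q → regs σ₀ q ≡ contents (bit ins ∷ endpoints e₁ ++ endpoints e₂) q) →
    Run w oracle σ₀ (oracleCost M) (Solved ins e₁ e₂)
  run-oracle χ₀ χ₀s χ₀t χ₀-closed ins e₁ e₂ {σ₀} refl none words =
    run-⨟ (run-weaken (run-prepare σ₀ layout-env clear) ≤-refl answer)
    where
    clear : ∀ a → Z ≤ a → contents layout a ≡ 0
    clear a ≤a = contents-beyond layout (≤-trans (≤-trans (≤-reflexive layout-length) (subst (λ z → 4 + z ≤ 16 + 8 * M) (*-comm 8 M) (+-monoˡ-≤ (8 * M) (≤ᵇ⇒≤ 4 16 tt)))) (≤-trans end≤Z ≤a))
    module _ {σ : State} (P : Prepared σ₀ layout-env clear σ) where
      open Prepared P
      env : Env (mem σ)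
      env = record
        { source = trans (low _ (<-≤-trans (<ᵇ⇒< 0 16 tt) 16≤Z)) source ; sink = trans (low _ (<-≤-trans (<ᵇ⇒< 1 16 tt) 16≤Z)) sink
        ; end = trans (low _ (<-≤-trans (<ᵇ⇒< 2 16 tt) 16≤Z)) end ; size = trans (low _ (<-≤-trans (<ᵇ⇒< 3 16 tt) 16≤Z)) size
        ; tails = λ h → trans (low _ (ad<Z h)) (tails h)
        ; heads = λ h → trans (low _ (≤-<-trans (+-monoʳ-≤ (ad h) (≤ᵇ⇒≤ 1 4 tt)) (ad+4<Z h))) (heads h)
        ; caps = λ h → trans (low _ (≤-<-trans (+-monoʳ-≤ (ad h) (≤ᵇ⇒≤ 2 4 tt)) (ad+4<Z h))) (caps h)
        ; twins = λ h → trans (low _ (≤-<-trans (+-monoʳ-≤ (ad h) (≤ᵇ⇒≤ 3 4 tt)) (ad+4<Z h))) (twins h) }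
        where open Env layout-env

      ends-at : ∀ i → regs σ (suc (toℕ i)) ≡ toℕ (terminals e₁ e₂ i)
      ends-at i = trans (regs-kept _ (s≤s (toℕ<n i))) (trans (words _) (value i))
        where
        value : ∀ i → contents (endpoints e₁ ++ endpoints e₂) (toℕ i) ≡ toℕ (terminals e₁ e₂ i)
        value zero                   = refl
        value (suc zero)             = refl
        value (suc (suc zero))       = refl
        value (suc (suc (suc zero))) = refl

      session : Session
      session = record
        { σᵢ = σ ; env = env ; hs = hs ; every = every ; few = few ; chains = chains ; out-empty = trans out-kept none
        ; e₁ = e₁ ; e₂ = e₂ ; ins = ins ; ends-at = ends-at }

      ready : Querying.Ready session 3 3 σ
      ready = record { regs-kept = λ _ _ → refl ; base = trans base (three Z) ; low = λ _ _ → refl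
        ; clear = λ a ≤a → high a (subst (_≤ a) (sym (three Z)) ≤a) ; out-none = trans out-kept none }
        where
        three : ∀ z → z + z + z ≡ 3 * z
        three = solve-∀

      answer : Run w (ifnz (reg 0) (tries true (schedule true)) (tries false (schedule false))) σ
        (2 + (triesCost true (length (schedule true)) M + triesCost false (length (schedule false)) M)) (Solved ins e₁ e₂)
      answer = Querying.run-schedule session χ₀ χ₀s χ₀t χ₀-closed ready (trans (regs-kept 0 (<ᵇ⇒< 0 5 tt)) (words 0))

-- Acyclic maximum flows

sum-mono : ∀ {m} {f g : Fin m → ℕ} → (∀ i → f i ≤ g i) → sum f ≤ sum g
sum-mono {zero}  le = z≤n
sum-mono {suc m} le = +-mono-≤ (le zero) (sum-mono (le ∘ suc))

sum-mono-< : ∀ {m} {f g : Fin m → ℕ} i → (∀ j → f j ≤ g j) → f i < g i → sum f < sum g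
sum-mono-< zero    le lt = +-mono-<-≤ lt (sum-mono (le ∘ suc))
sum-mono-< (suc i) le lt = +-mono-≤-< (le zero) (sum-mono-< i (le ∘ suc) lt)

sum-const : ∀ m k → sum {m} (λ _ → k) ≡ m * k
sum-const zero    k = refl
sum-const (suc m) k = cong (k +_) (sum-const m k)

finite-choice : ∀ {m} {A : Set} {B : Fin m → Set} → (∀ i → A ⊎ B i) → A ⊎ (∀ i → B i)
finite-choice {zero}  f = inj₂ λ ()
finite-choice {suc m} f with f zero | finite-choice (f ∘ suc)
... | inj₁ a | _      = inj₁ a
... | inj₂ b | inj₁ a = inj₁ a
... | inj₂ b | inj₂ g = inj₂ λ { zero → b ; (suc i) → g i }

≢⇒not : ∀ {b c} → c ≢ b → not b ≡ c
≢⇒not {true}  {true}  ne = ⊥-elim (ne refl)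
≢⇒not {true}  {false} ne = refl
≢⇒not {false} {true}  ne = refl
≢⇒not {false} {false} ne = ⊥-elim (ne refl)

∨-false : ∀ {a b} → a ∨ b ≡ false → a ≡ false
∨-false {false} _ = refl

bool-cases : ∀ b → b ≡ true ⊎ b ≡ false
bool-cases true  = inj₁ refl
bool-cases false = inj₂ refl

module Flows {n m : ℕ} (x y : Fin m → Fin n) where

  open Network x y

  abstract

    push : (Half → ℕ) → Half → Half → ℕ
    push ρ (i , b) (j , c) = if does (j ≟ᶠ i) then (if does (c ≟ᵇ b) then ρ (j , c) ∸ 1 else suc (ρ (j , c))) else ρ (j , c)

    push-here : ∀ ρ h → push ρ h h ≡ ρ h ∸ 1
    push-here ρ (i , b) rewrite dec-true (i ≟ᶠ i) refl | dec-true (b ≟ᵇ b) refl = refl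

    push-twin : ∀ ρ h → push ρ h (tw h) ≡ suc (ρ (tw h))
    push-twin ρ (i , b) rewrite dec-true (i ≟ᶠ i) refl | dec-false (not b ≟ᵇ b) (λ e → not-¬ refl (sym e)) = refl

    push-else : ∀ ρ h j c → j ≢ proj₁ h → push ρ h (j , c) ≡ ρ (j , c)
    push-else ρ (i , b) j c ne rewrite dec-false (j ≟ᶠ i) ne = refl

  outflow-pushed : ∀ ρ h → 0 < ρ h → ∀ χ → outflow (push ρ h) χ + bit (χ (tl h)) ≡ outflow ρ χ + bit (χ (hd h))
  outflow-pushed ρ h ρ>0 = outflow-push h (push-else ρ h) (trans (cong suc (push-here ρ h)) (m+[n∸m]≡n ρ>0)) (push-twin ρ h)

  -- One unit is sent along a path through arcs in ok, which uses every edge at most once.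

  data Change (ok : Half → Set) (ρ ρ′ : Half → ℕ) (i : Fin m) : Set where
    same   : (∀ b → ρ′ (i , b) ≡ ρ (i , b)) → Change ok ρ ρ′ i
    pushed : ∀ b → ok (i , b) → suc (ρ′ (i , b)) ≡ ρ (i , b) → ρ′ (i , not b) ≡ suc (ρ (i , not b)) → Change ok ρ ρ′ i

  record Sent (ok : Half → Set) (ρ : Half → ℕ) (u v : Fin n) : Set where
    field
      ρ′      : Half → ℕ
      conserved : ∀ χ → outflow ρ′ χ + bit (χ u) ≡ outflow ρ χ + bit (χ v)
      change  : ∀ i → Change ok ρ ρ′ i

  module _ {ok : Half → Set} (ok? : ∀ h → Dec (ok h)) {ρ : Half → ℕ} (positive : ∀ h → ok h → 0 < ρ h) (u v : Fin n) where

    -- The certificate that no path through `ok` arcs exists: a set closed under them that contains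
    -- `u` and not `v`.
    Blocked : Set
    Blocked = Σ[ χ ∈ (Fin n → Bool) ] χ u ≡ true × χ v ≡ false × (∀ h → ok h → χ (tl h) ≡ true → χ (hd h) ≡ true)

    -- Edges with an end outside `χ` are untouched by the path to `z`. An arc that leaves `χ` is
    -- therefore fresh, which is why every path built by `extend` uses an edge at most once.
    Inside : (Fin n → Bool) → Fin n → Set
    Inside χ z = Σ[ S ∈ Sent ok ρ u z ] (∀ h → χ (tl h) ≡ false → Sent.ρ′ S h ≡ ρ h × Sent.ρ′ S (tw h) ≡ ρ (tw h))

    extend : ∀ {χ h} → ok h → χ (tl h) ≡ true → χ (hd h) ≡ false → Inside χ (tl h) →
      Inside (λ z → χ z ∨ does (z ≟ᶠ hd h)) (hd h)
    extend {χ} {h@(i , b)} o t∈ h∉ (S , outside) = record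
      { ρ′ = push ρ₁ h
      ; conserved = λ χ′ → +-cancelʳ-≡ (bit (χ′ (tl h))) _ _ (begin
          outflow (push ρ₁ h) χ′ + bit (χ′ u) + bit (χ′ (tl h)) ≡⟨ swap (outflow (push ρ₁ h) χ′) _ _ ⟩
          outflow (push ρ₁ h) χ′ + bit (χ′ (tl h)) + bit (χ′ u) ≡⟨ cong (_+ bit (χ′ u)) (outflow-pushed ρ₁ h (subst (0 <_) (sym at-h) (positive h o)) χ′) ⟩
          outflow ρ₁ χ′ + bit (χ′ (hd h)) + bit (χ′ u)          ≡⟨ swap (outflow ρ₁ χ′) _ _ ⟩
          outflow ρ₁ χ′ + bit (χ′ u) + bit (χ′ (hd h))          ≡⟨ cong (_+ bit (χ′ (hd h))) (conserved χ′) ⟩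
          outflow ρ χ′ + bit (χ′ (tl h)) + bit (χ′ (hd h))      ≡⟨ swap (outflow ρ χ′) _ _ ⟩
          outflow ρ χ′ + bit (χ′ (hd h)) + bit (χ′ (tl h))      ∎)
      ; change = change′ } , outside′
      where
      open Sent S renaming (ρ′ to ρ₁)
      open ≡-Reasoning
      swap : ∀ a b c → a + b + c ≡ a + c + b
      swap = solve-∀
      unchanged = outside (tw h) h∉
      at-h : ρ₁ h ≡ ρ h
      at-h = subst (λ c → ρ₁ (i , c) ≡ ρ (i , c)) (not-involutive b) (proj₂ unchanged)
      at-tw : ρ₁ (tw h) ≡ ρ (tw h)
      at-tw = proj₁ unchanged
      change′ : ∀ j → Change ok ρ (push ρ₁ h) j
      change′ j with j ≟ᶠ i
      ... | yes refl = pushed b o (trans (cong suc (push-here ρ₁ h)) (trans (m+[n∸m]≡n (subst (0 <_) (sym at-h) (positive h o))) at-h))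
                         (trans (push-twin ρ₁ h) (cong suc at-tw))
      ... | no ne with change j
      ...   | same eq          = same (λ c → trans (push-else ρ₁ h j c ne) (eq c))
      ...   | pushed c o′ d up = pushed c o′ (trans (cong suc (push-else ρ₁ h j c ne)) d) (trans (push-else ρ₁ h j (not c) ne) up)
      outside′ : ∀ h′ → χ (tl h′) ∨ does (tl h′ ≟ᶠ hd h) ≡ false → push ρ₁ h h′ ≡ ρ h′ × push ρ₁ h (tw h′) ≡ ρ (tw h′)
      outside′ h′@(j , c) out with j ≟ᶠ i
      ... | no ne = trans (push-else ρ₁ h j c ne) (proj₁ old) , trans (push-else ρ₁ h j (not c) ne) (proj₂ old)
        where
        old = outside h′ (∨-false out)
      ... | yes refl = ⊥-elim (end-in c out)
        where
        tail-in : χ (tl h) ∨ does (tl h ≟ᶠ hd h) ≢ false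
        tail-in eq with () ← trans (sym (cong (_∨ does (tl h ≟ᶠ hd h)) t∈)) eq
        head-in : χ (hd h) ∨ does (hd h ≟ᶠ hd h) ≢ false
        head-in eq with () ← trans (sym (trans (cong (χ (hd h) ∨_) (dec-true (hd h ≟ᶠ hd h) refl)) (∨-zeroʳ _))) eq
        end-in : ∀ c → χ (tl (i , c)) ∨ does (tl (i , c) ≟ᶠ hd h) ≢ false
        end-in c with c ≟ᵇ b
        ... | yes refl = tail-in
        ... | no ne    = subst (λ c → χ (tl (i , c)) ∨ does (tl (i , c) ≟ᶠ hd h) ≢ false) (≢⇒not ne) head-in

    Frontier : (Fin n → Bool) → Half → Set
    Frontier χ h = ok h × χ (tl h) ≡ true × χ (hd h) ≡ false

    frontier : ∀ χ → ∃[ h ] Frontier χ h ⊎ (∀ h → ok h → χ (tl h) ≡ true → χ (hd h) ≡ true)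
    frontier χ with any? (λ i → dec (i , false) ⊎-dec dec (i , true))
      where
      dec : ∀ h → Dec (Frontier χ h)
      dec h = ok? h ×-dec (χ (tl h) ≟ᵇ true) ×-dec (χ (hd h) ≟ᵇ false)
    ... | yes (i , inj₁ f) = inj₁ ((i , false) , f)
    ... | yes (i , inj₂ f) = inj₁ ((i , true) , f)
    ... | no none = inj₂ closed
      where
      closed : ∀ h → ok h → χ (tl h) ≡ true → χ (hd h) ≡ true
      closed h@(i , b) o t∈ with bool-cases (χ (hd h))
      closed h@(i , b) o t∈ | inj₁ h∈ = h∈
      closed h@(i , false) o t∈ | inj₂ h∉ = ⊥-elim (none (i , inj₁ (o , t∈ , h∉)))
      closed h@(i , true)  o t∈ | inj₂ h∉ = ⊥-elim (none (i , inj₂ (o , t∈ , h∉)))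

    -- `rem` covers all vertices outside `χ`, and each round removes the head of a frontier arc from
    -- it; this is what `fuel` counts.
    explore-from : ∀ fuel rem χ → length rem ≤ fuel → (∀ z → χ z ≡ true ⊎ z ∈ rem) → χ u ≡ true →
      (∀ z → χ z ≡ true → Inside χ z) → Blocked ⊎ Sent ok ρ u v
    explore-from zero [] χ small cover u∈ inside with cover v
    ... | inj₁ v∈ = inj₂ (proj₁ (inside v v∈))
    explore-from (suc fuel) rem χ small cover u∈ inside with bool-cases (χ v) | frontier χ
    ... | inj₁ v∈ | _ = inj₂ (proj₁ (inside v v∈))
    ... | inj₂ v∉ | inj₂ closed = inj₁ (χ , u∈ , v∉ , closed)
    ... | inj₂ v∉ | inj₁ (h , o , t∈ , h∉) =
      explore-from fuel (filter keep? rem) _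
        (s≤s⁻¹ (≤-trans (filter-notAll keep? rem (Any.map (λ eq ne → ne (sym eq)) h∈)) small)) cover′
        (cong (_∨ does (u ≟ᶠ hd h)) u∈) inside′
      where
      keep? : ∀ z → Dec (z ≢ hd h)
      keep? z = ¬? (z ≟ᶠ hd h)
      h∈ : hd h ∈ rem
      h∈ with cover (hd h)
      ... | inj₂ m = m
      ... | inj₁ e with () ← trans (sym e) h∉
      cover′ : ∀ z → χ z ∨ does (z ≟ᶠ hd h) ≡ true ⊎ z ∈ filter keep? rem
      cover′ z with z ≟ᶠ hd h | cover z
      ... | yes _ | _      = inj₁ (∨-zeroʳ _)
      ... | no ne | inj₁ e = inj₁ (cong (_∨ false) e)
      ... | no ne | inj₂ e = inj₂ (∈-filter⁺ keep? e ne)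
      inside′ : ∀ z → χ z ∨ does (z ≟ᶠ hd h) ≡ true → Inside (λ z → χ z ∨ does (z ≟ᶠ hd h)) z
      inside′ z e with bool-cases (χ z)
      ... | inj₁ z∈ = proj₁ (inside z z∈) , λ h′ out → proj₂ (inside z z∈) h′ (∨-false out)
      ... | inj₂ z∉ with z ≟ᶠ hd h
      ...   | yes refl = extend {χ} o t∈ h∉ (inside (tl h) t∈)
      ...   | no _ with () ← trans (sym (cong (_∨ false) z∉)) e

    send : Blocked ⊎ Sent ok ρ u v
    send = explore-from (length (allFin n)) (allFin n) (λ z → does (z ≟ᶠ u)) ≤-refl (λ z → inj₂ (∈-allFin z)) (dec-true (u ≟ᶠ u) refl) start
      where
      start : ∀ z → does (z ≟ᶠ u) ≡ true → Inside (λ z → does (z ≟ᶠ u)) z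
      start z e with z ≟ᶠ u
      ... | yes refl = record { ρ′ = ρ ; conserved = λ _ → refl ; change = λ _ → same (λ _ → refl) } , λ _ _ → refl , refl

  -- Maximum flows and cancellation of cycles

  unit : Half → ℕ
  unit _ = 1

  Balanced : (Half → ℕ) → Set
  Balanced ρ = ∀ i → ρ (i , false) + ρ (i , true) ≡ 2

  balanced-twin : ∀ {ρ} → Balanced ρ → ∀ h → ρ h + ρ (tw h) ≡ 2
  balanced-twin bal (i , false) = bal i
  balanced-twin {ρ} bal (i , true) = trans (+-comm (ρ (i , true)) _) (bal i)

  change-balanced : ∀ {ok ρ ρ′} → Balanced ρ → (∀ i → Change ok ρ ρ′ i) → Balanced ρ′
  change-balanced {ok} {ρ} {ρ′} bal change i with change i
  ... | same eq = trans (cong₂ _+_ (eq false) (eq true)) (bal i)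
  ... | pushed false _ d u = trans (cong (ρ′ (i , false) +_) u) (trans (+-suc _ _) (trans (cong (_+ ρ (i , true)) d) (bal i)))
  ... | pushed true  _ d u = trans (cong (_+ ρ′ (i , true)) u) (trans (sym (+-suc _ _)) (trans (cong (ρ (i , false) +_) d) (bal i)))

  module MaxFlow (s t : Fin n) (s≢t : s ≢ t) where

    -- The zero flow has residual capacity 1 in both directions, so `outflow unit` counts crossing
    -- edges. Taking singletons for `χ` gives conservation at each vertex; the form with all sets is
    -- the one that pushing preserves and cuts use.
    record Flow (value : ℕ) (ρ : Half → ℕ) : Set where
      field
        balanced : Balanced ρ
        net      : ∀ χ → outflow ρ χ + value * bit (χ s) ≡ outflow unit χ + value * bit (χ t)

    is-s : Fin n → Bool
    is-s v = does (v ≟ᶠ s)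

    value≤ : ∀ {k ρ} → Flow k ρ → k ≤ outflow unit is-s
    value≤ {k} {ρ} F = begin
      k                                        ≡⟨ *-identityʳ k ⟨
      k * 1                                    ≡⟨ cong (λ b → k * bit b) (dec-true (s ≟ᶠ s) refl) ⟨
      k * bit (is-s s)                         ≤⟨ m≤n+m _ (outflow ρ is-s) ⟩
      outflow ρ is-s + k * bit (is-s s)        ≡⟨ Flow.net F is-s ⟩
      outflow unit is-s + k * bit (is-s t)     ≡⟨ cong (λ b → outflow unit is-s + k * bit b) (dec-false (t ≟ᶠ s) (λ e → s≢t (sym e))) ⟩
      outflow unit is-s + k * 0                ≡⟨ cong (outflow unit is-s +_) (*-zeroʳ k) ⟩
      outflow unit is-s + 0                    ≡⟨ +-identityʳ _ ⟩
      outflow unit is-s                        ∎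
      where open ≤-Reasoning

    Maximum : Set
    Maximum = ∃[ k ] ∃[ ρ ] Flow k ρ × Σ[ χ ∈ (Fin n → Bool) ] χ s ≡ true × χ t ≡ false × outflow ρ χ ≡ 0

    -- The value never exceeds the degree of the source, so the fuel runs out only in a
    -- contradictory state.
    augment : ∀ fuel k ρ → k + fuel ≡ suc (outflow unit is-s) → Flow k ρ → Maximum
    augment zero k ρ eq F = ⊥-elim (<-irrefl refl (≤-trans (≤-reflexive (sym (trans (sym (+-identityʳ k)) eq))) (value≤ F)))
    augment (suc fuel) k ρ eq F with send {ok = λ h → 0 < ρ h} (λ h → 0 <? ρ h) (λ _ p → p) s t
    ... | inj₁ (χ , s∈ , t∉ , closed) = k , ρ , F , χ , s∈ , t∉ , closed⇒outflow≡0 {ρ = ρ} {χ} (λ h t∈ p → closed h p t∈)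
    ... | inj₂ S = augment fuel (suc k) ρ′ (trans (sym (+-suc k fuel)) eq) (record
        { balanced = change-balanced (Flow.balanced F) change ; net = net′ })
      where
      open Sent S
      net′ : ∀ χ → outflow ρ′ χ + suc k * bit (χ s) ≡ outflow unit χ + suc k * bit (χ t)
      net′ χ = begin
        outflow ρ′ χ + (bit (χ s) + k * bit (χ s))  ≡⟨ +-assoc (outflow ρ′ χ) _ _ ⟨
        outflow ρ′ χ + bit (χ s) + k * bit (χ s)    ≡⟨ cong (_+ k * bit (χ s)) (conserved χ) ⟩
        outflow ρ χ + bit (χ t) + k * bit (χ s)     ≡⟨ swap (outflow ρ χ) _ _ ⟩
        outflow ρ χ + k * bit (χ s) + bit (χ t)     ≡⟨ cong (_+ bit (χ t)) (Flow.net F χ) ⟩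
        outflow unit χ + k * bit (χ t) + bit (χ t)  ≡⟨ swap₂ (outflow unit χ) _ _ ⟩
        outflow unit χ + (bit (χ t) + k * bit (χ t)) ∎
        where
        open ≡-Reasoning
        swap : ∀ a b c → a + b + c ≡ a + c + b
        swap = solve-∀
        swap₂ : ∀ a b c → a + b + c ≡ a + (c + b)
        swap₂ = solve-∀

    maximum : Maximum
    maximum = augment (suc (outflow unit is-s)) 0 unit refl (record { balanced = λ _ → refl ; net = λ _ → refl })

    carrying : (Half → ℕ) → Fin m → Bool
    carrying ρ i = not (does (ρ (i , false) ≟ 1))

    support : (Half → ℕ) → ℕ
    support ρ = sum (λ i → bit (carrying ρ i))

    -- Residual capacity 2 marks an arc that points against the flow. A set closed under such arcs
    -- that edge `i` enters certifies that `i` lies on no directed flow cycle; an edge without flow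
    -- satisfies `separates` vacuously.
    record Separated (ρ : Half → ℕ) (i : Fin m) : Set where
      field
        χ         : Fin n → Bool
        closed    : ∀ h → ρ h ≡ 2 → χ (tl h) ≡ true → χ (hd h) ≡ true
        separates : ∀ b → ρ (i , b) ≡ 2 → χ (tl (i , b)) ≡ false × χ (hd (i , b)) ≡ true

    Acyclic : (Half → ℕ) → Set
    Acyclic ρ = ∀ i → Separated ρ i

    Same : (Half → ℕ) → (Half → ℕ) → Set
    Same ρ ρ′ = Balanced ρ′ × (∀ χ → outflow ρ′ χ ≡ outflow ρ χ)

    twin≡0 : ∀ {ρ} → Balanced ρ → ∀ h → ρ h ≡ 2 → ρ (tw h) ≡ 0
    twin≡0 {ρ} bal h eq = +-cancelˡ-≡ 2 _ 0 (trans (cong (_+ ρ (tw h)) (sym eq)) (balanced-twin {ρ} bal h))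

    carrying-2 : ∀ {ρ} → Balanced ρ → ∀ i b → ρ (i , b) ≡ 2 → carrying ρ i ≡ true
    carrying-2 {ρ} bal i false eq rewrite eq = refl
    carrying-2 {ρ} bal i true  eq rewrite twin≡0 {ρ} bal (i , true) eq = refl

    carrying-1 : ∀ {ρ} i b → ρ (i , b) ≡ 1 → Balanced ρ → carrying ρ i ≡ false
    carrying-1 {ρ} i false eq bal rewrite eq = refl
    carrying-1 {ρ} i true  eq bal rewrite +-cancelʳ-≡ 1 _ 1 (trans (cong (ρ (i , false) +_) (sym eq)) (bal i)) = refl

    -- A return path from the head of `h` to its tail closes a cycle of arcs with residual capacity
    -- 2. Pushing one unit around it brings each of them to 1, so these edges stop carrying flow.
    -- Edge `i` is barred from the path because `h` itself completes the cycle.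
    cancel : ∀ {ρ} → Balanced ρ → ∀ h → ρ h ≡ 2 → (∃[ ρ′ ] Same ρ ρ′ × support ρ′ < support ρ) ⊎ Separated ρ (proj₁ h)
    cancel {ρ} bal h@(i , b) h≡2 with send {ok = λ h′ → ρ h′ ≡ 2 × proj₁ h′ ≢ i} (λ h′ → (ρ h′ ≟ 2) ×-dec ¬? (proj₁ h′ ≟ᶠ i))
                                      (λ h′ (e , _) → subst (0 <_) (sym e) z<s) (hd h) (tl h)
    ... | inj₁ (χ , h∈ , t∉ , closed) = inj₂ (record { χ = χ ; closed = closed′ ; separates = separates })
      where
      separates : ∀ c → ρ (i , c) ≡ 2 → χ (tl (i , c)) ≡ false × χ (hd (i , c)) ≡ true
      separates c e with c ≟ᵇ b
      ... | yes refl = t∉ , h∈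
      ... | no ne with () ← trans (sym (twin≡0 {ρ} bal h h≡2)) (trans (cong (λ c → ρ (i , c)) (≢⇒not ne)) e)
      closed′ : ∀ h′ → ρ h′ ≡ 2 → χ (tl h′) ≡ true → χ (hd h′) ≡ true
      closed′ h′@(j , c) e t∈ with j ≟ᶠ i
      ... | no ne = closed h′ (e , ne) t∈
      ... | yes refl = proj₂ (separates c e)
    ... | inj₂ S = inj₁ (push ρ′ h , (balanced′ , same-outflow) , sum-mono-< i fewer strictly)
      where
      open Sent S
      at-i : ∀ c → ρ′ (i , c) ≡ ρ (i , c)
      at-i c with change i
      ... | same eq = eq c
      ... | pushed _ (_ , ne) _ _ = ⊥-elim (ne refl)
      positive′ : 0 < ρ′ h
      positive′ = subst (0 <_) (sym (trans (at-i b) h≡2)) z<s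
      change-h : ∀ j → Change (λ _ → ℕ) ρ′ (push ρ′ h) j
      change-h j with j ≟ᶠ i
      ... | yes refl = pushed b 0 (trans (cong suc (push-here ρ′ h)) (m+[n∸m]≡n positive′)) (push-twin ρ′ h)
      ... | no ne    = same (λ c → push-else ρ′ h j c ne)
      balanced₁ : Balanced ρ′
      balanced₁ = change-balanced bal change
      balanced′ : Balanced (push ρ′ h)
      balanced′ = change-balanced balanced₁ change-h
      same-outflow : ∀ χ → outflow (push ρ′ h) χ ≡ outflow ρ χ
      same-outflow χ = +-cancelʳ-≡ (bit (χ (tl h)) + bit (χ (hd h))) _ _ (begin
        outflow (push ρ′ h) χ + (bit (χ (tl h)) + bit (χ (hd h)))   ≡⟨ +-assoc (outflow (push ρ′ h) χ) _ _ ⟨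
        outflow (push ρ′ h) χ + bit (χ (tl h)) + bit (χ (hd h))     ≡⟨ cong (_+ bit (χ (hd h))) (outflow-pushed ρ′ h positive′ χ) ⟩
        outflow ρ′ χ + bit (χ (hd h)) + bit (χ (hd h))              ≡⟨ cong (_+ bit (χ (hd h))) (conserved χ) ⟩
        outflow ρ χ + bit (χ (tl h)) + bit (χ (hd h))               ≡⟨ +-assoc (outflow ρ χ) _ _ ⟩
        outflow ρ χ + (bit (χ (tl h)) + bit (χ (hd h)))             ∎)
        where open ≡-Reasoning
      reset : ∀ j c → ρ (j , c) ≡ 2 → suc (push ρ′ h (j , c)) ≡ ρ (j , c) → carrying (push ρ′ h) j ≡ false
      reset j c e d = carrying-1 {push ρ′ h} j c (suc-injective (trans d e)) balanced′
      strictly : bit (carrying (push ρ′ h) i) < bit (carrying ρ i)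
      strictly rewrite carrying-2 {ρ} bal i b h≡2
        | reset i b h≡2 (trans (cong suc (push-here ρ′ h)) (trans (m+[n∸m]≡n positive′) (at-i b))) = ≤-refl
      fewer : ∀ j → bit (carrying (push ρ′ h) j) ≤ bit (carrying ρ j)
      fewer j with j ≟ᶠ i
      ... | yes refl = <⇒≤ strictly
      ... | no ne with change j
      ...   | same eq = ≤-reflexive (cong (λ z → bit (not (does (z ≟ 1)))) (trans (push-else ρ′ h j false ne) (eq false)))
      ...   | pushed c (e , _) d _ rewrite reset j c e (trans (cong suc (push-else ρ′ h j c ne)) d) = z≤n

    separate-or-cancel : ∀ {ρ} → Balanced ρ → ∀ i → (∃[ ρ′ ] Same ρ ρ′ × support ρ′ < support ρ) ⊎ Separated ρ i
    separate-or-cancel {ρ} bal i with ρ (i , false) ≟ 2 | ρ (i , true) ≟ 2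
    ... | yes e | _     = cancel bal (i , false) e
    ... | no _  | yes e = cancel bal (i , true) e
    ... | no a  | no b  = inj₂ (record { χ = λ _ → false ; closed = λ _ _ () ; separates = λ { false e → ⊥-elim (a e) ; true e → ⊥-elim (b e) } })

    make-acyclic : ∀ fuel ρ → support ρ < fuel → Balanced ρ → ∃[ ρ′ ] Same ρ ρ′ × Acyclic ρ′
    make-acyclic (suc fuel) ρ small bal with finite-choice (separate-or-cancel bal)
    ... | inj₂ sep = ρ , (bal , λ _ → refl) , sep
    ... | inj₁ (ρ₁ , (bal₁ , same₁) , fewer) with make-acyclic fuel ρ₁ (<-≤-trans fewer (s≤s⁻¹ small)) bal₁
    ...   | ρ₂ , (bal₂ , same₂) , sep = ρ₂ , (bal₂ , λ χ → trans (same₂ χ) (same₁ χ)) , sep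

    AcyclicMaximum : Set
    AcyclicMaximum = ∃[ k ] ∃[ ρ ] Flow k ρ × Acyclic ρ × Σ[ χ ∈ (Fin n → Bool) ] χ s ≡ true × χ t ≡ false × outflow ρ χ ≡ 0

    acyclic-maximum : AcyclicMaximum
    acyclic-maximum with maximum
    ... | k , ρ , F , χ , s∈ , t∉ , zero-out with make-acyclic (suc (support ρ)) ρ ≤-refl (Flow.balanced F)
    ...   | ρ′ , (bal , eq) , acyclic = k , ρ′ , record { balanced = bal ; net = λ χ → trans (cong (_+ k * bit (χ s)) (eq χ)) (Flow.net F χ) }
            , acyclic , χ , s∈ , t∉ , trans (eq χ) zero-out

does-true : ∀ {A : Set} (d : Dec A) → does d ≡ true → A
does-true (yes a) _ = a

∧-true : ∀ {a b} → a ∧ b ≡ true → a ≡ true × b ≡ true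
∧-true {true} e = refl , e

-- The number of edges that carry flow

sum-at-most-one : ∀ {m} (Q : Fin m → Bool) → (∀ i j → Q i ≡ true → Q j ≡ true → i ≡ j) → sum (λ i → bit (Q i)) ≤ 1
sum-at-most-one {zero} Q one = z≤n
sum-at-most-one {suc m} Q one with Q zero in q₀
... | false = sum-at-most-one (Q ∘ suc) (λ i j p q → suc-injectiveᶠ (one (suc i) (suc j) p q))
... | true  = s≤s (≤-reflexive (sum-≡0 others))
  where
  others : ∀ i → bit (Q (suc i)) ≡ 0
  others i with Q (suc i) in q
  ... | false = refl
  ... | true with () ← one zero (suc i) q₀ q

-- Double counting over the code values: each counted index is charged to its code, and each code is
-- charged at most once.
count-injective : ∀ {m} N (P : Fin m → Bool) (code : Fin m → ℕ) → (∀ i → P i ≡ true → code i < N) →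
  (∀ i j → P i ≡ true → P j ≡ true → code i ≡ code j → i ≡ j) → sum (λ i → bit (P i)) ≤ N
count-injective {m} N P code code< inj = begin
  sum (λ i → bit (P i))                            ≤⟨ sum-mono hits ⟩
  sum (λ i → sum {N} (λ c → bit (Q c i)))          ≡⟨ ∑-comm {m} {N} (λ i c → bit (Q c i)) ⟩
  sum {N} (λ c → sum (λ i → bit (Q c i)))          ≤⟨ sum-mono {N} (λ c → sum-at-most-one (Q c) (unique c)) ⟩
  sum {N} (λ c → 1)                                ≡⟨ sum-const N 1 ⟩
  N * 1                                            ≡⟨ *-identityʳ N ⟩
  N                                                ∎
  where
  open ≤-Reasoning
  Q : Fin N → Fin m → Bool
  Q c i = P i ∧ does (code i ≟ toℕ c)
  hits : ∀ i → bit (P i) ≤ sum {N} (λ c → bit (Q c i))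
  hits i with P i in p
  ... | false = z≤n
  ... | true  = ≤-trans (≤-reflexive (cong bit (sym (dec-true (code i ≟ toℕ c) (sym (toℕ-fromℕ< (code< i p)))))))
                  (sum-≤-at (λ c → bit (does (code i ≟ toℕ c))) c)
    where c = fromℕ< (code< i p)
  split : ∀ c i → Q c i ≡ true → P i ≡ true × code i ≡ toℕ c
  split c i q = proj₁ (∧-true q) , does-true (code i ≟ toℕ c) (proj₂ (∧-true {P i} q))
  unique : ∀ c i j → Q c i ≡ true → Q c j ≡ true → i ≡ j
  unique c i j p q with split c i p | split c j q
  ... | pi , ci | pj , cj = inj i j pi pj (trans ci (sym cj))

-- Positions from ranks

module Positions {n : ℕ} (rank : Fin n → ℕ) where

  -- Ties in rank are broken by the vertex number. Counting smaller keys then compresses the keys to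
  -- distinct positions below `n` without disturbing the order of ranks.
  key : Fin n → ℕ
  key v = rank v * n + toℕ v

  key-rank : ∀ {u v} → rank u < rank v → key u < key v
  key-rank {u} {v} lt = begin-strict
    rank u * n + toℕ u   <⟨ +-monoʳ-< (rank u * n) (toℕ<n u) ⟩
    rank u * n + n       ≡⟨ +-comm _ n ⟩
    suc (rank u) * n     ≤⟨ *-monoˡ-≤ n lt ⟩
    rank v * n           ≤⟨ m≤m+n _ _ ⟩
    rank v * n + toℕ v   ∎
    where open ≤-Reasoning

  key-injective : ∀ {u v} → key u ≡ key v → u ≡ v
  key-injective {u} {v} eq with <-cmp (rank u) (rank v)
  ... | tri< lt _ _ = ⊥-elim (<⇒≢ (key-rank lt) eq)
  ... | tri> _ _ gt = ⊥-elim (<⇒≢ (key-rank gt) (sym eq))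
  ... | tri≈ _ e _  = toℕ-injective (+-cancelˡ-≡ (rank u * n) _ _ (trans eq (cong (λ z → z * n + toℕ v) (sym e))))

  abstract

    pos : Fin n → ℕ
    pos v = sum (λ u → bit (key u <ᵇ key v))

    pos-key : ∀ {u v} → key u < key v → pos u < pos v
    pos-key {u} {v} lt = sum-mono-< u mono (subst₂ _<_ (cong bit (sym (<ᵇ-false {key u} (<-irrefl refl)))) (cong bit (sym (<ᵇ-true lt))) z<s)
      where
      mono : ∀ z → bit (key z <ᵇ key u) ≤ bit (key z <ᵇ key v)
      mono z with key z <? key u
      ... | yes p = ≤-reflexive (cong bit (trans (<ᵇ-true p) (sym (<ᵇ-true (<-trans p lt)))))
      ... | no ¬p = subst (_≤ bit (key z <ᵇ key v)) (cong bit (sym (<ᵇ-false ¬p))) z≤n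

    pos<n : ∀ v → pos v < n
    pos<n v = subst (pos v <_) (trans (sum-const n 1) (*-identityʳ n))
      (sum-mono-< v (λ z → bit≤1 (key z <ᵇ key v)) (subst (_< 1) (cong bit (sym (<ᵇ-false {key v} (<-irrefl refl)))) z<s))

  pos-rank : ∀ {u v} → rank u < rank v → pos u < pos v
  pos-rank = pos-key ∘ key-rank

  pos-injective : ∀ {u v} → pos u ≡ pos v → u ≡ v
  pos-injective {u} {v} eq with <-cmp (key u) (key v)
  ... | tri< lt _ _ = ⊥-elim (<⇒≢ (pos-key lt) eq)
  ... | tri≈ _ e _  = key-injective e
  ... | tri> _ _ gt = ⊥-elim (<⇒≢ (pos-key gt) (sym eq))

module Sparsity {n m : ℕ} (ed : Fin m → Edge n) (distinct : ∀ i j → ed i ∥ ed j → i ≡ j)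
  (s t : Fin n) (s≢t : s ≢ t) where

  x y : Fin m → Fin n
  x i = end₁ (ed i)
  y i = end₂ (ed i)

  open Network x y
  open Flows x y
  open MaxFlow s t s≢t

  unit-leaving : ∀ χ i → leavingAt unit χ i ≡ bit (crosses χ (ed i))
  unit-leaving χ i with χ (x i) | χ (y i)
  ... | true  | true  = refl
  ... | true  | false = refl
  ... | false | true  = refl
  ... | false | false = refl

  outflow-unit : ∀ χ → outflow unit χ ≡ sum (λ i → bit (crosses χ (ed i)))
  outflow-unit χ = sum-cong-≗ (unit-leaving χ)

  -- In a simple graph an edge at the source is determined by its other end, and this end is the
  -- code.
  source-degree : outflow unit is-s ≤ n
  source-degree = subst (_≤ n) (sym (outflow-unit is-s))
    (count-injective n (λ i → crosses is-s (ed i)) code code<n inj)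
    where
    code : Fin m → ℕ
    code i = if does (x i ≟ᶠ s) then toℕ (y i) else toℕ (x i)
    code<n : ∀ i → crosses is-s (ed i) ≡ true → code i < n
    code<n i _ with does (x i ≟ᶠ s)
    ... | true  = toℕ<n (y i)
    ... | false = toℕ<n (x i)
    inj : ∀ i j → crosses is-s (ed i) ≡ true → crosses is-s (ed j) ≡ true → code i ≡ code j → i ≡ j
    inj i j p q eq with x i ≟ᶠ s | y i ≟ᶠ s | x j ≟ᶠ s | y j ≟ᶠ s
    ... | yes xi | no _   | yes xj | no _   = distinct i j (inj₁ (trans xi (sym xj) , toℕ-injective eq))
    ... | yes xi | no _   | no _   | yes yj = distinct i j (inj₂ (trans xi (sym yj) , toℕ-injective eq))
    ... | no _   | yes yi | yes xj | no _   = distinct i j (inj₂ (toℕ-injective eq , trans yi (sym xj)))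
    ... | no _   | yes yi | no _   | yes yj = distinct i j (inj₁ (toℕ-injective eq , trans yi (sym yj)))

  module _ {k : ℕ} {ρ : Half → ℕ} (F : Flow k ρ) (acyclic : Acyclic ρ) where

    open Flow F

    -- A topological order obtained from the certificates: each separating set is closed under arcs
    -- of residual capacity 2, so its indicator does not drop along them, and the set of the arc's
    -- own edge gains the head. Positions thus grow against the flow, from sink side to source side.
    rank : Fin n → ℕ
    rank v = sum (λ i → bit (Separated.χ (acyclic i) v))

    rank-arc : ∀ h → ρ h ≡ 2 → rank (tl h) < rank (hd h)
    rank-arc h@(i , b) e = sum-mono-< i mono strict
      where
      mono : ∀ j → bit (Separated.χ (acyclic j) (tl h)) ≤ bit (Separated.χ (acyclic j) (hd h))
      mono j with Separated.χ (acyclic j) (tl h) in t∈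
      ... | false = z≤n
      ... | true rewrite Separated.closed (acyclic j) h e t∈ = ≤-refl
      strict : bit (Separated.χ (acyclic i) (tl h)) < bit (Separated.χ (acyclic i) (hd h))
      strict rewrite proj₁ (Separated.separates (acyclic i) b e) | proj₂ (Separated.separates (acyclic i) b e) = ≤-refl

    open Positions rank

    arc-of : ∀ i → carrying ρ i ≡ true → ∃[ b ] ρ (i , b) ≡ 2
    arc-of i c with ρ (i , false) in e₀ | balanced i
    ... | 0           | bal = true , trans (sym (cong (_+ ρ (i , true)) refl)) bal
    ... | 1           | bal with () ← c
    ... | 2           | bal = false , e₀
    ... | suc (suc (suc _)) | ()

    not-carrying : ∀ i → carrying ρ i ≡ false → ∀ b → ρ (i , b) ≡ 1
    not-carrying i c = λ { false → one ; true → +-cancelˡ-≡ 1 _ 1 (trans (cong (_+ ρ (i , true)) (sym one)) (balanced i)) }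
      where
      one : ρ (i , false) ≡ 1
      one = does-true (ρ (i , false) ≟ 1) (trans (sym (not-involutive _)) (cong not c))

    below : ℕ → Fin n → Bool
    below c v = pos v <ᵇ c

    forward : ∀ c h → ρ h ≡ 2 → below c (hd h) ≡ true → below c (tl h) ≡ true
    forward c h e h∈ with pos (hd h) <? c
    ... | yes p = <ᵇ-true (<-trans (pos-rank (rank-arc h e)) p)
    ... | no ¬p with () ← trans (sym h∈) (<ᵇ-false ¬p)

    crossing : ℕ → Fin m → Bool
    crossing c i = carrying ρ i ∧ crosses (below c) (ed i)

    -- Arcs of residual capacity 2 increase positions, so a flow edge that crosses a prefix leaves
    -- it with residual capacity 2 instead of 1, never 0. The excess over the zero flow therefore
    -- counts the crossing flow edges.
    leaving-below : ∀ c i → leavingAt ρ (below c) i ≡ leavingAt unit (below c) i + bit (crossing c i)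
    leaving-below c i with carrying ρ i in ci
    ... | false = trans (leaving-cong (below c (x i)) (below c (y i)) (not-carrying i ci)) (sym (+-identityʳ _))
    ... | true  = go (arc-of i ci)
      where
      go : ∃[ b ] ρ (i , b) ≡ 2 → leavingAt ρ (below c) i ≡ leavingAt unit (below c) i + bit (crosses (below c) (ed i))
      go (false , e) with below c (x i) in bx | below c (y i) in by
      ... | true  | true  = refl
      ... | true  | false = e
      ... | false | false = refl
      ... | false | true with () ← trans (sym bx) (forward c (i , false) e by)
      go (true , e) with below c (x i) in bx | below c (y i) in by
      ... | true  | true  = refl
      ... | false | true  = e
      ... | false | false = refl
      ... | true  | false with () ← trans (sym by) (forward c (i , true) e bx)

    -- In the conservation identity for a prefix the zero-flow terms cancel, leaving crossings plus
    -- `k` at the source equal to `k` at the sink.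
    crossing-few : ∀ c → sum (λ i → bit (crossing c i)) ≤ k
    crossing-few c = begin
      X                                    ≤⟨ m≤m+n X _ ⟩
      X + k * bit (below c s)              ≡⟨ +-cancelˡ-≡ (outflow unit (below c)) _ _ (trans (sym (+-assoc (outflow unit (below c)) X _))
                                                (trans (cong (_+ k * bit (below c s)) (sym total)) (net (below c)))) ⟩
      k * bit (below c t)                  ≤⟨ *-monoʳ-≤ k (bit≤1 (below c t)) ⟩
      k * 1                                ≡⟨ *-identityʳ k ⟩
      k                                    ∎
      where
      open ≤-Reasoning
      X = sum (λ i → bit (crossing c i))
      total : outflow ρ (below c) ≡ outflow unit (below c) + X
      total = trans (sum-cong-≗ (leaving-below c)) (∑-distrib-+ (leavingAt unit (below c)) (λ i → bit (crossing c i)))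

    -- Cut the flow order into blocks of length L: an edge inside a block is determined by its first
    -- end and the offset of its second, and any other edge crosses one of the L block boundaries.

    module _ (L : ℕ) .{{_ : NonZero L}} (n≤L² : n ≤ L * L) where

      inside : Fin m → Bool
      inside i = does (pos (x i) / L ≟ pos (y i) / L)

      inside-few : sum (λ i → bit (inside i)) ≤ n * L
      inside-few = count-injective (n * L) inside code code< inj
        where
        code : Fin m → ℕ
        code i = pos (x i) * L + pos (y i) % L
        code< : ∀ i → inside i ≡ true → code i < n * L
        code< i _ = begin-strict
          pos (x i) * L + pos (y i) % L   <⟨ +-monoʳ-< (pos (x i) * L) (m%n<n (pos (y i)) L) ⟩
          pos (x i) * L + L               ≡⟨ +-comm _ L ⟩
          suc (pos (x i)) * L             ≤⟨ *-monoˡ-≤ L (pos<n (x i)) ⟩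
          n * L                           ∎
          where open ≤-Reasoning
        quotient : ∀ a b → b < L → (a * L + b) / L ≡ a
        quotient a b b<L = trans (cong (_/ L) (+-comm (a * L) b)) (trans (+-distrib-/ b (a * L) rem) (cong₂ _+_ (m<n⇒m/n≡0 b<L) (m*n/n≡m a L)))
          where
          rem : b % L + a * L % L < L
          rem = subst (_< L) (sym (trans (cong₂ _+_ (m<n⇒m%n≡m b<L) (m*n%n≡0 a L)) (+-identityʳ b))) b<L
        inj : ∀ i j → inside i ≡ true → inside j ≡ true → code i ≡ code j → i ≡ j
        inj i j p q eq = distinct i j (inj₁ (pos-injective px , pos-injective py))
          where
          bi = does-true (pos (x i) / L ≟ pos (y i) / L) p
          bj = does-true (pos (x j) / L ≟ pos (y j) / L) q
          px : pos (x i) ≡ pos (x j)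
          px = trans (sym (quotient (pos (x i)) _ (m%n<n (pos (y i)) L))) (trans (cong (_/ L) eq) (quotient (pos (x j)) _ (m%n<n (pos (y j)) L)))
          py : pos (y i) ≡ pos (y j)
          py = begin
            pos (y i)                              ≡⟨ m≡m%n+[m/n]*n (pos (y i)) L ⟩
            pos (y i) % L + pos (y i) / L * L      ≡⟨ cong₂ (λ a b → a + b * L) rest (trans (sym bi) (trans (cong (_/ L) px) bj)) ⟩
            pos (y j) % L + pos (y j) / L * L      ≡⟨ m≡m%n+[m/n]*n (pos (y j)) L ⟨
            pos (y j)                              ∎
            where
            open ≡-Reasoning
            rest : pos (y i) % L ≡ pos (y j) % L
            rest = +-cancelˡ-≡ (pos (x i) * L) _ _ (trans eq (cong (λ z → z * L + pos (y j) % L) (sym px)))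

      -- The boundary is the start of the block of the head; its index is below `L` because
      -- positions are below `n` and `n` is at most `L * L`.
      boundary : ∀ h → ρ h ≡ 2 → pos (x (proj₁ h)) / L ≢ pos (y (proj₁ h)) / L →
        ∃[ c ] below (toℕ {L} c * L) (tl h) ≡ true × below (toℕ c * L) (hd h) ≡ false
      boundary h@(i , b) e ne = c , subst (λ z → below (z * L) (tl h) ≡ true) (sym at) (<ᵇ-true tl<)
                                  , subst (λ z → below (z * L) (hd h) ≡ false) (sym at) (<ᵇ-false (≤⇒≯ (m/n*n≤m (pos (hd h)) L)))
        where
        c< : pos (hd h) / L < L
        c< = m<n*o⇒m/o<n (<-≤-trans (pos<n (hd h)) n≤L²)
        c = fromℕ< c<
        at : toℕ c ≡ pos (hd h) / L
        at = toℕ-fromℕ< c<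
        end-in : ∀ b → pos (x i) / L ≢ pos (y i) / L → pos (tl (i , b)) / L ≢ pos (hd (i , b)) / L
        end-in false ne = ne
        end-in true  ne = ne ∘ sym
        lt : pos (tl h) / L < pos (hd h) / L
        lt = ≤∧≢⇒< (/-monoˡ-≤ L (<⇒≤ (pos-rank (rank-arc h e)))) (end-in b ne)
        tl< : pos (tl h) < pos (hd h) / L * L
        tl< = begin-strict
          pos (tl h)                             ≡⟨ m≡m%n+[m/n]*n (pos (tl h)) L ⟩
          pos (tl h) % L + pos (tl h) / L * L    <⟨ +-monoˡ-< _ (m%n<n (pos (tl h)) L) ⟩
          suc (pos (tl h) / L) * L               ≤⟨ *-monoˡ-≤ L lt ⟩
          pos (hd h) / L * L                     ∎
          where open ≤-Reasoning

      inside-or-crossing : ∀ i → bit (carrying ρ i) ≤ bit (inside i) + sum {L} (λ c → bit (crossing (toℕ c * L) i))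
      inside-or-crossing i = go (inside i) refl (carrying ρ i) refl
        where
        go : ∀ a → inside i ≡ a → ∀ b → carrying ρ i ≡ b → bit b ≤ bit a + sum {L} (λ c → bit (crossing (toℕ c * L) i))
        go true  _  b     _  = ≤-trans (bit≤1 b) (s≤s z≤n)
        go false _  false _  = z≤n
        go false in≡ true ci = crosses-some (arc-of i ci)
          where
          apart : pos (x i) / L ≢ pos (y i) / L
          apart e with () ← trans (sym in≡) (dec-true (pos (x i) / L ≟ pos (y i) / L) e)
          crosses-some : ∃[ b ] ρ (i , b) ≡ 2 → 1 ≤ sum {L} (λ c → bit (crossing (toℕ c * L) i))
          crosses-some (b , e) with boundary (i , b) e apart
          ... | c , t∈ , h∉ = ≤-trans (≤-reflexive (cong bit (sym (cong₂ _∧_ ci (crossed b t∈ h∉))))) (sum-≤-at (λ c → bit (crossing (toℕ c * L) i)) c)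
            where
            crossed : ∀ b → below (toℕ c * L) (tl (i , b)) ≡ true → below (toℕ c * L) (hd (i , b)) ≡ false → crosses (below (toℕ c * L)) (ed i) ≡ true
            crossed false p q rewrite p | q = refl
            crossed true  p q rewrite p | q = refl

      support-few : support ρ ≤ n * L + L * n
      support-few = begin
        support ρ                                                                          ≤⟨ sum-mono inside-or-crossing ⟩
        sum (λ i → bit (inside i) + sum {L} (λ c → bit (crossing (toℕ c * L) i)))          ≡⟨ ∑-distrib-+ (λ i → bit (inside i)) _ ⟩
        sum (λ i → bit (inside i)) + sum (λ i → sum {L} (λ c → bit (crossing (toℕ c * L) i))) ≡⟨ cong (sum (λ i → bit (inside i)) +_) (∑-comm {m} {L} (λ i c → bit (crossing (toℕ c * L) i))) ⟩
        sum (λ i → bit (inside i)) + sum {L} (λ c → sum (λ i → bit (crossing (toℕ c * L) i))) ≤⟨ +-mono-≤ inside-few (sum-mono {L} (λ c → ≤-trans (crossing-few (toℕ c * L)) (≤-trans (value≤ F) source-degree))) ⟩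
        n * L + sum {L} (λ _ → n)                                                          ≡⟨ cong (n * L +_) (sum-const L n) ⟩
        n * L + L * n                                                                      ∎
        where open ≤-Reasoning

-- The stored subgraph

total : ∀ {A : Set} → (A → ℕ) → List A → ℕ
total f xs = List.sum (map f xs)

total-++ : ∀ {A : Set} (f : A → ℕ) xs ys → total f (xs ++ ys) ≡ total f xs + total f ys
total-++ f xs ys = trans (cong List.sum (map-++ f xs ys)) (sum-++ (map f xs) (map f ys))

total-↭ : ∀ {A : Set} (f : A → ℕ) {xs ys} → xs ↭ ys → total f xs ≡ total f ys
total-↭ f p = sum-↭ (map⁺ f p)

total-tabulate : ∀ {A : Set} (f : A → ℕ) {m} (g : Fin m → A) → sum (λ i → f (g i)) ≡ total f (tabulate g)
total-tabulate f {zero}  g = refl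
total-tabulate f {suc m} g = cong (f (g zero) +_) (total-tabulate f (g ∘ suc))

total-lookup : ∀ {A : Set} (f : A → ℕ) xs → sum (λ i → f (lookup xs i)) ≡ total f xs
total-lookup f xs = trans (total-tabulate f (lookup xs)) (cong (total f) (tabulate-lookup xs))

total-bit : ∀ {A : Set} (p : A → Bool) xs → total (λ a → bit (p a)) xs ≡ length (filterᵇ p xs)
total-bit p [] = refl
total-bit p (a ∷ xs) with p a
... | true  = cong suc (total-bit p xs)
... | false = total-bit p xs

filterᵇ-partition : ∀ {A : Set} (p : A → Bool) xs → xs ↭ filterᵇ p xs ++ filterᵇ (λ a → not (p a)) xs
filterᵇ-partition p [] = ↭-refl
filterᵇ-partition p (a ∷ xs) with p a
... | true  = ↭-prep a (filterᵇ-partition p xs)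
... | false = ↭-trans (↭-prep a (filterᵇ-partition p xs)) (↭-sym (↭-shift a (filterᵇ p xs) _))

cut : ∀ {n} → (Fin n → Bool) → List (Edge n) → ℕ
cut χ = total (λ e → bit (crosses χ e))

-- Spanning forests

module Forests {n : ℕ} where

  -- `comp` picks a representative of each component, as in union-find. A tree edge is added exactly
  -- when it merges two components and destroys one representative, so tree edges plus
  -- representatives never exceed `n`.
  record Components (L : List (Edge n)) : Set where
    field
      tree rest : List (Edge n)
      comp      : Fin n → Fin n
      split     : L ↭ tree ++ rest
      idem      : ∀ v → comp (comp v) ≡ comp v
      few       : length tree + sum (λ v → bit (does (comp v ≟ᶠ v))) ≤ n
      respects  : ∀ χ → cut χ tree ≡ 0 → ∀ v → χ (comp v) ≡ χ v
      joined    : All (λ e → comp (end₁ e) ≡ comp (end₂ e)) rest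

  components : ∀ L → Components L
  components [] = record
    { tree = [] ; rest = [] ; comp = id ; split = ↭-refl ; idem = λ _ → refl
    ; few = ≤-trans (≤-reflexive (sum-cong-≗ {n} (λ v → cong bit (dec-true (v ≟ᶠ v) refl)))) (≤-reflexive (trans (sum-const n 1) (*-identityʳ n)))
    ; respects = λ _ _ _ → refl ; joined = [] }
  components (e ∷ L) with components L
  ... | C with Components.comp C (end₁ e) ≟ᶠ Components.comp C (end₂ e)
  ...   | yes eq = record { tree = tree ; rest = e ∷ rest ; comp = comp ; split = ↭-trans (↭-prep e split) (↭-sym (↭-shift e tree rest))
          ; idem = idem ; few = few ; respects = respects ; joined = eq ∷ joined }
    where open Components C
  ...   | no ne = record { tree = e ∷ tree ; rest = rest ; comp = comp′ ; split = ↭-prep e split ; idem = idem′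
          ; few = ≤-trans (≤-reflexive (sym (+-suc (length tree) _))) (≤-trans (+-monoʳ-≤ (length tree) fewer) few)
          ; respects = respects′ ; joined = All.map (λ eq → cong redirect eq) joined }
    where
    open Components C
    a = end₁ e
    b = end₂ e
    redirect : Fin n → Fin n
    redirect c = if does (c ≟ᶠ comp a) then comp b else c
    comp′ : Fin n → Fin n
    comp′ v = redirect (comp v)
    redirect-≢ : ∀ {c} → c ≢ comp a → redirect c ≡ c
    redirect-≢ {c} c≢ rewrite dec-false (c ≟ᶠ comp a) c≢ = refl
    redirect-≡ : ∀ {c} → c ≡ comp a → redirect c ≡ comp b
    redirect-≡ {c} c≡ rewrite dec-true (c ≟ᶠ comp a) c≡ = refl
    idem′ : ∀ v → comp′ (comp′ v) ≡ comp′ v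
    idem′ v = go (comp v ≟ᶠ comp a)
      where
      go : Dec (comp v ≡ comp a) → comp′ (comp′ v) ≡ comp′ v
      go (yes c≡) rewrite redirect-≡ c≡ = trans (cong redirect (idem b)) (redirect-≢ (≢-sym ne))
      go (no c≢)  rewrite redirect-≢ c≢ = trans (cong redirect (idem v)) (redirect-≢ c≢)
    root-kept : ∀ v → comp′ v ≡ v → comp v ≡ v
    root-kept v r = go (comp v ≟ᶠ comp a)
      where
      go : Dec (comp v ≡ comp a) → comp v ≡ v
      go (no c≢)  = trans (sym (redirect-≢ c≢)) r
      go (yes c≡) = ⊥-elim (ne (trans (sym c≡) (trans (cong comp (trans (sym r) (redirect-≡ c≡))) (idem b))))
    fewer : sum (λ v → bit (does (comp′ v ≟ᶠ v))) < sum (λ v → bit (does (comp v ≟ᶠ v)))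
    fewer = sum-mono-< (comp a) mono (subst₂ _<_
        (cong bit (sym (dec-false (comp′ (comp a) ≟ᶠ comp a) (λ r → ne (trans (sym r) (redirect-≡ (idem a)))))))
        (cong bit (sym (dec-true (comp (comp a) ≟ᶠ comp a) (idem a)))) z<s)
      where
      mono : ∀ v → bit (does (comp′ v ≟ᶠ v)) ≤ bit (does (comp v ≟ᶠ v))
      mono v with comp′ v ≟ᶠ v
      ... | no _  = z≤n
      ... | yes r rewrite dec-true (comp v ≟ᶠ v) (root-kept v r) = ≤-refl
    respects′ : ∀ χ → cut χ (e ∷ tree) ≡ 0 → ∀ v → χ (comp′ v) ≡ χ v
    respects′ χ eq v = go (comp v ≟ᶠ comp a)
      where
      old : ∀ v → χ (comp v) ≡ χ v
      old = respects χ (m+n≡0⇒n≡0 (bit (crosses χ e)) eq)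
      same-side : ∀ p q → bit (p xor q) ≡ 0 → p ≡ q
      same-side true  true  _ = refl
      same-side false false _ = refl
      go : Dec (comp v ≡ comp a) → χ (comp′ v) ≡ χ v
      go (no c≢)  = trans (cong χ (redirect-≢ c≢)) (old v)
      go (yes c≡) = trans (cong χ (redirect-≡ c≡)) (trans (old b) (trans (sym (same-side (χ a) (χ b) (m+n≡0⇒m≡0 _ eq)))
        (trans (sym (old a)) (trans (cong χ (sym c≡)) (old v)))))

  record Forest (L : List (Edge n)) : Set where
    field
      tree rest : List (Edge n)
      split     : L ↭ tree ++ rest
      few       : length tree ≤ n
      spans     : ∀ χ → cut χ tree ≡ 0 → cut χ rest ≡ 0

  forest : ∀ L → Forest L
  forest L = record { tree = tree ; rest = rest ; split = split ; few = ≤-trans (m≤m+n _ _) few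
                    ; spans = λ χ eq → uncut χ (respects χ eq) joined }
    where
    open Components (components L)
    uncut : ∀ χ → (∀ v → χ (comp v) ≡ χ v) → ∀ {es} → All (λ e → comp (end₁ e) ≡ comp (end₂ e)) es → cut χ es ≡ 0
    uncut χ r [] = refl
    uncut χ r {e ∷ es} (eq ∷ eqs) = cong₂ _+_ (trans (cong (λ p → bit (p xor χ (end₂ e))) (trans (sym (r _)) (trans (cong χ eq) (r _)))) (cong bit (xor-same (χ (end₂ e))))) (uncut χ r eqs)

open Forests

-- The stored subgraph with its residual capacities: every cut that a query can make minimum
-- leaves at most one residual unit and so is cut by no edge outside the subgraph.

record Sparsifier {n : ℕ} (E : List (Edge n)) (s t : Fin n) : Set where
  field
    M          : ℕ
    ed         : Fin M → Edge n
    r          : Fin M × Bool → ℕ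
    rest       : List (Edge n)
    value      : ℕ
    χ₀         : Fin n → Bool

  open Network (λ i → end₁ (ed i)) (λ i → end₂ (ed i)) using (outflow) public

  field
    split      : E ↭ tabulate ed ++ rest
    r≤2        : ∀ h → r h ≤ 2
    net        : ∀ χ → outflow r χ + value * bit (χ s) ≡ cut χ (tabulate ed) + value * bit (χ t)
    χ₀-source  : χ₀ s ≡ true
    χ₀-sink    : χ₀ t ≡ false
    χ₀-closed  : outflow r χ₀ ≡ 0
    thin       : ∀ χ → outflow r χ ≤ 1 → cut χ rest ≡ 0
    small      : M * M ≤ 64 * (n * n * n)

-- A block length within a factor 2 of the square root. It grows by one only when the next number
-- exceeds the current square, and the factor 4 absorbs the step.
square-root : ∀ n → ∃[ L ] suc n ≤ suc L * suc L × suc L * suc L ≤ 4 * suc n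
square-root zero = 0 , ≤-refl , s≤s z≤n
square-root (suc n) with square-root n
... | L , lo , hi with suc (suc n) ≤? suc L * suc L
...   | yes p = L , p , ≤-trans hi (*-monoʳ-≤ 4 (n≤1+n (suc n)))
...   | no ¬p = suc L , lo′ , hi′
  where
  eq : suc n ≡ suc L * suc L
  eq = ≤-antisym lo (s≤s⁻¹ (≰⇒> ¬p))
  arith : ∀ l → (2 + l) * (2 + l) ≡ suc (suc l * suc l) + (2 * l + 2)
  arith = solve-∀
  lo′ : suc (suc n) ≤ suc (suc L) * suc (suc L)
  lo′ = subst (suc (suc n) ≤_) (sym (arith L)) (≤-trans (s≤s (≤-reflexive eq)) (m≤m+n _ _))
  arith₂ : ∀ l → 4 * suc (suc l * suc l) ≡ (2 + l) * (2 + l) + (3 * l * l + 4 * l + 4)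
  arith₂ = solve-∀
  hi′ : suc (suc L) * suc (suc L) ≤ 4 * suc (suc n)
  hi′ = subst (λ z → suc (suc L) * suc (suc L) ≤ 4 * suc z) (sym eq) (subst (suc (suc L) * suc (suc L) ≤_) (sym (arith₂ L)) (m≤m+n _ _))

module _ {n : ℕ} (E : List (Edge n)) (distinct : ∀ i j → lookup E i ∥ lookup E j → i ≡ j) (s t : Fin n) (s≢t : s ≢ t) where

  open Sparsity (lookup E) distinct s t s≢t
  open Network x y
  open Flows x y
  open MaxFlow s t s≢t

  -- Keeping an edge together with its residual capacities lets both be rearranged by permutations
  -- of one list, although the network indexes capacities by position.
  Arc : Set
  Arc = Edge n × (Bool → ℕ)

  carries : Arc → Bool
  carries (e , f) = not (does (f false ≟ 1))

  leave : (Fin n → Bool) → Arc → ℕ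
  leave χ (e , f) = leaving (χ (end₁ e)) (χ (end₂ e)) f

  plain : Edge n → Arc
  plain e = e , λ _ → 1

  leave-plain : ∀ χ e → leave χ (plain e) ≡ bit (crosses χ e)
  leave-plain χ e with χ (end₁ e) | χ (end₂ e)
  ... | true  | true  = refl
  ... | true  | false = refl
  ... | false | true  = refl
  ... | false | false = refl

  total-plain : ∀ χ es → total (leave χ) (map plain es) ≡ cut χ es
  total-plain χ []       = refl
  total-plain χ (e ∷ es) = cong₂ _+_ (leave-plain χ e) (total-plain χ es)

  sparsifier : Sparsifier E s t
  sparsifier with acyclic-maximum
  ... | k , ρ , F , acyclic , χ₀ , s∈ , t∉ , closed = record
    { M = length H ; ed = λ i → proj₁ (lookup H i) ; r = λ (i , b) → proj₂ (lookup H i) b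
    ; rest = rest₂ ; value = k ; χ₀ = χ₀
    ; split = split-all
    ; r≤2 = λ (i , b) → All.lookup H-≤2 (∈-lookup i) b
    ; net = net-H ; χ₀-source = s∈ ; χ₀-sink = t∉
    ; χ₀-closed = trans (outflow-H χ₀) χ₀-H ; thin = λ χ o≤1 → thin-H χ (subst (_≤ 1) (outflow-H χ) o≤1)
    ; small = small-H n s refl }
    where
    arcs flowing idle : List Arc
    arcs    = tabulate (λ i → lookup E i , λ b → ρ (i , b))
    flowing = filterᵇ carries arcs
    idle    = filterᵇ (λ a → not (carries a)) arcs
    idleEdges = map proj₁ idle
    open Forest (forest idleEdges) renaming (tree to tree₁; rest to rest₁; split to split₁; few to few₁; spans to spans₁)
    open Forest (forest rest₁) renaming (tree to tree₂; rest to rest₂; split to split₂; few to few₂; spans to spans₂)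
    H : List Arc
    H = flowing ++ map plain (tree₁ ++ tree₂)

    Even : Arc → Set
    Even (e , f) = f false + f true ≡ 2

    arcs-even : All Even arcs
    arcs-even = All.tabulate⁺ (Flow.balanced F)

    all-filterᵇ : ∀ {A : Set} {P : A → Set} (p : A → Bool) {xs} → All P xs → All (λ a → p a ≡ true × P a) (filterᵇ p xs)
    all-filterᵇ p [] = []
    all-filterᵇ p {a ∷ xs} (pa ∷ ps) with p a in eq
    ... | true  = (eq , pa) ∷ all-filterᵇ p ps
    ... | false = all-filterᵇ p ps

    idle-total : ∀ χ {as} → All (λ a → not (carries a) ≡ true × Even a) as → total (leave χ) as ≡ cut χ (map proj₁ as)
    idle-total χ [] = refl
    idle-total χ {(e , f) ∷ as} ((i , even) ∷ ps) = cong₂ _+_ (trans (leaving-cong (χ (end₁ e)) (χ (end₂ e)) ones) (leave-plain χ e)) (idle-total χ ps)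
      where
      one : f false ≡ 1
      one = does-true (f false ≟ 1) (trans (sym (not-involutive _)) i)
      ones : ∀ b → f b ≡ 1
      ones false = one
      ones true  = +-cancelˡ-≡ 1 _ 1 (trans (cong (_+ f true) (sym one)) even)

    idle-ok : All (λ a → not (carries a) ≡ true × Even a) idle
    idle-ok = all-filterᵇ (λ a → not (carries a)) arcs-even

    H-≤2 : All (λ a → ∀ b → proj₂ a b ≤ 2) H
    H-≤2 = All.++⁺ (All.map (λ (_ , even) → λ { false → ≤-trans (m≤m+n _ _) (≤-reflexive even) ; true → ≤-trans (m≤n+m _ _) (≤-reflexive even) })
        (all-filterᵇ carries arcs-even)) (All.map⁺ (All.tabulate (λ _ _ → s≤s z≤n)))

    edges-split : E ↭ map proj₁ flowing ++ idleEdges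
    edges-split = ↭-trans (↭-reflexive (sym (trans (map-tabulate (λ i → lookup E i , λ b → ρ (i , b)) proj₁) (tabulate-lookup E))))
      (↭-trans (map⁺ proj₁ (filterᵇ-partition carries arcs)) (↭-reflexive (map-++ proj₁ flowing idle)))

    idle-split : idleEdges ↭ (tree₁ ++ tree₂) ++ rest₂
    idle-split = ↭-trans split₁ (↭-trans (++⁺ˡ tree₁ split₂) (↭-reflexive (sym (++-assoc tree₁ tree₂ rest₂))))

    H-edges : tabulate (λ i → proj₁ (lookup H i)) ≡ map proj₁ flowing ++ (tree₁ ++ tree₂)
    H-edges = trans (sym (map-tabulate (lookup H) proj₁)) (trans (cong (map proj₁) (tabulate-lookup H))
      (trans (map-++ proj₁ flowing _) (cong (map proj₁ flowing ++_) (trans (sym (map-∘ (tree₁ ++ tree₂))) (map-id _)))))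

    split-all : E ↭ tabulate (λ i → proj₁ (lookup H i)) ++ rest₂
    split-all = ↭-trans edges-split (↭-trans (++⁺ˡ (map proj₁ flowing) idle-split)
      (↭-reflexive (trans (sym (++-assoc (map proj₁ flowing) (tree₁ ++ tree₂) rest₂)) (cong (_++ rest₂) (sym H-edges)))))

    module H = Network (λ i → end₁ (proj₁ (lookup H i))) (λ i → end₂ (proj₁ (lookup H i)))

    flow-leave = λ χ → total (leave χ) flowing

    outflow-H : ∀ χ → H.outflow (λ (i , b) → proj₂ (lookup H i) b) χ ≡ flow-leave χ + (cut χ tree₁ + cut χ tree₂)
    outflow-H χ = trans (total-lookup (leave χ) H) (trans (total-++ (leave χ) flowing _)
      (cong (flow-leave χ +_) (trans (total-plain χ (tree₁ ++ tree₂)) (total-++ _ tree₁ tree₂))))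

    outflow-E : ∀ χ → outflow ρ χ ≡ flow-leave χ + cut χ idleEdges
    outflow-E χ = trans (total-tabulate (leave χ) (λ i → lookup E i , λ b → ρ (i , b)))
      (trans (total-↭ (leave χ) (filterᵇ-partition carries arcs)) (trans (total-++ (leave χ) flowing idle) (cong (flow-leave χ +_) (idle-total χ idle-ok))))

    unit-E : ∀ χ → outflow unit χ ≡ cut χ (map proj₁ flowing) + cut χ idleEdges
    unit-E χ = trans (outflow-unit χ) (trans (total-lookup (λ e → bit (crosses χ e)) E)
      (trans (total-↭ (λ e → bit (crosses χ e)) edges-split) (total-++ _ (map proj₁ flowing) idleEdges)))

    cut-H : ∀ χ → cut χ (tabulate (λ i → proj₁ (lookup H i))) ≡ cut χ (map proj₁ flowing) + (cut χ tree₁ + cut χ tree₂)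
    cut-H χ = trans (cong (cut χ) H-edges) (trans (total-++ _ (map proj₁ flowing) _) (cong (cut χ (map proj₁ flowing) +_) (total-++ _ tree₁ tree₂)))

    net-H : ∀ χ → H.outflow _ χ + k * bit (χ s) ≡ cut χ (tabulate (λ i → proj₁ (lookup H i))) + k * bit (χ t)
    net-H χ = begin
      H.outflow _ χ + k * bit (χ s)                            ≡⟨ cong (_+ k * bit (χ s)) (outflow-H χ) ⟩
      flow-leave χ + trees + k * bit (χ s)                     ≡⟨ swap (flow-leave χ) trees _ ⟩
      flow-leave χ + k * bit (χ s) + trees                     ≡⟨ cong (_+ trees) flows ⟩
      cut χ (map proj₁ flowing) + k * bit (χ t) + trees        ≡⟨ swap (cut χ (map proj₁ flowing)) _ trees ⟩
      cut χ (map proj₁ flowing) + trees + k * bit (χ t)        ≡⟨ cong (_+ k * bit (χ t)) (cut-H χ) ⟨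
      cut χ (tabulate (λ i → proj₁ (lookup H i))) + k * bit (χ t) ∎
      where
      open ≡-Reasoning
      trees = cut χ tree₁ + cut χ tree₂
      I = cut χ idleEdges
      swap : ∀ a b c → a + b + c ≡ a + c + b
      swap = solve-∀
      -- Edges without flow add the same amount to the residual outflow and to the capacity, so they
      -- cancel from the conservation identity of the whole graph.
      flows : flow-leave χ + k * bit (χ s) ≡ cut χ (map proj₁ flowing) + k * bit (χ t)
      flows = +-cancelʳ-≡ I _ _ (trans (swap (flow-leave χ) _ I) (trans (cong (_+ k * bit (χ s)) (sym (outflow-E χ)))
        (trans (Flow.net F χ) (trans (cong (_+ k * bit (χ t)) (unit-E χ)) (swap (cut χ (map proj₁ flowing)) I _)))))

    idle-cut : ∀ χ → cut χ idleEdges ≡ cut χ tree₁ + cut χ tree₂ + cut χ rest₂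
    idle-cut χ = trans (total-↭ _ idle-split) (trans (total-++ _ (tree₁ ++ tree₂) rest₂) (cong (_+ cut χ rest₂) (total-++ _ tree₁ tree₂)))

    χ₀-H : flow-leave χ₀ + (cut χ₀ tree₁ + cut χ₀ tree₂) ≡ 0
    χ₀-H = n≤0⇒n≡0 (≤-trans (+-monoʳ-≤ (flow-leave χ₀) (≤-trans (m≤m+n _ (cut χ₀ rest₂)) (≤-reflexive (sym (idle-cut χ₀)))))
      (≤-reflexive (trans (sym (outflow-E χ₀)) closed)))

    -- The second forest consists of edges spanned by the first, so a cut through the second forest
    -- also goes through the first and has outflow at least 2. Below that, the second forest is
    -- uncut and hence so is everything it spans.
    thin-H : ∀ χ → flow-leave χ + (cut χ tree₁ + cut χ tree₂) ≤ 1 → cut χ rest₂ ≡ 0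
    thin-H χ le with cut χ tree₁ in e₁ | cut χ tree₂ in e₂
    ... | _     | zero  = spans₂ χ e₂
    ... | zero  | suc _ with () ← trans (sym e₂) (m+n≡0⇒m≡0 (cut χ tree₂) (trans (sym (total-++ _ tree₂ rest₂)) (trans (sym (total-↭ _ split₂)) (spans₁ χ e₁))))
    ... | suc a | suc b = ⊥-elim (<⇒≱ (s≤s (≤-trans (s≤s z≤n) (≤-reflexive (sym (+-suc a b))))) (≤-trans (m≤n+m _ (flow-leave χ)) le))

    few-H : ∀ L .{{_ : NonZero L}} → n ≤ L * L → length H ≤ n * L + L * n + (n + n)
    few-H L n≤ = ≤-trans (≤-reflexive (trans (length-++ flowing) (cong (length flowing +_) (trans (length-map plain (tree₁ ++ tree₂)) (length-++ tree₁)))))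
      (+-mono-≤ (≤-trans (≤-reflexive (sym (trans (total-tabulate (λ a → bit (carries a)) (λ i → lookup E i , λ b → ρ (i , b))) (total-bit carries arcs))))
        (support-few F acyclic L n≤)) (+-mono-≤ few₁ few₂))

    -- With ℓ near the square root of n, the flow edges number at most 2 n ℓ and the forests at most
    -- 2 n, together at most 4 n ℓ. The argument of type `Fin n′` rules out `n = 0`, where no block
    -- length is available.
    small-H : ∀ n′ → Fin n′ → n ≡ n′ → length H * length H ≤ 64 * (n * n * n)
    small-H (suc n′) _ eq with square-root n′
    ... | L , lo , hi = begin
      length H * length H            ≤⟨ *-mono-≤ H≤ H≤ ⟩
      4 * n * ℓ * (4 * n * ℓ)        ≡⟨ arith₁ n ℓ ⟩
      16 * (n * n) * (ℓ * ℓ)         ≤⟨ *-monoʳ-≤ (16 * (n * n)) (subst (λ z → ℓ * ℓ ≤ 4 * z) (sym eq) hi) ⟩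
      16 * (n * n) * (4 * n)         ≡⟨ arith₂ n ⟩
      64 * (n * n * n)               ∎
      where
      open ≤-Reasoning
      ℓ = suc L
      arith₁ : ∀ n l → 4 * n * l * (4 * n * l) ≡ 16 * (n * n) * (l * l)
      arith₁ = solve-∀
      arith₂ : ∀ n → 16 * (n * n) * (4 * n) ≡ 64 * (n * n * n)
      arith₂ = solve-∀
      arith₃ : ∀ n l → n * l + l * n + (n * l + n * l) ≡ 4 * n * l
      arith₃ = solve-∀
      H≤ : length H ≤ 4 * n * ℓ
      H≤ = ≤-trans (few-H ℓ (subst (_≤ ℓ * ℓ) (sym eq) lo)) (≤-trans (+-monoʳ-≤ (n * ℓ + ℓ * n) (+-mono-≤ (m≤m*n n ℓ) (m≤m*n n ℓ))) (≤-reflexive (arith₃ n ℓ)))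

-- Minimum cuts after a query

∥-sym : ∀ {n} {e f : Edge n} → e ∥ f → f ∥ e
∥-sym (inj₁ (p , q)) = inj₁ (sym p , sym q)
∥-sym (inj₂ (p , q)) = inj₂ (sym q , sym p)

∥-trans : ∀ {n} {e f g : Edge n} → e ∥ f → f ∥ g → e ∥ g
∥-trans (inj₁ (p , q)) (inj₁ (p′ , q′)) = inj₁ (trans p p′ , trans q q′)
∥-trans (inj₁ (p , q)) (inj₂ (p′ , q′)) = inj₂ (trans p p′ , trans q q′)
∥-trans (inj₂ (p , q)) (inj₁ (p′ , q′)) = inj₂ (trans p q′ , trans q p′)
∥-trans (inj₂ (p , q)) (inj₂ (p′ , q′)) = inj₁ (trans p q′ , trans q p′)

∥-refl : ∀ {n} {e : Edge n} → e ∥ e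
∥-refl = inj₁ (refl , refl)

∥-crosses : ∀ {n} χ {e f : Edge n} → e ∥ f → crosses χ e ≡ crosses χ f
∥-crosses χ (inj₁ (p , q)) = cong₂ (λ a b → χ a xor χ b) p q
∥-crosses χ {e} {f} (inj₂ (p , q)) = trans (cong₂ (λ a b → χ a xor χ b) p q) (xor-comm (χ (end₂ f)) (χ (end₁ f)))

lookup-distinct : ∀ {n} {E : List (Edge n)} → AllPairs (λ e f → ¬ (e ∥ f)) E → ∀ i j → lookup E i ∥ lookup E j → i ≡ j
lookup-distinct (ps ∷ qs) zero    zero    _ = refl
lookup-distinct (ps ∷ qs) zero    (suc j) p = ⊥-elim (All.lookup ps (∈-lookup j) p)
lookup-distinct {E = e ∷ E} (ps ∷ qs) (suc i) zero p = ⊥-elim (All.lookup ps (∈-lookup i) (∥-sym {e = lookup E i} {e} p))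
lookup-distinct (ps ∷ qs) (suc i) (suc j) p = cong suc (lookup-distinct qs i j p)

filter≡filterᵇ : ∀ {A : Set} {P : A → Set} (P? : ∀ a → Dec (P a)) {p : A → Bool} → (∀ a → does (P? a) ≡ p a) →
  ∀ xs → filter P? xs ≡ filterᵇ p xs
filter≡filterᵇ P? eq [] = refl
filter≡filterᵇ P? {p} eq (a ∷ xs) with does (P? a) | p a | eq a
... | true  | true  | refl = cong (a ∷_) (filter≡filterᵇ P? eq xs)
... | false | false | refl = filter≡filterᵇ P? eq xs

filterᵇ-cong : ∀ {A : Set} {p q : A → Bool} → (∀ a → p a ≡ q a) → ∀ xs → filterᵇ p xs ≡ filterᵇ q xs
filterᵇ-cong {p = p} eq = filter≡filterᵇ (T? ∘ p) eq

filterᵇ-∧ : ∀ {A : Set} (p q : A → Bool) xs → filterᵇ p (filterᵇ q xs) ≡ filterᵇ (λ a → p a ∧ q a) xs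
filterᵇ-∧ p q [] = refl
filterᵇ-∧ p q (a ∷ xs) with q a | p a in pa
... | false | true  = filterᵇ-∧ p q xs
... | false | false = filterᵇ-∧ p q xs
... | true  | true  rewrite pa = cong (a ∷_) (filterᵇ-∧ p q xs)
... | true  | false rewrite pa = filterᵇ-∧ p q xs

does-∈? : ∀ {n} (v : Fin n) (C : Subset n) → does (v ∈ˢ? C) ≡ Vec.lookup C v
does-∈? v C with Vec.lookup C v in eq
... | true  = dec-true (v ∈ˢ? C) (lookup⇒[]= v C eq)
... | false = dec-false (v ∈ˢ? C) (λ m → case (trans (sym ([]=⇒lookup m)) eq))
  where
  case : true ≢ false
  case ()

∈⇔lookup : ∀ {n} {v : Fin n} {C : Subset n} → (v ∈ˢ C → Vec.lookup C v ≡ true) × (Vec.lookup C v ≡ true → v ∈ˢ C)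
∈⇔lookup {v = v} {C} = []=⇒lookup , lookup⇒[]= v C

∉⇒lookup : ∀ {n} {v : Fin n} {C : Subset n} → v ∉ˢ C → Vec.lookup C v ≡ false
∉⇒lookup {v = v} {C} v∉ with Vec.lookup C v in eq
... | false = refl
... | true  = ⊥-elim (v∉ (lookup⇒[]= v C eq))

module _ {n : ℕ} (C : Subset n) {χ : Fin n → Bool} (C≡χ : ∀ v → Vec.lookup C v ≡ χ v) where

  does-contributes : ∀ e → does (contributes? C e) ≡ crosses χ e
  does-contributes e = trans (cong₂ side (trans (does-∈? (end₁ e) C) (C≡χ _)) (trans (does-∈? (end₂ e) C) (C≡χ _))) (value (χ (end₁ e)) (χ (end₂ e)))
    where
    side : Bool → Bool → Bool
    side a b = (a ∧ not b) ∨ (not a ∧ b)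
    value : ∀ a b → side a b ≡ a xor b
    value true  true  = refl
    value true  false = refl
    value false true  = refl
    value false false = refl

  contributing≡ : ∀ E → contributing C E ≡ filterᵇ (crosses χ) E
  contributing≡ = filter≡filterᵇ (contributes? C) does-contributes

  capacity≡ : ∀ E → capacity E C ≡ cut χ E
  capacity≡ E = trans (cong length (contributing≡ E)) (sym (total-bit (crosses χ) E))

cut≡0⇒none : ∀ {n} (χ : Fin n → Bool) (p : Edge n → Bool) E → cut χ E ≡ 0 → filterᵇ (λ e → crosses χ e ∧ p e) E ≡ []
cut≡0⇒none χ p [] _ = refl
cut≡0⇒none χ p (e ∷ E) eq with crosses χ e
... | false = cut≡0⇒none χ p E eq

cut-filterᵇ-all : ∀ {n} (χ : Fin n → Bool) {p : Edge n → Bool} {E} → All (λ e → p e ≡ true) E → cut χ (filterᵇ p E) ≡ cut χ E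
cut-filterᵇ-all χ [] = refl
cut-filterᵇ-all χ {p} {e ∷ E} (pe ∷ ps) rewrite pe = cong (bit (crosses χ e) +_) (cut-filterᵇ-all χ ps)

module _ {n : ℕ} (f : Edge n) (p : Edge n → Bool)
  (sound : ∀ e → p e ≡ true → e ∥ f) (complete : ∀ e → e ∥ f → p e ≡ true) where

  -- In a simple graph the filter removes exactly one edge: after the first edge parallel to `f`, a
  -- second one would be parallel to it.
  cut-remove : ∀ χ {E} → AllPairs (λ e f → ¬ (e ∥ f)) E → Any (f ∥_) E →
    cut χ (filterᵇ (λ e → not (p e)) E) + bit (crosses χ f) ≡ cut χ E
  cut-remove χ {e ∷ E} (ps ∷ qs) f∈ with p e in eq
  ... | true  = trans (cong₂ _+_ (cut-filterᵇ-all χ (All.map none ps)) (cong bit (sym (∥-crosses χ {e} {f} (sound e eq))))) (+-comm _ (bit (crosses χ e)))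
    where
    none : ∀ {g} → ¬ (e ∥ g) → not (p g) ≡ true
    none {g} ¬e∥g with p g in eq′
    ... | false = refl
    ... | true  = ⊥-elim (¬e∥g (∥-trans {e = e} {f} {g} (sound e eq) (∥-sym {e = g} {f} (sound g eq′))))
  ... | false = trans (+-assoc (bit (crosses χ e)) _ _) (cong (bit (crosses χ e) +_) (cut-remove χ qs (tail f∈)))
    where
    tail : Any (f ∥_) (e ∷ E) → Any (f ∥_) E
    tail (here f∥e) with () ← trans (sym (complete e (∥-sym {e = f} {e} f∥e))) eq
    tail (there m) = m

  remains : ∀ {g E} → ¬ (f ∥ g) → Any (g ∥_) E → Any (g ∥_) (filterᵇ (λ e → not (p e)) E)
  remains {g} {e ∷ E} ¬f∥g (here g∥e) with p e in eq
  ... | true  = ⊥-elim (¬f∥g (∥-sym {e = g} {f} (∥-trans {e = g} {e} {f} g∥e (sound e eq))))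
  ... | false = here g∥e
  remains {g} {e ∷ E} ¬f∥g (there m) with p e
  ... | true  = remains {g} ¬f∥g m
  ... | false = there (remains {g} ¬f∥g m)

module _ {n : ℕ} {G : SimpleGraph n} where

  inserting : Query G → Bool
  inserting (failure _ _ _ _ _) = false
  inserting (insertion _ _)     = true

  edge₁ edge₂ : Query G → Edge n
  edge₁ (failure e₁ _ _ _ _) = e₁
  edge₁ (insertion e₁ _)     = e₁
  edge₂ (failure _ e₂ _ _ _) = e₂
  edge₂ (insertion _ e₂)     = e₂

  query-words : ∀ q → queryWords q ≡ bit (inserting q) ∷ endpoints (edge₁ q) ++ endpoints (edge₂ q)
  query-words (failure _ _ _ _ _) = refl
  query-words (insertion _ _)     = refl

  extra : Query G → List (Edge n)
  extra q = if inserting q then edge₁ q ∷ edge₂ q ∷ [] else []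

  kept : Query G → Edge n → Bool
  kept q e = if inserting q then true else not (e ∥ᵇ edge₁ q) ∧ not (e ∥ᵇ edge₂ q)

  -- Splits off the inserted edges and leaves a filter of the original edge list, which can then be
  -- restricted to the stored edges.
  filter-updated : ∀ q (p : Edge n → Bool) → filterᵇ p (updated G q) ≡ filterᵇ p (extra q) ++ filterᵇ (λ e → p e ∧ kept q e) (edges G)
  filter-updated (failure e₁ e₂ _ _ _) p = trans (cong (filterᵇ p) (filter≡filterᵇ (λ e → _) (λ _ → refl) (edges G)))
    (filterᵇ-∧ p (λ e → not (e ∥ᵇ e₁) ∧ not (e ∥ᵇ e₂)) (edges G))
  filter-updated (insertion e₁ e₂) p = trans (filter-++ (T? ∘ p) (e₁ ∷ e₂ ∷ []) (edges G))
    (cong (filterᵇ p (e₁ ∷ e₂ ∷ []) ++_) (filterᵇ-cong (λ e → sym (∧-identityʳ (p e))) (edges G)))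

  -- The capacity is shifted by 2 for failures, which keeps both sides free of subtraction.

  offset : Query G → ℕ
  offset q = if inserting q then 0 else 2

  cut-updated : ∀ q χ → cut χ (updated G q) + offset q ≡ cut χ (edges G) + shift (inserting q) (patternOf (edge₁ q) (edge₂ q) χ)
  cut-updated (insertion e₁ e₂) χ = arith (bit (crosses χ e₁)) (bit (crosses χ e₂)) (cut χ (edges G))
    where
    arith : ∀ a b c → a + (b + c) + 0 ≡ c + (a + b)
    arith = solve-∀
  cut-updated (failure e₁ e₂ in₁ in₂ distinct) χ = begin
    cut χ (updated G q) + 2                                ≡⟨ cong₂ (λ E z → cut χ E + z) stepwise (sym (m+[n∸m]≡n {a + b} {2} (+-mono-≤ (bit≤1 (crosses χ e₁)) (bit≤1 (crosses χ e₂))))) ⟩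
    cut χ E₂ + (a + b + (2 ∸ (a + b)))                     ≡⟨ arith (cut χ E₂) a b _ ⟩
    cut χ E₂ + b + a + (2 ∸ (a + b))                       ≡⟨ cong (λ z → z + a + (2 ∸ (a + b))) (cut-remove e₂ (_∥ᵇ e₂) (λ e → does-true (e ∥? e₂)) (λ e → dec-true (e ∥? e₂)) χ simple₁ still) ⟩
    cut χ E₁ + a + (2 ∸ (a + b))                           ≡⟨ cong (_+ (2 ∸ (a + b))) (cut-remove e₁ (_∥ᵇ e₁) (λ e → does-true (e ∥? e₁)) (λ e → dec-true (e ∥? e₁)) χ (no-parallel G) in₁) ⟩
    cut χ (edges G) + (2 ∸ (a + b))                        ∎
    where
    open ≡-Reasoning
    q = failure e₁ e₂ in₁ in₂ distinct
    a = bit (crosses χ e₁)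
    b = bit (crosses χ e₂)
    E₁ = filterᵇ (λ e → not (e ∥ᵇ e₁)) (edges G)
    E₂ = filterᵇ (λ e → not (e ∥ᵇ e₂)) E₁
    stepwise : updated G q ≡ E₂
    stepwise = trans (filter≡filterᵇ (λ e → _) (λ e → ∧-comm (not (e ∥ᵇ e₁)) (not (e ∥ᵇ e₂))) (edges G))
      (sym (filterᵇ-∧ (λ e → not (e ∥ᵇ e₂)) (λ e → not (e ∥ᵇ e₁)) (edges G)))
    simple₁ : AllPairs (λ e f → ¬ (e ∥ f)) E₁
    simple₁ = AllPairs.filter⁺ (T? ∘ (λ e → not (e ∥ᵇ e₁))) (no-parallel G)
    still : Any (e₂ ∥_) E₁
    still = remains e₁ (_∥ᵇ e₁) (λ e → does-true (e ∥? e₁)) (λ e → dec-true (e ∥? e₁)) {e₂} distinct in₂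
    arith : ∀ c a b d → c + (a + b + d) ≡ c + b + a + d
    arith = solve-∀

-- Word length and the final bounds

n≤2^log : ∀ n → n ≤ 2 ^ ⌈log₂ n ⌉
n≤2^log = <-rec (λ n → n ≤ 2 ^ ⌈log₂ n ⌉) step
  where
  step : ∀ n → (∀ {m} → m < n → m ≤ 2 ^ ⌈log₂ m ⌉) → n ≤ 2 ^ ⌈log₂ n ⌉
  step 0 _ = z≤n
  step 1 _ = ≤-refl
  step n@(suc (suc m)) rec = begin
    n                                ≡⟨ ⌊n/2⌋+⌈n/2⌉≡n n ⟨
    ⌊ n /2⌋ + ⌈ n /2⌉                ≤⟨ +-mono-≤ (⌊n/2⌋≤⌈n/2⌉ n) (≤-reflexive (sym (+-identityʳ _))) ⟩
    2 * ⌈ n /2⌉                      ≤⟨ *-monoʳ-≤ 2 (rec (⌈n/2⌉<n m)) ⟩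
    2 * 2 ^ ⌈log₂ ⌈ n /2⌉ ⌉          ≡⟨ cong (λ z → 2 * 2 ^ z) (⌈log₂⌈n/2⌉⌉≡⌈log₂n⌉∸1 n) ⟩
    2 ^ suc (⌈log₂ n ⌉ ∸ 1)          ≡⟨ cong (2 ^_) (m+[n∸m]≡n (⌈log₂⌉-mono-≤ {2} {n} (s≤s (s≤s z≤n)))) ⟩
    2 ^ ⌈log₂ n ⌉                    ∎
    where open ≤-Reasoning

distinct⇒2≤ : ∀ {n} {s t : Fin n} → s ≢ t → 2 ≤ n
distinct⇒2≤ {1} {zero} {zero} s≢t = ⊥-elim (s≢t refl)
distinct⇒2≤ {suc (suc n)} _ = s≤s (s≤s z≤n)

square-cancel-≤ : ∀ a b → a * a ≤ b * b → a ≤ b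
square-cancel-≤ a b le with a ≤? b
... | yes p = p
... | no ¬p = ⊥-elim (<⇒≱ (*-mono-< (≰⇒> ¬p) (≰⇒> ¬p)) le)

module _ {n M : ℕ} (2≤n : 2 ≤ n) (small : M * M ≤ 64 * (n * n * n)) where

  1≤n : 1 ≤ n
  1≤n = ≤-trans (n≤1+n 1) 2≤n

  M≤8n² : M ≤ 8 * (n * n)
  M≤8n² = square-cancel-≤ M (8 * (n * n)) (≤-trans small (≤-trans (*-monoʳ-≤ 64 (m≤m*n (n * n * n) n {{>-nonZero 1≤n}})) (≤-reflexive (arith n))))
    where
    arith : ∀ n → 64 * (n * n * n * n) ≡ 8 * (n * n) * (8 * (n * n))
    arith = solve-∀

  memorySize : ℕ
  memorySize = 16 + 8 * M + n

  memorySize≤ : memorySize ≤ 81 * (n * n)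
  memorySize≤ = ≤-trans (+-mono-≤ (+-mono-≤ (*-monoʳ-≤ 16 (*-mono-≤ 1≤n 1≤n)) (*-monoʳ-≤ 8 M≤8n²)) (m≤m*n n n {{>-nonZero 1≤n}})) (≤-reflexive (arith (n * n)))
    where
    arith : ∀ m → 16 * m + 8 * (8 * m) + m ≡ 81 * m
    arith = solve-∀

  -- Addresses are at most 81000 n². The constant is below 2²⁸, hence below the 28th power of `b`
  -- since n is at least 2, and n² takes two more factors `b`: this gives the 30 in the word length.
  word-fits : 1000 * memorySize < 2 ^ wordBits 29 n
  word-fits = begin-strict
    1000 * memorySize              ≤⟨ *-monoʳ-≤ 1000 memorySize≤ ⟩
    1000 * (81 * (n * n))          ≡⟨ *-assoc 1000 81 (n * n) ⟨
    81000 * (n * n)                ≤⟨ *-monoʳ-≤ 81000 (*-mono-≤ (n≤2^log n) (n≤2^log n)) ⟩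
    81000 * (b * b)                <⟨ *-monoˡ-< (b * b) {{b*b≢0}} {81000} {2 ^ 28} (<ᵇ⇒< 81000 (2 ^ 28) tt) ⟩
    2 ^ 28 * (b * b)               ≤⟨ *-monoˡ-≤ (b * b) (^-monoˡ-≤ 28 (≤-trans 2≤n (n≤2^log n))) ⟩
    b ^ 28 * (b * b)               ≡⟨ cong (λ z → b ^ 28 * (b * z)) (*-identityʳ b) ⟨
    b ^ 28 * b ^ 2                 ≡⟨ ^-distribˡ-+-* b 28 2 ⟨
    b ^ 30                         ≡⟨ ^-*-assoc 2 ⌈log₂ n ⌉ 30 ⟩
    2 ^ (⌈log₂ n ⌉ * 30)           ≡⟨ cong (2 ^_) (*-comm ⌈log₂ n ⌉ 30) ⟩
    2 ^ wordBits 29 n              ∎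
    where
    open ≤-Reasoning
    b = 2 ^ ⌈log₂ n ⌉
    b*b≢0 : NonZero (b * b)
    b*b≢0 = >-nonZero (*-mono-≤ (m^n>0 2 ⌈log₂ n ⌉) (m^n>0 2 ⌈log₂ n ⌉))

  -- The factor 16 serves both bounds: (M + 1)² is at most 130 n³, which 16² n³ exceeds, and M + 1
  -- is at most twice `1 ⊔ m`.
  linear⇒min : ∀ {m} c {z} → M ≤ m → z ≤ c * suc M → z ≤ c * 16 ·min⟨ m , n ^1·5⟩
  linear⇒min {m} c {z} M≤m z≤ = by-edges , by-nodes
    where
    open ≤-Reasoning
    by-edges : z ≤ c * 16 * (1 ⊔ m)
    by-edges = begin
      z                          ≤⟨ z≤ ⟩
      c * suc M                  ≤⟨ *-monoʳ-≤ c (+-mono-≤ (m≤m⊔n 1 m) (≤-trans M≤m (m≤n⊔m 1 m))) ⟩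
      c * ((1 ⊔ m) + (1 ⊔ m))        ≤⟨ *-monoʳ-≤ c (+-monoʳ-≤ (1 ⊔ m) (m≤n*m (1 ⊔ m) 15)) ⟩
      c * (16 * (1 ⊔ m))         ≡⟨ *-assoc c 16 (1 ⊔ m) ⟨
      c * 16 * (1 ⊔ m)           ∎
    square : suc M * suc M ≤ 256 * (n * n * n)
    square = begin
      suc M * suc M                               ≤⟨ square-bound M ⟩
      2 + 2 * (M * M)                             ≤⟨ +-mono-≤ (*-monoʳ-≤ 2 (*-mono-≤ (*-mono-≤ 1≤n 1≤n) 1≤n)) (*-monoʳ-≤ 2 small) ⟩
      2 * (n * n * n) + 2 * (64 * (n * n * n))    ≡⟨ arith (n * n * n) ⟩
      130 * (n * n * n)                           ≤⟨ *-monoˡ-≤ (n * n * n) (≤ᵇ⇒≤ 130 256 tt) ⟩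
      256 * (n * n * n)                           ∎
      where
      arith : ∀ k → 2 * k + 2 * (64 * k) ≡ 130 * k
      arith = solve-∀
      square-bound : ∀ M → suc M * suc M ≤ 2 + 2 * (M * M)
      square-bound 0 = s≤s z≤n
      square-bound (suc M) = subst (_≤ 2 + 2 * (suc M * suc M)) (sym (left M)) (subst (4 + M * M + 4 * M ≤_) (sym (right M)) (m≤m+n _ (M * M)))
        where
        left : ∀ M → suc (suc M) * suc (suc M) ≡ 4 + M * M + 4 * M
        left = solve-∀
        right : ∀ M → 2 + 2 * (suc M * suc M) ≡ 4 + M * M + 4 * M + M * M
        right = solve-∀
    by-nodes : z ^ 2 ≤ (c * 16) ^ 2 * n ^ 3
    by-nodes = begin
      z ^ 2                                   ≡⟨ square≡ z ⟩
      z * z                                   ≤⟨ *-mono-≤ z≤ z≤ ⟩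
      c * suc M * (c * suc M)                 ≡⟨ regroup c (suc M) ⟩
      c * c * (suc M * suc M)                 ≤⟨ *-monoʳ-≤ (c * c) square ⟩
      c * c * (256 * (n * n * n))             ≡⟨ final c n ⟩
      (c * 16) ^ 2 * n ^ 3                    ∎
      where
      square≡ : ∀ z → z ^ 2 ≡ z * z
      square≡ z = cong (z *_) (*-identityʳ z)
      regroup : ∀ c m → c * m * (c * m) ≡ c * c * (m * m)
      regroup = solve-∀
      final′ : ∀ c n → c * c * (256 * (n * n * n)) ≡ c * 16 * (c * 16) * (n * (n * n))
      final′ = solve-∀
      final : ∀ c n → c * c * (256 * (n * n * n)) ≡ (c * 16) ^ 2 * n ^ 3
      final c n = trans (final′ c n) (sym (cong₂ _*_ (square≡ (c * 16)) (cong (n *_) (square≡ n))))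

abstract

  oracle-cost : ∃[ c ] ∀ m → oracleCost m ≤ c * suc m
  oracle-cost = oracleCost-linear

  -- The additional 8 makes the same constant bound the space, 4 + 8 M words.
  oracleFactor : ℕ
  oracleFactor = proj₁ oracle-cost + 8

  8≤oracleFactor : 8 ≤ oracleFactor
  8≤oracleFactor = m≤n+m 8 (proj₁ oracle-cost)

  oracleCost≤ : ∀ m → oracleCost m ≤ oracleFactor * suc m
  oracleCost≤ m = ≤-trans (proj₂ oracle-cost m) (*-monoˡ-≤ (suc m) (m≤m+n (proj₁ oracle-cost) 8))

-- Assembly for one graph

module Correctness {n : ℕ} (G : SimpleGraph n) (s t : Fin n) (s≢t : s ≢ t) where

  abstract

    sparse : Sparsifier (edges G) s t
    sparse = sparsifier (edges G) (lookup-distinct (no-parallel G)) s t s≢t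

  open Sparsifier sparse

  2≤n : 2 ≤ n
  2≤n = distinct⇒2≤ s≢t

  Z w : ℕ
  Z = memorySize {n} {M} 2≤n small
  w = wordBits 29 n

  device : Device n M
  device = record
    { ed = ed ; s = s ; t = t ; r = r ; Z = Z ; w = w ; n≤Z = m≤n+m n (16 + 8 * M) ; end≤Z = m≤m+n (16 + 8 * M) n
    ; big = word-fits {n} {M} 2≤n small ; r≤2 = r≤2 }

  layout : List ℕ
  layout = Machine.layout device

  M≤m : M ≤ length (edges G)
  M≤m = subst (M ≤_) (sym (trans (↭-length split) (trans (length-++ (tabulate ed)) (cong (_+ length rest) (length-tabulate ed))))) (m≤m+n M _)

  layout-small : length layout ≤ oracleFactor * suc M
  layout-small = ≤-trans (≤-reflexive (Machine.layout-length device)) (≤-trans (+-monoˡ-≤ (M * 8) (≤ᵇ⇒≤ 4 8 tt)) (≤-trans (≤-reflexive (*-comm (suc M) 8)) (*-monoˡ-≤ (suc M) 8≤oracleFactor)))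

  module _ (q : Query G) {σ : State} (A : Machine.Solved device (inserting q) (edge₁ q) (edge₂ q) σ) where

    open Machine.Solved A

    χ : Fin n → Bool
    χ = member vs

    C : Subset n
    C = Vec.tabulate χ

    C≡χ : ∀ v → Vec.lookup C v ≡ χ v
    C≡χ = lookup∘tabulate χ

    weight : (Fin n → Bool) → ℕ
    weight χ = shift (inserting q) (patternOf (edge₁ q) (edge₂ q) χ)

    -- For an (s,t)-cut the indicator terms of the conservation identity become 0 and 1, which turns
    -- it into capacity equals outflow plus flow value.
    cut-stored : ∀ χ → χ s ≡ true → χ t ≡ false → cut χ (tabulate ed) ≡ outflow r χ + value
    cut-stored χ s∈ t∉ = trans (trans (sym (+-identityʳ _)) (trans (cong (cut χ (tabulate ed) +_) (sym (trans (cong (λ b → value * bit b) t∉) (*-zeroʳ value)))) (sym (net χ))))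
      (cong (outflow r χ +_) (trans (cong (λ b → value * bit b) s∈) (*-identityʳ value)))

    cut-all : ∀ χ → cut χ (edges G) ≡ cut χ (tabulate ed) + cut χ rest
    cut-all χ = trans (total-↭ _ split) (total-++ _ (tabulate ed) rest)

    rest-uncut : cut χ rest ≡ 0
    rest-uncut = thin χ tight

    -- The discarded edges are uncut for the reported cut by its tightness; for the competitor they
    -- can only increase the capacity, so comparing stored capacities suffices.
    minimum : ∀ χ′ → χ′ s ≡ true → χ′ t ≡ false → cut χ (updated G q) ≤ cut χ′ (updated G q)
    minimum χ′ s∈ t∉ = +-cancelʳ-≤ (offset q) _ _ (begin
      cut χ (updated G q) + offset q                   ≡⟨ cut-updated q χ ⟩
      cut χ (edges G) + weight χ                       ≡⟨ cong (_+ weight χ) (trans (cut-all χ) (trans (cong (cut χ (tabulate ed) +_) rest-uncut) (+-identityʳ _))) ⟩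
      cut χ (tabulate ed) + weight χ                   ≡⟨ cong (_+ weight χ) (cut-stored χ source∈ sink∉) ⟩
      outflow r χ + value + weight χ                   ≡⟨ swap (outflow r χ) value (weight χ) ⟩
      outflow r χ + weight χ + value                   ≤⟨ +-monoˡ-≤ value (best χ′ s∈ t∉) ⟩
      outflow r χ′ + weight χ′ + value                 ≡⟨ swap (outflow r χ′) (weight χ′) value ⟩
      outflow r χ′ + value + weight χ′                 ≡⟨ cong (_+ weight χ′) (cut-stored χ′ s∈ t∉) ⟨
      cut χ′ (tabulate ed) + weight χ′                 ≤⟨ +-monoˡ-≤ (weight χ′) (≤-trans (m≤m+n _ (cut χ′ rest)) (≤-reflexive (sym (cut-all χ′)))) ⟩
      cut χ′ (edges G) + weight χ′                     ≡⟨ cut-updated q χ′ ⟨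
      cut χ′ (updated G q) + offset q                  ∎)
      where
      open ≤-Reasoning
      swap : ∀ a b c → a + b + c ≡ a + c + b
      swap = solve-∀

    mincut : IsMincut (updated G q) s t C
    mincut = (proj₂ ∈⇔lookup (trans (C≡χ s) source∈) , λ t∈ → true≢false (trans (sym (proj₁ ∈⇔lookup t∈)) (trans (C≡χ t) sink∉)))
      , λ C′ (s∈ , t∉) → subst₂ _≤_ (sym (capacity≡ C C≡χ (updated G q))) (sym (capacity≡ C′ (λ _ → refl) (updated G q)))
          (minimum (Vec.lookup C′) (proj₁ ∈⇔lookup s∈) (∉⇒lookup t∉))
      where
      true≢false : true ≢ false
      true≢false ()

    reportedEdges : List (Edge n)
    reportedEdges = filterᵇ (crosses χ) (extra q) ++ filterᵇ (λ e → crosses χ e ∧ kept q e) (tabulate ed)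

    -- A permutation, because the stored edges come in a different order from those of the graph;
    -- the discarded edges drop out since none of them crosses.
    contributing-reported : contributing C (updated G q) ↭ reportedEdges
    contributing-reported = ↭-trans (↭-reflexive (trans (contributing≡ C C≡χ (updated G q)) (filter-updated q (crosses χ))))
      (++⁺ˡ (filterᵇ (crosses χ) (extra q)) (↭-trans (filter-↭ (T? ∘ sel) split) (↭-reflexive
        (trans (filter-++ (T? ∘ sel) (tabulate ed) rest) (trans (cong (filterᵇ sel (tabulate ed) ++_) (cut≡0⇒none χ (kept q) rest rest-uncut)) (++-identityʳ _))))))
      where
      sel : Edge n → Bool
      sel e = crosses χ e ∧ kept q e

    reported : Reports (out σ) (updated G q) C
    reported = vs , reportedEdges , reports , unique
      , (λ v → mk⇔ (λ v∈ → proj₂ ∈⇔lookup (trans (C≡χ v) (dec-true (v ∈ᶠ? vs) v∈)))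
                   (λ v∈ → does-true (v ∈ᶠ? vs) (trans (sym (C≡χ v)) (proj₁ ∈⇔lookup v∈))))
      , Homogeneous.sym (λ {e} {f} → ∥-sym {e = e} {f}) (Homogeneous.map (λ { {e} refl → ∥-refl {e = e} }) (↭⇒↭ₛ contributing-reported))

  run-query : ∀ (q : Query G) → Run w oracle (initial layout q) (oracleCost M) (Machine.Solved device (inserting q) (edge₁ q) (edge₂ q))
  run-query q = Machine.run-oracle device χ₀ χ₀-source χ₀-sink χ₀-closed (inserting q) (edge₁ q) (edge₂ q) refl refl (λ a → cong (λ ws → contents ws a) (query-words q))

  structure : Σ[ D ∈ List ℕ ]
    Fits w D
    × length D ≤ oracleFactor * 16 ·min⟨ ∣E G ∣ , n ^1·5⟩
    × (∀ (q : Query G) → Σ[ σ ∈ State ] Σ[ τ ∈ ℕ ] Σ[ C ∈ Subset n ]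
      Exec w oracle (initial D q) σ τ
      × τ ≤ oracleFactor * 16 ·min⟨ ∣E G ∣ , n ^1·5⟩
      × IsMincut (updated G q) s t C
      × Reports (out σ) (updated G q) C)
  structure = layout , Machine.layout-fits device , linear⇒min {n} {M} 2≤n small {∣E G ∣} oracleFactor {length layout} M≤m layout-small , answer
    where
    answer : ∀ (q : Query G) → Σ[ σ ∈ State ] Σ[ τ ∈ ℕ ] Σ[ C ∈ Subset n ]
      Exec w oracle (initial layout q) σ τ
      × τ ≤ oracleFactor * 16 ·min⟨ ∣E G ∣ , n ^1·5⟩
      × IsMincut (updated G q) s t C
      × Reports (out σ) (updated G q) C
    answer q = let σ , τ , run , τ≤ , A = run-query q in
      σ , τ , C q A , run , linear⇒min {n} {M} 2≤n small {∣E G ∣} oracleFactor {τ} M≤m (≤-trans τ≤ (oracleCost≤ M)) , mincut q A , reported q A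

theorem5 : Σ[ P ∈ Program ] Σ[ c ∈ ℕ ] Σ[ k ∈ ℕ ]
    (∀ (n : ℕ) (G : SimpleGraph n) (s t : Fin n) → s ≢ t →
    Σ[ D ∈ List ℕ ]
    Fits (wordBits k n) D
    × length D ≤ c ·min⟨ ∣E G ∣ , n ^1·5⟩
    × (∀ (q : Query G) →
    Σ[ σ ∈ State ] Σ[ τ ∈ ℕ ] Σ[ C ∈ Subset n ]
    Exec (wordBits k n) P (initial D q) σ τ
    × τ ≤ c ·min⟨ ∣E G ∣ , n ^1·5⟩
    × IsMincut (updated G q) s t C
    × Reports (out σ) (updated G q) C))
theorem5 = oracle , oracleFactor * 16 , 29 , λ n G s t s≢t → Correctness.structure G s t s≢t
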